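{- For integers $n\ge 1$ and $0\le k\le n!$, let $T(n,k)$ denote the number of orbits of the action of $\mathfrak{S}_n\times\mathfrak{S}_n$ on the family of $k$-element subsets of $\mathfrak{S}_n$ given by $(g_1,g_2)\cdot\{x_1,\dots,x_k\}=\{g_1x_1g_2,\dots,g_1x_kg_2\}$, and let $\Lambda_n(k)=\frac{1}{n!^2}\binom{n!}{k}$. Then, as $n\to\infty$, \[T(n,k)=\Lambda_n(k)\,(1+o_n(1))\] uniformly for $3\le k\le n!-3$. Moreover, the $o_n(1)$ term can be taken to be $O(n^{ -2})$: there is a constant $C>0$ such that for all $n$ and all $3\le k\le n!-3$, \[\left|\frac{T(n,k)}{\Lambda_n(k)}-1\right|\le \frac{C}{n^2}.\] In this statement, neither the range $[3,n!-3]$ nor the quadratic rate can be improved: the asymptotic $T(n,k)\sim\Lambda_n(k)$ fails for $k=2$ (and $k=n!-2$), and $n^{ -2}$ cannot be replaced by $n^{ -a}$ with $a>2$ uniformly over $3\le k\le n!-3$.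
   Context: $\mathfrak{S}_n$ is the symmetric group on $\{1,\dots,n\}$. Products $g_1x_ig_2$ are products in $\mathfrak{S}_n$. -}

module Defs where

open import Data.Nat as ℕ using (ℕ; zero; suc; _!)
open import Data.Nat.Combinatorics using (_C_)
open import Data.Fin as F using (Fin)
open import Data.Fin.Properties as FP using ()
open import Data.Vec as V using (Vec; []; _∷_; lookup; tabulate; toList)
open import Data.Vec.Properties using (≡-dec)
open import Data.List as L using (List; []; _∷_; [_]; _++_; concatMap; allFin; filter; length)
open import Data.List.Relation.Unary.All using (All)
open import Data.List.Relation.Unary.All.Properties using ()
import Data.List.Relation.Unary.All as All
open import Data.List.Relation.Unary.Any using (Any; any?)
open import Data.List.Relation.Unary.Unique.Propositional using (Unique)
open import Data.Product using (_×_)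
open import Data.Integer using (+_)
open import Data.Rational as Q using (ℚ; 0ℚ; 1ℚ; _÷_; _*_)
open import Data.Rational.Properties using () renaming (_≟_ to _≟ℚ_)
open import Relation.Nullary using (Dec; yes; no; ¬_)
open import Relation.Nullary.Decidable using (_×-dec_)
open import Relation.Binary.Definitions using (DecidableEquality)
open import Relation.Binary.PropositionalEquality using (_≡_)

-- The symmetric group 𝔖ₙ, represented concretely.
-- A permutation of {1,…,n} ≅ Fin n is stored as its table of values
-- (a vector v with v[i] = σ(i)); it is a permutation iff the entries
-- are pairwise distinct (an injective map Fin n → Fin n is a bijection).

Perm : ℕ → Set
Perm n = Vec (Fin n) n

_≟P_ : ∀ {n} → DecidableEquality (Perm n)
_≟P_ = ≡-dec F._≟_

allVecs : (m n : ℕ) → List (Vec (Fin m) n)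
allVecs m zero    = [ [] ]
allVecs m (suc n) = concatMap (λ i → L.map (i ∷_) (allVecs m n)) (allFin m)

IsPerm : ∀ {n} → Perm n → Set
IsPerm v = Unique (toList v)

isPerm? : ∀ {n} (v : Perm n) → Dec (IsPerm v)
isPerm? v = unique? (toList v)
  where open import Data.List.Relation.Unary.Unique.DecPropositional F._≟_ using (unique?)

Sym : (n : ℕ) → List (Perm n)
Sym n = filter isPerm? (allVecs n n)

_·_ : ∀ {n} → Perm n → Perm n → Perm n
x · y = tabulate (λ i → lookup x (lookup y i))

-- k-element subsets of a finite set given by a duplicate-free list:
-- each k-subset is represented exactly once as a sublist of length k.

choose : ∀ {a} {A : Set a} → ℕ → List A → List (List A)
choose zero    xs       = [ [] ]
choose (suc k) []       = []
choose (suc k) (x ∷ xs) = L.map (x ∷_) (choose k xs) ++ choose (suc k) xs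

module _ {n : ℕ} where
  open import Data.List.Membership.DecPropositional (_≟P_ {n}) using (_∈_; _∈?_)

  SameSet : List (Perm n) → List (Perm n) → Set
  SameSet xs ys = All (_∈ ys) xs × All (_∈ xs) ys

  sameSet? : ∀ xs ys → Dec (SameSet xs ys)
  sameSet? xs ys = All.all? (_∈? ys) xs ×-dec All.all? (_∈? xs) ys

act : ∀ {n} → Perm n → Perm n → List (Perm n) → List (Perm n)
act g₁ g₂ S = L.map (λ x → (g₁ · x) · g₂) S

SameOrbit : (n : ℕ) → List (Perm n) → List (Perm n) → Set
SameOrbit n S S' = Any (λ g₁ → Any (λ g₂ → SameSet (act g₁ g₂ S) S') (Sym n)) (Sym n)

sameOrbit? : (n : ℕ) → ∀ S S' → Dec (SameOrbit n S S')
sameOrbit? n S S' = any? (λ g₁ → any? (λ g₂ → sameSet? (act g₁ g₂ S) S') (Sym n)) (Sym n)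

-- Number of equivalence classes of a decidable equivalence relation on
-- the elements of a list: count the elements not related to any
-- previously counted element.
countClasses : ∀ {a r} {A : Set a} (R : A → A → Set r) →
               (∀ x y → Dec (R x y)) → List A → ℕ
countClasses {A = A} R R? = go []
  where
  go : List A → List A → ℕ
  go seen []       = 0
  go seen (x ∷ xs) with any? (λ y → R? y x) seen
  ... | yes _ = go seen xs
  ... | no  _ = suc (go (x ∷ seen) xs)

T : ℕ → ℕ → ℕ
T n k = countClasses (SameOrbit n) (sameOrbit? n) (choose k (Sym n))

ℕtoℚ : ℕ → ℚ
ℕtoℚ m = + m Q./ 1

-- division p / q, used only where q ≠ 0 (returns 0 when q = 0)
_//_ : ℚ → ℚ → ℚ
p // q with q ≟ℚ 0ℚ
... | yes _  = 0ℚ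
... | no q≢0 = (p ÷ q) {{Q.≢-nonZero q≢0}}

_^ℚ_ : ℚ → ℕ → ℚ
p ^ℚ zero  = 1ℚ
p ^ℚ suc m = p * (p ^ℚ m)

Λ : ℕ → ℕ → ℚ
Λ n k = ℕtoℚ ((n !) C k) // ℕtoℚ ((n !) ℕ.* (n !))

err : ℕ → ℕ → ℚ
err n k = Q.∣ (ℕtoℚ (T n k) // Λ n k) Q.- 1ℚ ∣

{-# OPTIONS --safe #-}

-- Write N = n! and let (g , h) act by φ x = g x h.  By Burnside's lemma N² T(n,k) is the sum over
-- all (g , h) of the number of φ-invariant k-subsets.  The identity contributes (N choose k), so
-- T/Λ − 1 is the sum over (g , h) ≠ (1 , 1) (the "excess") divided by (N choose k).
--
-- For one φ with f fixed points, f₂ and f₃ being the numbers of fixed points of φ² and φ³, the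
-- proportion of invariant k-sets is O((f³ + f f₂ + f₂ + f₃ + 1) / N³) uniformly in 3 ≤ k ≤ N − 3.
-- Indeed a k-set meeting the support of φ in at most 4 points is described by those points, and
-- an invariant set S meeting it in more is determined by S ∩ R for a maximal independent set R
-- of the graph x — φ x; moving the other ≥ 3 points of S outside R freely yields ≥ c N³ sets.
--
-- If g ≠ 1 then f ≤ c(g), the order of the centralizer, and the values f(g , h) sum to N over h.
-- So everything reduces to Σ_{g ≠ 1} c(g)² = O(N²/n²).  If g has support of size t, c(g) is at most
-- (n−t)! t! / ⌈t/2⌉!.  For 4t ≤ n it is enough to count the g with given t; for 4t > n this
-- beats the number Σ c(g) ≤ 4ⁿ N of commuting pairs.  The terms with f₂, f₃ are controlled by
-- the rarity of the solutions of g² = 1 and g³ = 1.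
--
-- For k = 3 the pairs of transpositions alone contribute ≥ c/n² to T/Λ − 1.  For k = 2 and
-- k = N − 2 one has T ≥ 1 while Λ < 1/2.
module Submission where

open import Defs
open import Data.Nat using (ℕ; zero; suc; _+_; _*_; _∸_; _^_; _!; _≤_; _<_; z≤n; s≤s; s≤s⁻¹; NonZero; >-nonZero; ≢-nonZero; _≤?_; _<?_) renaming (_≟_ to _≟ℕ_)
import Data.Nat
import Data.Rational
open import Data.Nat.Properties as ℕₚ using (≤-refl; ≤-trans; ≤-reflexive; <⇒≤; +-mono-≤; +-monoˡ-≤; +-monoʳ-≤; *-mono-≤; *-monoˡ-≤; *-monoʳ-≤; +-comm; +-assoc; +-identityʳ; *-comm; *-assoc; *-identityˡ; *-identityʳ; *-zeroʳ; *-distribˡ-+; *-distribʳ-+; m≤m+n; m≤n+m; module ≤-Reasoning)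
open import Data.Nat.Combinatorics using (_C_; nCk+nC[k+1]≡[n+1]C[k+1]; nC1≡n; nCk≡nC[n∸k])
open import Data.Nat.Tactic.RingSolver using (solve-∀)
open import Data.Fin using (Fin; zero; suc; toℕ; fromℕ<)
open import Data.Nat.DivMod using (_/_; m/n*n≤m; m≡m%n+[m/n]*n; m%n<n)
open import Data.Fin.Properties as Finₚ using () renaming (_≟_ to _≟F_)
open import Data.Vec using (Vec; []; _∷_; lookup; tabulate; toList)
import Data.Vec.Properties as Vecₚ
open import Data.List using (List; []; _∷_; _++_; map; concatMap; allFin; filter; length; upTo; cartesianProduct)
import Data.List.Properties as Listₚ
open import Data.List.Relation.Unary.All as All using (All; []; _∷_)
open import Data.List.Relation.Unary.Any as Any using (Any; here; there)
open import Data.List.Relation.Unary.AllPairs using ([]; _∷_)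
open import Data.List.Relation.Unary.Unique.Propositional using (Unique)
import Data.List.Relation.Unary.Unique.Propositional.Properties as Uniqueₚ
open import Data.List.Membership.Propositional using (_∈_; _∉_; find; lose)
import Data.List.Membership.Propositional.Properties as ∈ₚ
open import Data.List.Relation.Binary.Permutation.Propositional using (_↭_; ↭-sym; ↭-trans; refl; prep; swap; trans)
import Data.List.Relation.Binary.Permutation.Propositional.Properties as ↭ₚ
open import Data.Product using (∃; _×_; _,_; proj₁; proj₂)
open import Data.Product.Properties using () renaming (≡-dec to ×-≡-dec)
open import Data.Sum using (_⊎_; inj₁; inj₂)
open import Data.Empty using (⊥)
open import Function using (_∘_; id)
open import Relation.Nullary using (¬_; Dec; yes; no; contradiction)
open import Relation.Nullary.Decidable using (_×-dec_; ¬?)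
open import Relation.Unary using (Decidable)
open import Relation.Binary.Definitions using (DecidableEquality)
open import Relation.Binary.PropositionalEquality using (_≡_; _≢_; refl; sym; cong; cong₂; subst; subst₂; module ≡-Reasoning) renaming (trans to ≡-trans)
open import Data.Integer as ℤ using ()
import Data.Integer.Properties as ℤₚ
open import Data.Rational as ℚ using (ℚ; 0ℚ; 1ℚ)
import Data.Rational.Properties as ℚₚ
open import Data.Rational.Solver using (module +-*-Solver)
open import Data.Rational.Unnormalised as ℚᵘ using (mkℚᵘ; *≡*; *≤*)
import Data.Rational.Unnormalised.Properties as ℚᵘₚ

-- Sums over lists

-- The estimate for a single φ compares each term with a term of a Vandermonde sum: points whose
-- position φ forces are traded for freely chosen moved points. Squares of centralizer orders arise
-- from f³ ≤ c(g)² f, after which f can be summed over h. The g with support of size t contribute at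
-- most N f! t! 2ᵗ to Σ c². For t = 2 this is of the true order N²/n²; for 3 ≤ t ≤ n/4 it is smaller
-- by a factor n, which pays for the number of values of t. For t near n it is useless, about 2ⁿ N²,
-- and there the largest c is combined with a bound on Σ c. That sum is N times the number of
-- partitions of n; partitions are avoided by encoding an element of the centralizer of z as a map
-- constant on the cycles of z and by counting pairs (map, permutation preserving its fibres). The
-- numbers f₂ and f₃ can equal N, for instance f₂ when g and h are both involutions, so only
-- averaging over pairs controls them. Small n, for which f ≤ N/4 may fail, are absorbed in the
-- constant.

private variable
  A B : Set
  P Q : A → Set

*-exchange : ∀ a b c → a * (b * c) ≡ b * (a * c)
*-exchange = solve-∀

+-exchange : ∀ a b c → a + (b + c) ≡ b + (a + c)
+-exchange = solve-∀

+-interchange : ∀ a b c d → (a + b) + (c + d) ≡ (a + c) + (b + d)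
+-interchange = solve-∀

∑ : List A → (A → ℕ) → ℕ
∑ []       f = 0
∑ (x ∷ xs) f = f x + ∑ xs f

𝟙 : {P : Set} → Dec P → ℕ
𝟙 (yes _) = 1
𝟙 (no  _) = 0

𝟙-yes : {P : Set} (p? : Dec P) → P → 𝟙 p? ≡ 1
𝟙-yes (yes _) _ = refl
𝟙-yes (no ¬p) p = contradiction p ¬p

𝟙-no : {P : Set} (p? : Dec P) → ¬ P → 𝟙 p? ≡ 0
𝟙-no (yes p) ¬p = contradiction p ¬p
𝟙-no (no _)  _  = refl

𝟙-≤ : {P : Set} (p? : Dec P) {m : ℕ} → (P → 1 ≤ m) → 𝟙 p? ≤ m
𝟙-≤ (yes p) h = h p
𝟙-≤ (no _)  _ = z≤n

𝟙*-≤ : {P : Set} (p? : Dec P) {c m : ℕ} → (P → c ≤ m) → 𝟙 p? * c ≤ m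
𝟙*-≤ (yes p) {c} h rewrite +-identityʳ c = h p
𝟙*-≤ (no _)  _ = z≤n

𝟙≤1 : {P : Set} (p? : Dec P) → 𝟙 p? ≤ 1
𝟙≤1 p? = 𝟙-≤ p? (λ _ → ≤-refl)

𝟙-mono : {P Q : Set} (p? : Dec P) (q? : Dec Q) → (P → Q) → 𝟙 p? ≤ 𝟙 q?
𝟙-mono p? q? f = 𝟙-≤ p? (λ p → ≤-reflexive (sym (𝟙-yes q? (f p))))

𝟙-cong : {P Q : Set} (p? : Dec P) (q? : Dec Q) → (P → Q) → (Q → P) → 𝟙 p? ≡ 𝟙 q?
𝟙-cong p? q? f g = ℕₚ.≤-antisym (𝟙-mono p? q? f) (𝟙-mono q? p? g)

𝟙-product : {P Q R : Set} (r? : Dec R) (p? : Dec P) (q? : Dec Q) → (R → P × Q) → (P → Q → R) → 𝟙 r? ≡ 𝟙 p? * 𝟙 q?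
𝟙-product r? (yes p) q? f g = ≡-trans (𝟙-cong r? q? (proj₂ ∘ f) (g p)) (sym (+-identityʳ _))
𝟙-product r? (no ¬p) q? f g = 𝟙-no r? (¬p ∘ proj₁ ∘ f)

∑-mono : {f g : A → ℕ} (xs : List A) → (∀ {x} → x ∈ xs → f x ≤ g x) → ∑ xs f ≤ ∑ xs g
∑-mono []       h = z≤n
∑-mono (x ∷ xs) h = +-mono-≤ (h (here refl)) (∑-mono xs (h ∘ there))

∑-cong : {f g : A → ℕ} (xs : List A) → (∀ {x} → x ∈ xs → f x ≡ g x) → ∑ xs f ≡ ∑ xs g
∑-cong []       h = refl
∑-cong (x ∷ xs) h = cong₂ _+_ (h (here refl)) (∑-cong xs (h ∘ there))

∑-+ : (f g : A → ℕ) (xs : List A) → ∑ xs (λ x → f x + g x) ≡ ∑ xs f + ∑ xs g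
∑-+ f g []       = refl
∑-+ f g (x ∷ xs) rewrite ∑-+ f g xs = +-interchange (f x) (g x) (∑ xs f) (∑ xs g)

∑-*ˡ : (c : ℕ) (f : A → ℕ) (xs : List A) → ∑ xs (λ x → c * f x) ≡ c * ∑ xs f
∑-*ˡ c f []       = sym (*-zeroʳ c)
∑-*ˡ c f (x ∷ xs) rewrite ∑-*ˡ c f xs = sym (*-distribˡ-+ c (f x) (∑ xs f))

∑-*ʳ : (f : A → ℕ) (c : ℕ) (xs : List A) → ∑ xs (λ x → f x * c) ≡ ∑ xs f * c
∑-*ʳ f c []       = refl
∑-*ʳ f c (x ∷ xs) rewrite ∑-*ʳ f c xs = sym (*-distribʳ-+ c (f x) (∑ xs f))

∑-const : (c : ℕ) (xs : List A) → ∑ xs (λ _ → c) ≡ length xs * c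
∑-const c []       = refl
∑-const c (x ∷ xs) = cong (c +_) (∑-const c xs)

∑-1 : (xs : List A) → ∑ xs (λ _ → 1) ≡ length xs
∑-1 xs = ≡-trans (∑-const 1 xs) (*-identityʳ _)

∑-0 : {f : A → ℕ} (xs : List A) → (∀ {x} → x ∈ xs → f x ≡ 0) → ∑ xs f ≡ 0
∑-0 xs h = ≡-trans (∑-cong xs h) (≡-trans (∑-const 0 xs) (*-zeroʳ (length xs)))

∑-≤-const : {f : A → ℕ} (c : ℕ) (xs : List A) → (∀ {x} → x ∈ xs → f x ≤ c) → ∑ xs f ≤ length xs * c
∑-≤-const c xs h = ≤-trans (∑-mono xs h) (≤-reflexive (∑-const c xs))

∑-swap : (f : A → B → ℕ) (xs : List A) (ys : List B) →
         ∑ xs (λ x → ∑ ys (f x)) ≡ ∑ ys (λ y → ∑ xs (λ x → f x y))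
∑-swap f []       ys = sym (∑-0 ys (λ _ → refl))
∑-swap f (x ∷ xs) ys rewrite ∑-swap f xs ys = sym (∑-+ (f x) _ ys)

∑-++ : (f : A → ℕ) (xs ys : List A) → ∑ (xs ++ ys) f ≡ ∑ xs f + ∑ ys f
∑-++ f []       ys = refl
∑-++ f (x ∷ xs) ys rewrite ∑-++ f xs ys = sym (+-assoc (f x) _ _)

∑-map : (f : B → ℕ) (g : A → B) (xs : List A) → ∑ (map g xs) f ≡ ∑ xs (f ∘ g)
∑-map f g []       = refl
∑-map f g (x ∷ xs) = cong (f (g x) +_) (∑-map f g xs)

∑-concatMap : (f : B → ℕ) (g : A → List B) (xs : List A) →
              ∑ (concatMap g xs) f ≡ ∑ xs (λ x → ∑ (g x) f)
∑-concatMap f g []       = refl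
∑-concatMap f g (x ∷ xs) rewrite ∑-++ f (g x) (concatMap g xs) = cong (∑ (g x) f +_) (∑-concatMap f g xs)

∑-filter : (P? : Decidable P) (f : A → ℕ) (xs : List A) →
           ∑ (filter P? xs) f ≡ ∑ xs (λ x → 𝟙 (P? x) * f x)
∑-filter P? f [] = refl
∑-filter P? f (x ∷ xs) with P? x
... | yes _ = cong₂ _+_ (sym (+-identityʳ _)) (∑-filter P? f xs)
... | no _  = ∑-filter P? f xs

length-filter : (P? : Decidable P) (xs : List A) → length (filter P? xs) ≡ ∑ xs (λ x → 𝟙 (P? x))
length-filter P? xs = ≡-trans (sym (∑-1 (filter P? xs)))
  (≡-trans (∑-filter P? (λ _ → 1) xs) (∑-cong xs (λ _ → *-identityʳ _)))

∑-∈ : {f : A → ℕ} {x : A} {xs : List A} → x ∈ xs → f x ≤ ∑ xs f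
∑-∈ (here refl) = m≤m+n _ _
∑-∈ (there x∈)  = ≤-trans (∑-∈ x∈) (m≤n+m _ _)

∑-↭ : (f : A → ℕ) {xs ys : List A} → xs ↭ ys → ∑ xs f ≡ ∑ ys f
∑-↭ f refl         = refl
∑-↭ f (prep x p)   = cong (f x +_) (∑-↭ f p)
∑-↭ f (swap x y p) rewrite ∑-↭ f p = +-exchange (f x) (f y) _
∑-↭ f (trans p q)  = ≡-trans (∑-↭ f p) (∑-↭ f q)

filter-split-↭ : (P? : Decidable P) (xs : List A) → xs ↭ filter P? xs ++ filter (¬? ∘ P?) xs
filter-split-↭ P? [] = refl
filter-split-↭ P? (x ∷ xs) with P? x
... | yes _ = prep x (filter-split-↭ P? xs)
... | no _  = ↭-trans (prep x (filter-split-↭ P? xs)) (↭-sym (↭ₚ.shift x (filter P? xs) _))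

∑-atMostOne : (P? : Decidable P) {xs : List A} → Unique xs →
              (∀ {x y} → x ∈ xs → y ∈ xs → P x → P y → x ≡ y) → ∑ xs (λ x → 𝟙 (P? x)) ≤ 1
∑-atMostOne P? [] h = z≤n
∑-atMostOne P? {x ∷ xs} (x# ∷ u) h with P? x
... | no _   = ∑-atMostOne P? u (λ i j → h (there i) (there j))
... | yes px = s≤s (≤-reflexive (∑-0 xs (λ {y} y∈ → 𝟙-no (P? y)
                 (λ py → All.lookup x# y∈ (h (here refl) (there y∈) px py)))))

-- Double counting over the pairs (x , y) with f x ≡ y: each x finds its y in `ys`, and each y is
-- hit by at most one x. The predicate marks the part of `xs` on which f is injective and lands in
-- `ys`; most cardinality bounds below are instances.
∑-injection : (_≟_ : DecidableEquality B) {xs : List A} {ys : List B} → Unique xs →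
              (P? : Decidable P) (f : A → B) (w : B → ℕ) →
              (∀ {x} → x ∈ xs → P x → f x ∈ ys) →
              (∀ {x y} → x ∈ xs → y ∈ xs → P x → P y → f x ≡ f y → x ≡ y) →
              ∑ xs (λ x → 𝟙 (P? x) * w (f x)) ≤ ∑ ys w
∑-injection _≟_ {xs} {ys} u P? f w into inj = begin
  ∑ xs (λ x → 𝟙 (P? x) * w (f x))                                ≤⟨ ∑-mono xs (λ {x} x∈ → 𝟙*-≤ (P? x) (pick x∈)) ⟩
  ∑ xs (λ x → ∑ ys (λ y → 𝟙 (P? x ×-dec (f x ≟ y)) * w y))       ≡⟨ ∑-swap _ xs ys ⟩
  ∑ ys (λ y → ∑ xs (λ x → 𝟙 (P? x ×-dec (f x ≟ y)) * w y))       ≤⟨ ∑-mono ys (λ {y} _ → collapse y) ⟩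
  ∑ ys w                                                         ∎
  where
  open ≤-Reasoning
  pick : ∀ {x} → x ∈ xs → _ → w (f x) ≤ ∑ ys (λ y → 𝟙 (P? x ×-dec (f x ≟ y)) * w y)
  pick {x} x∈ px = ≤-trans
    (≤-reflexive (sym (≡-trans (cong (_* w (f x)) (𝟙-yes (P? x ×-dec (f x ≟ f x)) (px , refl))) (*-identityˡ _))))
    (∑-∈ {f = λ y → 𝟙 (P? x ×-dec (f x ≟ y)) * w y} (into x∈ px))
  collapse : ∀ y → ∑ xs (λ x → 𝟙 (P? x ×-dec (f x ≟ y)) * w y) ≤ w y
  collapse y = ≤-trans (≤-reflexive (∑-*ʳ _ (w y) xs)) (≤-trans
    (*-monoˡ-≤ (w y) (∑-atMostOne (λ x → P? x ×-dec (f x ≟ y)) u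
      (λ i j p q → inj i j (proj₁ p) (proj₁ q) (≡-trans (proj₂ p) (sym (proj₂ q))))))
    (≤-reflexive (*-identityˡ _)))

count-injection : (_≟_ : DecidableEquality B) {xs : List A} {ys : List B} → Unique xs →
                  (P? : Decidable P) (f : A → B) →
                  (∀ {x} → x ∈ xs → P x → f x ∈ ys) →
                  (∀ {x y} → x ∈ xs → y ∈ xs → P x → P y → f x ≡ f y → x ≡ y) →
                  ∑ xs (λ x → 𝟙 (P? x)) ≤ length ys
count-injection _≟_ {xs} {ys} u P? f into inj = begin
  ∑ xs (λ x → 𝟙 (P? x))       ≡⟨ ∑-cong xs (λ _ → sym (*-identityʳ _)) ⟩
  ∑ xs (λ x → 𝟙 (P? x) * 1)   ≤⟨ ∑-injection _≟_ u P? f (λ _ → 1) into inj ⟩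
  ∑ ys (λ _ → 1)              ≡⟨ ∑-1 ys ⟩
  length ys                   ∎
  where open ≤-Reasoning

∑-reindex-≤ : (_≟_ : DecidableEquality B) {xs : List A} {ys : List B} → Unique xs → (f : A → B) (w : B → ℕ) →
              (∀ {x} → x ∈ xs → f x ∈ ys) →
              (∀ {x y} → x ∈ xs → y ∈ xs → f x ≡ f y → x ≡ y) →
              ∑ xs (w ∘ f) ≤ ∑ ys w
∑-reindex-≤ _≟_ {xs} {ys} u f w into inj = ≤-trans
  (≤-reflexive (∑-cong xs (λ _ → sym (*-identityˡ _))))
  (∑-injection _≟_ u (λ _ → yes tt) f w (λ x∈ _ → into x∈) (λ i j _ _ → inj i j))
  where open import Data.Unit using (tt)

length-injection : (_≟_ : DecidableEquality B) {xs : List A} {ys : List B} → Unique xs → (f : A → B) →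
                   (∀ {x} → x ∈ xs → f x ∈ ys) →
                   (∀ {x y} → x ∈ xs → y ∈ xs → f x ≡ f y → x ≡ y) → length xs ≤ length ys
length-injection _≟_ {xs} {ys} u f into inj = begin
  length xs        ≡⟨ ∑-1 xs ⟨
  ∑ xs (λ _ → 1)   ≤⟨ ∑-reindex-≤ _≟_ u f (λ _ → 1) into inj ⟩
  ∑ ys (λ _ → 1)   ≡⟨ ∑-1 ys ⟩
  length ys        ∎
  where open ≤-Reasoning

-- Counting subsets

∑-choose-∷ : (F : List A → ℕ) (k : ℕ) (x : A) (xs : List A) →
  ∑ (choose (suc k) (x ∷ xs)) F ≡ ∑ (choose k xs) (F ∘ (x ∷_)) + ∑ (choose (suc k) xs) F
∑-choose-∷ F k x xs rewrite ∑-++ F (map (x ∷_) (choose k xs)) (choose (suc k) xs)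
                          | ∑-map F (x ∷_) (choose k xs) = refl

∑-choose-0 : (F : List A → ℕ) (xs : List A) → ∑ (choose 0 xs) F ≡ F []
∑-choose-0 F xs = +-identityʳ _

length-choose : (k : ℕ) (xs : List A) → length (choose k xs) ≡ length xs C k
length-choose zero    xs = refl
length-choose (suc k) [] = refl
length-choose (suc k) (x ∷ xs) = begin
  length (map (x ∷_) (choose k xs) ++ choose (suc k) xs)     ≡⟨ Listₚ.length-++ (map (x ∷_) (choose k xs)) ⟩
  length (map (x ∷_) (choose k xs)) + length (choose (suc k) xs) ≡⟨ cong₂ _+_ (≡-trans (Listₚ.length-map (x ∷_) (choose k xs)) (length-choose k xs)) (length-choose (suc k) xs) ⟩
  length xs C k + length xs C suc k                          ≡⟨ nCk+nC[k+1]≡[n+1]C[k+1] (length xs) k ⟩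
  suc (length xs) C suc k                                    ∎
  where open ≡-Reasoning

-- `choose` keeps the order of the given list, so rearranging a set into blocks changes the sublists
-- themselves; an F blind to order does not notice. In the transposition case the two leading
-- entries are peeled off together.
∑-choose-↭ : (F : List A → ℕ) → (∀ {S S′} → S ↭ S′ → F S ≡ F S′) → (k : ℕ) {xs ys : List A} → xs ↭ ys →
             ∑ (choose k xs) F ≡ ∑ (choose k ys) F
∑-choose-↭ F F-↭ zero p = refl
∑-choose-↭ F F-↭ (suc k) refl = refl
∑-choose-↭ F F-↭ (suc k) (trans p q) = ≡-trans (∑-choose-↭ F F-↭ (suc k) p) (∑-choose-↭ F F-↭ (suc k) q)
∑-choose-↭ F F-↭ (suc k) (prep {xs} {ys} x p)
  rewrite ∑-choose-∷ F k x xs | ∑-choose-∷ F k x ys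
        | ∑-choose-↭ F F-↭ (suc k) p
        | ∑-choose-↭ (F ∘ (x ∷_)) (F-↭ ∘ prep x) k p = refl
∑-choose-↭ F F-↭ (suc zero) (swap {xs} {ys} x y p)
  rewrite ∑-choose-∷ F 0 x (y ∷ xs) | ∑-choose-∷ F 0 y xs | ∑-choose-∷ F 0 y (x ∷ ys) | ∑-choose-∷ F 0 x ys
        | ∑-choose-↭ F F-↭ 1 p = +-exchange (F (x ∷ []) + 0) (F (y ∷ []) + 0) _
∑-choose-↭ F F-↭ (suc (suc k)) (swap {xs} {ys} x y p)
  rewrite ∑-choose-∷ F (suc k) x (y ∷ xs) | ∑-choose-∷ F (suc k) y xs
        | ∑-choose-∷ F (suc k) y (x ∷ ys) | ∑-choose-∷ F (suc k) x ys
        | ∑-choose-∷ (F ∘ (x ∷_)) k y xs | ∑-choose-∷ (F ∘ (y ∷_)) k x ys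
        | ∑-choose-↭ F F-↭ (suc (suc k)) p
        | ∑-choose-↭ (F ∘ (x ∷_)) (F-↭ ∘ prep x) (suc k) p
        | ∑-choose-↭ (F ∘ (y ∷_)) (F-↭ ∘ prep y) (suc k) p
        | ∑-choose-↭ (λ S → F (x ∷ y ∷ S)) (F-↭ ∘ prep x ∘ prep y) k p
        | ∑-cong {f = λ S → F (x ∷ y ∷ S)} {g = λ S → F (y ∷ x ∷ S)} (choose k ys) (λ _ → F-↭ (swap x y refl))
        = +-interchange (∑ (choose k ys) (λ S → F (y ∷ x ∷ S))) _ _ _

antidiagonal : ℕ → List (ℕ × ℕ)
antidiagonal zero    = (0 , 0) ∷ []
antidiagonal (suc k) = (0 , suc k) ∷ map (λ ij → suc (proj₁ ij) , proj₂ ij) (antidiagonal k)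

∑-antidiagonal-suc : (f : ℕ × ℕ → ℕ) (k : ℕ) →
  ∑ (antidiagonal (suc k)) f ≡ f (0 , suc k) + ∑ (antidiagonal k) (λ ij → f (suc (proj₁ ij) , proj₂ ij))
∑-antidiagonal-suc f k = cong (f (0 , suc k) +_) (∑-map f _ (antidiagonal k))

antidiagonal-+ : ∀ i j → (i , j) ∈ antidiagonal (i + j)
antidiagonal-+ zero    zero    = here refl
antidiagonal-+ zero    (suc j) = here refl
antidiagonal-+ (suc i) j       = there (∈ₚ.∈-map⁺ _ (antidiagonal-+ i j))

∈-antidiagonal : ∀ k {ij} → ij ∈ antidiagonal k → proj₁ ij + proj₂ ij ≡ k
∈-antidiagonal zero    (here refl) = refl
∈-antidiagonal (suc k) (here refl) = refl
∈-antidiagonal (suc k) (there ij∈) with ∈ₚ.∈-map⁻ _ ij∈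
... | _ , ij∈′ , refl = cong suc (∈-antidiagonal k ij∈′)

-- A sublist of `xs ++ ys` is cut at the seam into a sublist of each block. With F constant this is
-- Vandermonde's identity; a general F is kept because invariance of a set couples its two halves.
∑-choose-++ : (F : List A → ℕ) (k : ℕ) (xs ys : List A) →
  ∑ (choose k (xs ++ ys)) F ≡
  ∑ (antidiagonal k) (λ ij → ∑ (choose (proj₁ ij) xs) (λ S → ∑ (choose (proj₂ ij) ys) (λ S′ → F (S ++ S′))))
∑-choose-++ F zero xs ys = sym (≡-trans (+-identityʳ _) (+-identityʳ _))
∑-choose-++ F (suc k) [] ys = sym (begin
  ∑ (antidiagonal (suc k)) (λ ij → ∑ (choose (proj₁ ij) []) (λ S → ∑ (choose (proj₂ ij) ys) (λ S′ → F (S ++ S′))))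
    ≡⟨ ∑-antidiagonal-suc _ k ⟩
  (∑ (choose (suc k) ys) F + 0) + ∑ (antidiagonal k) (λ _ → 0)
    ≡⟨ cong₂ _+_ (+-identityʳ _) (∑-0 (antidiagonal k) (λ _ → refl)) ⟩
  ∑ (choose (suc k) ys) F + 0   ≡⟨ +-identityʳ _ ⟩
  ∑ (choose (suc k) ys) F       ∎)
  where open ≡-Reasoning
∑-choose-++ F (suc k) (x ∷ xs) ys = begin
  ∑ (choose (suc k) (x ∷ xs ++ ys)) F
    ≡⟨ ∑-choose-∷ F k x (xs ++ ys) ⟩
  ∑ (choose k (xs ++ ys)) (F ∘ (x ∷_)) + ∑ (choose (suc k) (xs ++ ys)) F
    ≡⟨ cong₂ _+_ (∑-choose-++ (F ∘ (x ∷_)) k xs ys) (∑-choose-++ F (suc k) xs ys) ⟩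
  ∑ (antidiagonal k) X + ∑ (antidiagonal (suc k)) Y
    ≡⟨ cong (∑ (antidiagonal k) X +_) (∑-antidiagonal-suc Y k) ⟩
  ∑ (antidiagonal k) X + (Y (0 , suc k) + ∑ (antidiagonal k) Y′)
    ≡⟨ +-exchange (∑ (antidiagonal k) X) (Y (0 , suc k)) _ ⟩
  Y (0 , suc k) + (∑ (antidiagonal k) X + ∑ (antidiagonal k) Y′)
    ≡⟨ cong (Y (0 , suc k) +_) (sym (∑-+ X Y′ (antidiagonal k))) ⟩
  Y (0 , suc k) + ∑ (antidiagonal k) (λ ij → X ij + Y′ ij)
    ≡⟨ cong (Y (0 , suc k) +_) (∑-cong (antidiagonal k) (λ {ij} _ → sym (∑-choose-∷ _ (proj₁ ij) x xs))) ⟩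
  Z (0 , suc k) + ∑ (antidiagonal k) (λ ij → Z (suc (proj₁ ij) , proj₂ ij))
    ≡⟨ ∑-antidiagonal-suc Z k ⟨
  ∑ (antidiagonal (suc k)) Z ∎
  where
  open ≡-Reasoning
  X Y Y′ Z : ℕ × ℕ → ℕ
  X ij = ∑ (choose (proj₁ ij) xs) (λ S → ∑ (choose (proj₂ ij) ys) (λ S′ → F (x ∷ S ++ S′)))
  Y ij = ∑ (choose (proj₁ ij) xs) (λ S → ∑ (choose (proj₂ ij) ys) (λ S′ → F (S ++ S′)))
  Y′ ij = Y (suc (proj₁ ij) , proj₂ ij)
  Z ij = ∑ (choose (proj₁ ij) (x ∷ xs)) (λ S → ∑ (choose (proj₂ ij) ys) (λ S′ → F (S ++ S′)))

vandermonde : ∀ a b k → (a + b) C k ≡ ∑ (antidiagonal k) (λ ij → (a C proj₁ ij) * (b C proj₂ ij))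
vandermonde a b k = begin
  (a + b) C k                                  ≡⟨ cong (_C k) (≡-trans (cong₂ _+_ (sym (Listₚ.length-upTo a)) (sym (Listₚ.length-upTo b))) (sym (Listₚ.length-++ (upTo a)))) ⟩
  length (upTo a ++ upTo b) C k                ≡⟨ length-choose k (upTo a ++ upTo b) ⟨
  length (choose k (upTo a ++ upTo b))         ≡⟨ ∑-1 (choose k (upTo a ++ upTo b)) ⟨
  ∑ (choose k (upTo a ++ upTo b)) (λ _ → 1)    ≡⟨ ∑-choose-++ (λ _ → 1) k (upTo a) (upTo b) ⟩
  ∑ (antidiagonal k) (λ ij → ∑ (choose (proj₁ ij) (upTo a)) (λ _ → ∑ (choose (proj₂ ij) (upTo b)) (λ _ → 1)))
    ≡⟨ ∑-cong (antidiagonal k) (λ {ij} _ → ≡-trans (∑-const _ (choose (proj₁ ij) (upTo a)))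
         (cong₂ _*_ (≡-trans (length-choose (proj₁ ij) (upTo a)) (cong (_C proj₁ ij) (Listₚ.length-upTo a)))
                    (≡-trans (∑-1 (choose (proj₂ ij) (upTo b))) (≡-trans (length-choose (proj₂ ij) (upTo b)) (cong (_C proj₂ ij) (Listₚ.length-upTo b)))))) ⟩
  ∑ (antidiagonal k) (λ ij → (a C proj₁ ij) * (b C proj₂ ij)) ∎
  where open ≡-Reasoning

vandermonde-≤ : ∀ a b i j → (a C i) * (b C j) ≤ (a + b) C (i + j)
vandermonde-≤ a b i j = ≤-trans
  (∑-∈ {f = λ ij → (a C proj₁ ij) * (b C proj₂ ij)} (antidiagonal-+ i j))
  (≤-reflexive (sym (vandermonde a b (i + j))))

-- A sublist is charged to its first entry. The tails on the right come from all of `xs`, so x may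
-- occur in them again; the rooted counts below therefore put distinctness of the entries into F.
∑-choose-suc-≤ : (F : List A → ℕ) (k : ℕ) (xs : List A) →
  ∑ (choose (suc k) xs) F ≤ ∑ xs (λ x → ∑ (choose k xs) (F ∘ (x ∷_)))
∑-choose-suc-≤ F k [] = z≤n
∑-choose-suc-≤ F k (x ∷ xs) = begin
  ∑ (choose (suc k) (x ∷ xs)) F                              ≡⟨ ∑-choose-∷ F k x xs ⟩
  ∑ (choose k xs) (F ∘ (x ∷_)) + ∑ (choose (suc k) xs) F     ≤⟨ +-mono-≤ (weaken k (F ∘ (x ∷_))) (∑-choose-suc-≤ F k xs) ⟩
  ∑ (choose k (x ∷ xs)) (F ∘ (x ∷_)) + ∑ xs (λ y → ∑ (choose k xs) (F ∘ (y ∷_)))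
    ≤⟨ +-monoʳ-≤ _ (∑-mono xs (λ {y} _ → weaken k (F ∘ (y ∷_)))) ⟩
  ∑ (x ∷ xs) (λ y → ∑ (choose k (x ∷ xs)) (F ∘ (y ∷_)))      ∎
  where
  open ≤-Reasoning
  weaken : ∀ k G → ∑ (choose k xs) G ≤ ∑ (choose k (x ∷ xs)) G
  weaken zero    G = ≤-refl
  weaken (suc k) G = ≤-trans (m≤n+m _ _) (≤-reflexive (sym (∑-choose-∷ G k x xs)))

C-suc-≤ : ∀ n k → n C suc k ≤ n * (n C k)
C-suc-≤ n k = begin
  n C suc k                           ≡⟨ size (suc k) ⟨
  ∑ (choose (suc k) (upTo n)) (λ _ → 1)   ≤⟨ ∑-choose-suc-≤ (λ _ → 1) k (upTo n) ⟩
  ∑ (upTo n) (λ _ → ∑ (choose k (upTo n)) (λ _ → 1))  ≡⟨ ∑-const _ (upTo n) ⟩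
  length (upTo n) * ∑ (choose k (upTo n)) (λ _ → 1)   ≡⟨ cong₂ _*_ (Listₚ.length-upTo n) (size k) ⟩
  n * (n C k)                           ∎
  where
  open ≤-Reasoning
  size : ∀ k → ∑ (choose k (upTo n)) (λ _ → 1) ≡ n C k
  size k = ≡-trans (∑-1 (choose k (upTo n))) (≡-trans (length-choose k (upTo n)) (cong (_C k) (Listₚ.length-upTo n)))

C-pos : ∀ {n k} → k ≤ n → 1 ≤ n C k
C-pos {n} {zero} _ = ≤-refl
C-pos {suc n} {suc k} (s≤s k≤n) = ≤-trans (C-pos k≤n) (≤-trans (m≤m+n _ _) (≤-reflexive (nCk+nC[k+1]≡[n+1]C[k+1] n k)))

-- The hypotheses place e between j and p - j, so this is unimodality together with symmetry.
-- Pascal's rule reduces both sides in step; when j + e = p the induction would leave the range, but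
-- there the two coefficients agree by symmetry.
C-mono-middle : ∀ p {j e} → j ≤ e → j + e ≤ p → p C j ≤ p C e
C-mono-middle p {zero} {e} _ e≤p = C-pos e≤p
C-mono-middle (suc p) {suc j} {suc e} (s≤s j≤e) (s≤s j+e≤p) with ℕₚ.m≤n⇒m<n∨m≡n j+e≤p
... | inj₁ lt = begin
  suc p C suc j          ≡⟨ nCk+nC[k+1]≡[n+1]C[k+1] p j ⟨
  p C j + p C suc j      ≤⟨ +-mono-≤ (C-mono-middle p j≤e (≤-trans (+-monoʳ-≤ j (ℕₚ.n≤1+n e)) j+e≤p)) (C-mono-middle p (s≤s j≤e) lt) ⟩
  p C e + p C suc e      ≡⟨ nCk+nC[k+1]≡[n+1]C[k+1] p e ⟩
  suc p C suc e          ∎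
  where open ≤-Reasoning
... | inj₂ refl = ≤-reflexive (≡-trans (nCk≡nC[n∸k] {suc j} (s≤s (m≤m+n j (suc e))))
                     (cong (suc (j + suc e) C_) (ℕₚ.m+n∸m≡n j (suc e))))

choose-⊆ : ∀ k (D : List A) {S} → S ∈ choose k D → ∀ {x} → x ∈ S → x ∈ D
choose-⊆ zero    D       (here refl) ()
choose-⊆ (suc k) (y ∷ D) S∈ x∈ with ∈ₚ.∈-++⁻ (map (y ∷_) (choose k D)) S∈
... | inj₂ S∈′ = there (choose-⊆ (suc k) D S∈′ x∈)
... | inj₁ S∈′ with ∈ₚ.∈-map⁻ _ S∈′ | x∈
...   | _ , S′∈ , refl | here refl = here refl
...   | _ , S′∈ , refl | there x∈′ = there (choose-⊆ k D S′∈ x∈′)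

choose-length : ∀ k (D : List A) {S} → S ∈ choose k D → length S ≡ k
choose-length zero    D       (here refl) = refl
choose-length (suc k) (y ∷ D) S∈ with ∈ₚ.∈-++⁻ (map (y ∷_) (choose k D)) S∈
... | inj₂ S∈′ = choose-length (suc k) D S∈′
... | inj₁ S∈′ with ∈ₚ.∈-map⁻ _ S∈′
...   | _ , S′∈ , refl = cong suc (choose-length k D S′∈)

choose-Unique : ∀ k {D : List A} → Unique D → ∀ {S} → S ∈ choose k D → Unique S
choose-Unique zero u (here refl) = []
choose-Unique (suc k) {y ∷ D} (y# ∷ u) S∈ with ∈ₚ.∈-++⁻ (map (y ∷_) (choose k D)) S∈
... | inj₂ S∈′ = choose-Unique (suc k) u S∈′
... | inj₁ S∈′ with ∈ₚ.∈-map⁻ _ S∈′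
...   | _ , S′∈ , refl = All.tabulate (λ x∈ → All.lookup y# (choose-⊆ k D S′∈ x∈)) ∷ choose-Unique k u S′∈

Unique-choose : {D : List A} → Unique D → ∀ k → Unique (choose k D)
Unique-choose u zero = [] ∷ []
Unique-choose {D = []} u (suc k) = []
Unique-choose {D = y ∷ D} (y# ∷ u) (suc k) =
  Uniqueₚ.++⁺ (Uniqueₚ.map⁺ Listₚ.∷-injectiveʳ (Unique-choose u k)) (Unique-choose u (suc k)) disjoint
  where
  disjoint : ∀ {S} → S ∈ map (y ∷_) (choose k D) × S ∈ choose (suc k) D → ⊥
  disjoint (i , j) with ∈ₚ.∈-map⁻ _ i
  ... | _ , _ , refl = All.lookup y# (choose-⊆ (suc k) D j (here refl)) refl

filter-cong-∈ : (P? : Decidable P) (Q? : Decidable Q) (xs : List A) →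
                (∀ {x} → x ∈ xs → (P x → Q x) × (Q x → P x)) → filter P? xs ≡ filter Q? xs
filter-cong-∈ P? Q? [] h = refl
filter-cong-∈ P? Q? (x ∷ xs) h with P? x | Q? x | filter-cong-∈ P? Q? xs (h ∘ there)
... | yes _ | yes _ | eq = cong (x ∷_) eq
... | no _  | no _  | eq = eq
... | yes p | no ¬q | _  = contradiction (proj₁ (h (here refl)) p) ¬q
... | no ¬p | yes q | _  = contradiction (proj₂ (h (here refl)) q) ¬p

filter-∈-choose : (P? : Decidable P) (D : List A) → filter P? D ∈ choose (length (filter P? D)) D
filter-∈-choose P? [] = here refl
filter-∈-choose P? (x ∷ D) with P? x
... | yes _ = ∈ₚ.∈-++⁺ˡ (∈ₚ.∈-map⁺ (x ∷_) (filter-∈-choose P? D))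
... | no _ with filter P? D | filter-∈-choose P? D
...   | []    | _ = here refl
...   | _ ∷ _ | i = ∈ₚ.∈-++⁺ʳ _ i

module _ (_≟_ : DecidableEquality A) where
  open import Data.List.Membership.DecPropositional _≟_ using (_∈?_)

  -- A member of `choose k D` keeps the order of D, so it is recovered from its set of members.
  -- Sublists of a duplicate-free list are thus faithful representatives of subsets, and equality of
  -- sets becomes equality of lists.
  choose-filter : ∀ k {D : List A} → Unique D → ∀ {S} → S ∈ choose k D → filter (_∈? S) D ≡ S
  choose-filter zero {D} u (here refl) = Listₚ.filter-none (_∈? []) {D} (All.tabulate (λ _ ()))
  choose-filter (suc k) {y ∷ D} (y# ∷ u) {S} S∈ with ∈ₚ.∈-++⁻ (map (y ∷_) (choose k D)) S∈
  ... | inj₂ S∈′ = ≡-trans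
    (Listₚ.filter-reject (_∈? S) (λ y∈ → All.lookup y# (choose-⊆ (suc k) D S∈′ y∈) refl))
    (choose-filter (suc k) u S∈′)
  ... | inj₁ S∈′ with ∈ₚ.∈-map⁻ _ S∈′
  ...   | S″ , S″∈ , refl = ≡-trans
    (Listₚ.filter-accept (_∈? (y ∷ S″)) (here refl))
    (cong (y ∷_) (≡-trans
      (filter-cong-∈ (_∈? (y ∷ S″)) (_∈? S″) D
        (λ x∈ → (λ { (here refl) → contradiction refl (All.lookup y# x∈) ; (there i) → i }) , there))
      (choose-filter k u S″∈)))

  filter-∈-length : {xs S : List A} → Unique xs → Unique S → (∀ {x} → x ∈ S → x ∈ xs) →
                    length (filter (_∈? S) xs) ≡ length S
  filter-∈-length {xs} {S} uxs uS S⊆ = ℕₚ.≤-antisym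
    (length-injection _≟_ (Uniqueₚ.filter⁺ (_∈? S) uxs) id (λ i → proj₂ (∈ₚ.∈-filter⁻ (_∈? S) {xs = xs} i)) (λ _ _ e → e))
    (length-injection _≟_ uS id (λ i → ∈ₚ.∈-filter⁺ (_∈? S) (S⊆ i) i) (λ _ _ e → e))

  filter-∉-length : {xs S : List A} → Unique xs → Unique S → (∀ {x} → x ∈ S → x ∈ xs) →
                    length S + length (filter (¬? ∘ (_∈? S)) xs) ≡ length xs
  filter-∉-length {xs} {S} uxs uS S⊆ = sym (≡-trans (↭ₚ.↭-length (filter-split-↭ (_∈? S) xs))
    (≡-trans (Listₚ.length-++ (filter (_∈? S) xs)) (cong (_+ length (filter (¬? ∘ (_∈? S)) xs)) (filter-∈-length uxs uS S⊆))))

  ∑-choose-complement : {D : List A} → Unique D → ∀ {k l} → k + l ≡ length D → (w : List A → ℕ) →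
    ∑ (choose k D) (λ S → w (filter (¬? ∘ (_∈? S)) D)) ≤ ∑ (choose l D) w
  ∑-choose-complement {D} u {k} {l} k+l w = ∑-reindex-≤ (Listₚ.≡-dec _≟_) (Unique-choose u k) co w into inj
    where
    co : List A → List A
    co S = filter (¬? ∘ (_∈? S)) D
    into : ∀ {S} → S ∈ choose k D → co S ∈ choose l D
    into {S} S∈ = subst (λ m → co S ∈ choose m D)
      (ℕₚ.+-cancelˡ-≡ k _ _ (≡-trans (≡-trans (cong (_+ length (co S)) (sym (choose-length k D S∈)))
        (filter-∉-length u (choose-Unique k u S∈) (choose-⊆ k D S∈))) (sym k+l)))
      (filter-∈-choose (¬? ∘ (_∈? S)) D)
    transfer : ∀ {S S′} → S′ ∈ choose k D → co S ≡ co S′ → ∀ {x} → x ∈ D → x ∈ S → x ∈ S′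
    transfer {S} {S′} S′∈ eq {x} x∈D x∈S with x ∈? S′
    ... | yes i = i
    ... | no ¬i = contradiction x∈S (proj₂ (∈ₚ.∈-filter⁻ (¬? ∘ (_∈? S)) {xs = D}
                    (subst (x ∈_) (sym eq) (∈ₚ.∈-filter⁺ (¬? ∘ (_∈? S′)) x∈D ¬i))))
    inj : ∀ {S S′} → S ∈ choose k D → S′ ∈ choose k D → co S ≡ co S′ → S ≡ S′
    inj {S} {S′} S∈ S′∈ eq = ≡-trans (sym (choose-filter k u S∈)) (≡-trans
      (filter-cong-∈ (_∈? S) (_∈? S′) D (λ x∈ → transfer S′∈ eq x∈ , transfer S∈ (sym eq) x∈))
      (choose-filter k u S′∈))

-- Invariant subsets of a bijection

atMostOne-* : (P? : Decidable P) (xs : List A) {c d : ℕ} → ∑ xs (λ x → 𝟙 (P? x)) ≤ 1 →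
              (∀ {x} → x ∈ xs → P x → c ≤ d) → ∑ xs (λ x → 𝟙 (P? x)) * c ≤ d
atMostOne-* P? [] _ _ = z≤n
atMostOne-* P? (x ∷ xs) {c} amo h with P? x
... | no _  = atMostOne-* P? xs amo (h ∘ there)
... | yes p = ≤-trans (*-monoˡ-≤ c amo) (≤-trans (≤-reflexive (*-identityˡ c)) (h (here refl) p))

module Cover {A : Set} (_≟_ : DecidableEquality A) where
  open import Data.List.Membership.DecPropositional _≟_ using (_∈?_)

  ∉⇒#-All : {e : A} {L : List A} → e ∉ L → All (e ≢_) L
  ∉⇒#-All e∉ = All.tabulate (λ i eq → e∉ (subst (_∈ _) (sym eq) i))

  cover : {L S : List A} → Unique L → (∀ {x} → x ∈ L → x ∈ S) → length S ≤ length L → ∀ {e} → e ∈ S → e ∈ L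
  cover {L} {S} u L⊆ len {e} e∈ with e ∈? L
  ... | yes i = i
  ... | no ¬i = contradiction
    (length-injection _≟_ (∉⇒#-All ¬i ∷ u) id (λ { (here refl) → e∈ ; (there i) → L⊆ i }) (λ _ _ eq → eq))
    (ℕₚ.<⇒≱ (s≤s len))

  escape : {L S : List A} → Unique S → length L < length S → ∃ λ v → v ∈ S × v ∉ L
  escape {L} {S} u lt with Any.any? (¬? ∘ (_∈? L)) S
  ... | yes a = find a
  ... | no ¬a = contradiction (length-injection _≟_ u id inside (λ _ _ eq → eq)) (ℕₚ.<⇒≱ lt)
    where
    inside : ∀ {x} → x ∈ S → x ∈ L
    inside {x} x∈ with x ∈? L
    ... | yes i = i
    ... | no ¬i = contradiction (lose x∈ ¬i) ¬a

  choose-ext : ∀ k {D S S′ : List A} → Unique D → S ∈ choose k D → S′ ∈ choose k D →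
               (∀ {e} → e ∈ S → e ∈ S′) → (∀ {e} → e ∈ S′ → e ∈ S) → S ≡ S′
  choose-ext k {D} {S} {S′} u S∈ S′∈ f g = ≡-trans (sym (choose-filter _≟_ k u S∈))
    (≡-trans (filter-cong-∈ (_∈? S) (_∈? S′) D (λ _ → f , g)) (choose-filter _≟_ k u S′∈))

-- The maps live on the whole type and are constrained only on D, with the inverse carried along.
-- The same φ and ψ can then be restricted to the moved points without changing type.
record Bijection {A : Set} (D : List A) : Set where
  field
    φ ψ : A → A
    φ∈  : ∀ {x} → x ∈ D → φ x ∈ D
    ψ∈  : ∀ {x} → x ∈ D → ψ x ∈ D
    ψφ  : ∀ {x} → x ∈ D → ψ (φ x) ≡ x
    φψ  : ∀ {x} → x ∈ D → φ (ψ x) ≡ x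

  φ-injective : ∀ {x y} → x ∈ D → y ∈ D → φ x ≡ φ y → x ≡ y
  φ-injective x∈ y∈ eq = ≡-trans (sym (ψφ x∈)) (≡-trans (cong ψ eq) (ψφ y∈))

module Invariant {A : Set} (_≟_ : DecidableEquality A) {D : List A} (bij : Bijection D) where
  open Bijection bij
  open import Data.List.Membership.DecPropositional _≟_ using (_∈?_)

  -- Closure under ψ is asked together with closure under φ, so that the neighbour argument and the
  -- passage to complements may follow an edge in either direction.
  Inv : List A → Set
  Inv S = All (λ x → φ x ∈ S × ψ x ∈ S) S

  inv? : Decidable Inv
  inv? S = All.all? (λ x → (φ x ∈? S) ×-dec (ψ x ∈? S)) S

  Inv-↭ : ∀ {S S′} → S ↭ S′ → Inv S → Inv S′
  Inv-↭ p i = All.map (λ q → ↭ₚ.∈-resp-↭ p (proj₁ q) , ↭ₚ.∈-resp-↭ p (proj₂ q)) (↭ₚ.All-resp-↭ p i)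

  𝟙-inv-↭ : ∀ {S S′} → S ↭ S′ → 𝟙 (inv? S) ≡ 𝟙 (inv? S′)
  𝟙-inv-↭ p = 𝟙-cong (inv? _) (inv? _) (Inv-↭ p) (Inv-↭ (↭-sym p))

  #invariant : ℕ → ℕ
  #invariant k = ∑ (choose k D) (λ S → 𝟙 (inv? S))

  -- The complement of an invariant set is invariant, and complementation is injective. This brings
  -- k beyond the middle of the range back to N - k.
  #invariant-complement : Unique D → ∀ {k l} → k + l ≡ length D → #invariant k ≤ #invariant l
  #invariant-complement u {k} {l} k+l = ≤-trans
    (∑-mono (choose k D) (λ {S} S∈ → 𝟙-mono (inv? S) (inv? (filter (¬? ∘ (_∈? S)) D)) co-Inv))
    (∑-choose-complement _≟_ u {k} {l} k+l (λ S → 𝟙 (inv? S)))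
    where
    co-Inv : ∀ {S} → Inv S → Inv (filter (¬? ∘ (_∈? S)) D)
    co-Inv {S} i = All.tabulate λ {x} x∈ → let
      (x∈D , x∉S) = ∈ₚ.∈-filter⁻ (¬? ∘ (_∈? S)) {xs = D} x∈ in
      ∈ₚ.∈-filter⁺ (¬? ∘ (_∈? S)) (φ∈ x∈D) (λ φx∈S → x∉S (subst (_∈ S) (ψφ x∈D) (proj₂ (All.lookup i φx∈S)))) ,
      ∈ₚ.∈-filter⁺ (¬? ∘ (_∈? S)) (ψ∈ x∈D) (λ ψx∈S → x∉S (subst (_∈ S) (φψ x∈D) (proj₁ (All.lookup i ψx∈S))))

-- For φ without fixed points, let R be a maximal independent set of the graph with edges
-- x — φ x.  Every x ∉ R has a neighbour in R, so an invariant set S is determined by S ∩ R;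
-- and φ maps S ∩ R injectively into S ∖ R.
module Independent {A : Set} (_≟_ : DecidableEquality A) {D : List A} (u : Unique D) (bij : Bijection D)
                   (φ≢ : ∀ {x} → x ∈ D → Bijection.φ bij x ≢ x) where
  open Bijection bij
  open Invariant _≟_ bij
  open Cover _≟_
  open import Data.List.Membership.DecPropositional _≟_ using (_∈?_)

  greedy : List A → List A
  greedy [] = []
  greedy (x ∷ xs) with φ x ∈? greedy xs | ψ x ∈? greedy xs
  ... | no _  | no _  = x ∷ greedy xs
  ... | yes _ | _     = greedy xs
  ... | no _  | yes _ = greedy xs

  greedy-⊆ : ∀ xs {x} → x ∈ greedy xs → x ∈ xs
  greedy-⊆ (y ∷ xs) x∈ with φ y ∈? greedy xs | ψ y ∈? greedy xs
  ... | yes _ | _     = there (greedy-⊆ xs x∈)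
  ... | no _  | yes _ = there (greedy-⊆ xs x∈)
  greedy-⊆ (y ∷ xs) (here refl) | no _ | no _ = here refl
  greedy-⊆ (y ∷ xs) (there x∈)  | no _ | no _ = there (greedy-⊆ xs x∈)

  greedy-independent : ∀ xs → (∀ {x} → x ∈ xs → x ∈ D) → ∀ {x} → x ∈ greedy xs → φ x ∉ greedy xs
  greedy-independent (y ∷ xs) ⊆D x∈ φx∈ with φ y ∈? greedy xs | ψ y ∈? greedy xs
  ... | yes _ | _     = greedy-independent xs (⊆D ∘ there) x∈ φx∈
  ... | no _  | yes _ = greedy-independent xs (⊆D ∘ there) x∈ φx∈
  greedy-independent (y ∷ xs) ⊆D (here refl) (here eq)    | no φy∉ | no _   = φ≢ (⊆D (here refl)) eq
  greedy-independent (y ∷ xs) ⊆D (here refl) (there φx∈)  | no φy∉ | no _   = φy∉ φx∈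
  greedy-independent (y ∷ xs) ⊆D (there x∈)  (there φx∈)  | no _   | no _   = greedy-independent xs (⊆D ∘ there) x∈ φx∈
  greedy-independent (y ∷ xs) ⊆D (there x∈)  (here refl)  | no _   | no ψy∉ =
    ψy∉ (subst (_∈ greedy xs) (sym (ψφ (⊆D (there (greedy-⊆ xs x∈))))) x∈)

  greedy-maximal : ∀ xs {x} → x ∈ xs → x ∈ greedy xs ⊎ φ x ∈ greedy xs ⊎ ψ x ∈ greedy xs
  greedy-maximal (y ∷ xs) x∈ with φ y ∈? greedy xs | ψ y ∈? greedy xs
  greedy-maximal (y ∷ xs) (here refl) | yes i | _     = inj₂ (inj₁ i)
  greedy-maximal (y ∷ xs) (here refl) | no _  | yes i = inj₂ (inj₂ i)
  greedy-maximal (y ∷ xs) (here refl) | no _  | no _  = inj₁ (here refl)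
  greedy-maximal (y ∷ xs) (there x∈)  | yes _ | _     = greedy-maximal xs x∈
  greedy-maximal (y ∷ xs) (there x∈)  | no _  | yes _ = greedy-maximal xs x∈
  greedy-maximal (y ∷ xs) (there x∈)  | no _  | no _ with greedy-maximal xs x∈
  ... | inj₁ i        = inj₁ (there i)
  ... | inj₂ (inj₁ i) = inj₂ (inj₁ (there i))
  ... | inj₂ (inj₂ i) = inj₂ (inj₂ (there i))

  R : List A
  R = greedy D

  Reps Rest : List A
  Reps = filter (_∈? R) D
  Rest = filter (¬? ∘ (_∈? R)) D

  uReps : Unique Reps
  uReps = Uniqueₚ.filter⁺ (_∈? R) u

  uRest : Unique Rest
  uRest = Uniqueₚ.filter⁺ (¬? ∘ (_∈? R)) u

  ∈Reps⁻ : ∀ {x} → x ∈ Reps → x ∈ D × x ∈ R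
  ∈Reps⁻ = ∈ₚ.∈-filter⁻ (_∈? R) {xs = D}

  ∈Rest⁻ : ∀ {x} → x ∈ Rest → x ∈ D × x ∉ R
  ∈Rest⁻ = ∈ₚ.∈-filter⁻ (¬? ∘ (_∈? R)) {xs = D}

  φ-Reps : ∀ {x} → x ∈ Reps → φ x ∈ Rest
  φ-Reps x∈ = let (x∈D , x∈R) = ∈Reps⁻ x∈ in
    ∈ₚ.∈-filter⁺ (¬? ∘ (_∈? R)) (φ∈ x∈D) (greedy-independent D id x∈R)

  neighbour : ∀ {x} → x ∈ Rest → φ x ∈ Reps ⊎ ψ x ∈ Reps
  neighbour x∈ with ∈Rest⁻ x∈
  ... | x∈D , x∉R with greedy-maximal D x∈D
  ...   | inj₁ i        = contradiction i x∉R
  ...   | inj₂ (inj₁ i) = inj₁ (∈ₚ.∈-filter⁺ (_∈? R) (φ∈ x∈D) i)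
  ...   | inj₂ (inj₂ i) = inj₂ (∈ₚ.∈-filter⁺ (_∈? R) (ψ∈ x∈D) i)

  r p : ℕ
  r = length Reps
  p = length Rest

  D↭ : D ↭ Reps ++ Rest
  D↭ = filter-split-↭ (_∈? R) D

  r+p≡ : r + p ≡ length D
  r+p≡ = sym (≡-trans (↭ₚ.↭-length D↭) (Listₚ.length-++ Reps))

  Reps-injective : ∀ {x y} → x ∈ Reps → y ∈ Reps → φ x ≡ φ y → x ≡ y
  Reps-injective i j = φ-injective (proj₁ (∈Reps⁻ i)) (proj₁ (∈Reps⁻ j))

  -- φ sends `Reps` injectively into `Rest`, so at least half of D lies in `Rest`. Both the saving
  -- C(p, 3) for invariant sets and the factor p! for centralizers draw on this.
  r≤p : r ≤ p
  r≤p = length-injection _≟_ uReps φ φ-Reps Reps-injective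

  module Split (i j : ℕ) {S : List A} (S∈ : S ∈ choose i Reps) where

    ∉Rest : ∀ {x} → x ∈ S → x ∉ Rest
    ∉Rest x∈ x∈′ = proj₂ (∈Rest⁻ x∈′) (proj₂ (∈Reps⁻ (choose-⊆ i Reps S∈ x∈)))

    left : ∀ {S′ x} → S′ ∈ choose j Rest → x ∈ Reps → x ∈ S ++ S′ → x ∈ S
    left S′∈ x∈R x∈ with ∈ₚ.∈-++⁻ S x∈
    ... | inj₁ i = i
    ... | inj₂ i = contradiction (proj₂ (∈Reps⁻ x∈R)) (proj₂ (∈Rest⁻ (choose-⊆ j Rest S′∈ i)))

    right : ∀ {S′ x} → x ∈ Rest → x ∈ S ++ S′ → x ∈ S′
    right x∈R x∈ with ∈ₚ.∈-++⁻ S x∈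
    ... | inj₁ i = contradiction x∈R (∉Rest i)
    ... | inj₂ i = i

    determined : ∀ {S′ S″} → S′ ∈ choose j Rest → S″ ∈ choose j Rest → Inv (S ++ S′) → Inv (S ++ S″) →
                 ∀ {x} → x ∈ S′ → x ∈ S″
    determined S′∈ S″∈ i′ i″ {x} x∈ with choose-⊆ j Rest S′∈ x∈
    ... | x∈Rest with neighbour x∈Rest | All.lookup i′ (∈ₚ.∈-++⁺ʳ S x∈) | proj₁ (∈Rest⁻ x∈Rest)
    ...   | inj₁ φx∈R | φx∈ , _ | x∈D = right x∈Rest (subst (_∈ _) (ψφ x∈D)
              (proj₂ (All.lookup i″ (∈ₚ.∈-++⁺ˡ (left S′∈ φx∈R φx∈)))))
    ...   | inj₂ ψx∈R | _ , ψx∈ | x∈D = right x∈Rest (subst (_∈ _) (φψ x∈D)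
              (proj₁ (All.lookup i″ (∈ₚ.∈-++⁺ˡ (left S′∈ ψx∈R ψx∈)))))

    extension≤1 : ∑ (choose j Rest) (λ S′ → 𝟙 (inv? (S ++ S′))) ≤ 1
    extension≤1 = ∑-atMostOne (λ S′ → inv? (S ++ S′)) (Unique-choose uRest j)
      (λ S′∈ S″∈ i′ i″ → choose-ext j uRest S′∈ S″∈ (determined S′∈ S″∈ i′ i″) (determined S″∈ S′∈ i″ i′))

    module _ {S′ : List A} (S′∈ : S′ ∈ choose j Rest) (inv : Inv (S ++ S′)) where

      i≤j : i ≤ j
      i≤j = subst₂ _≤_ (choose-length i Reps S∈) (choose-length j Rest S′∈)
        (length-injection _≟_ (choose-Unique i uReps S∈) φ
          (λ x∈ → right (φ-Reps (choose-⊆ i Reps S∈ x∈)) (proj₁ (All.lookup inv (∈ₚ.∈-++⁺ˡ x∈))))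
          (λ x∈ y∈ → Reps-injective (choose-⊆ i Reps S∈ x∈) (choose-⊆ i Reps S∈ y∈)))

      a b : ℕ
      a = length (filter (¬? ∘ (_∈? S)) Reps)
      b = length (filter (¬? ∘ (_∈? S′)) Rest)

      i+a≡r : i + a ≡ r
      i+a≡r = ≡-trans (cong (_+ a) (sym (choose-length i Reps S∈)))
        (filter-∉-length _≟_ uReps (choose-Unique i uReps S∈) (choose-⊆ i Reps S∈))

      j+b≡p : j + b ≡ p
      j+b≡p = ≡-trans (cong (_+ b) (sym (choose-length j Rest S′∈)))
        (filter-∉-length _≟_ uRest (choose-Unique j uRest S′∈) (choose-⊆ j Rest S′∈))

      -- The complement of `S ++ S′` is invariant as well, so the injection φ from the part in
      -- `Reps` to the part in `Rest` works there too.
      a≤b : a ≤ b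
      a≤b = length-injection _≟_ (Uniqueₚ.filter⁺ (¬? ∘ (_∈? S)) uReps) φ
        (λ {x} x∈ → let (x∈R , x∉S) = ∈ₚ.∈-filter⁻ (¬? ∘ (_∈? S)) {xs = Reps} x∈ in
          ∈ₚ.∈-filter⁺ (¬? ∘ (_∈? S′)) (φ-Reps x∈R)
            (λ φx∈S′ → x∉S (left S′∈ x∈R (subst (_∈ S ++ S′) (ψφ (proj₁ (∈Reps⁻ x∈R)))
                                (proj₂ (All.lookup inv (∈ₚ.∈-++⁺ʳ S φx∈S′)))))))
        (λ x∈ y∈ → Reps-injective (proj₁ (∈ₚ.∈-filter⁻ (¬? ∘ (_∈? S)) {xs = Reps} x∈)) (proj₁ (∈ₚ.∈-filter⁻ (¬? ∘ (_∈? S)) {xs = Reps} y∈)))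

      -- With i ≤ j, a total of five points forces j ≥ 3; with a ≤ b, five points left over force b
      -- ≥ 3. Hence j lies between 3 and p - 3, the range in which C(p, j) ≥ C(p, 3).
      middle : 5 ≤ i + j → (i + j) + 5 ≤ length D → 3 ≤ j × 3 + j ≤ p
      middle lo hi = half i≤j lo , ≤-trans (≤-trans (+-monoˡ-≤ j (half a≤b 5≤a+b)) (≤-reflexive (+-comm b j))) (≤-reflexive j+b≡p)
        where
        half : ∀ {x y} → x ≤ y → 5 ≤ x + y → 3 ≤ y
        half {x} {y} x≤y h with 3 ≤? y
        ... | yes q = q
        ... | no ¬q = contradiction h (ℕₚ.<⇒≱ (s≤s (+-mono-≤ (≤-trans x≤y (s≤s⁻¹ (ℕₚ.≰⇒> ¬q))) (s≤s⁻¹ (ℕₚ.≰⇒> ¬q)))))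
        regroup : ∀ i j a b → (i + a) + (j + b) ≡ (i + j) + (a + b)
        regroup = solve-∀
        5≤a+b : 5 ≤ a + b
        5≤a+b = ℕₚ.+-cancelˡ-≤ (i + j) 5 (a + b) (≤-trans hi (≤-reflexive
          (≡-trans (sym r+p≡) (≡-trans (cong₂ _+_ (sym i+a≡r) (sym j+b≡p)) (regroup i j a b)))))

  -- Each i-subset of `Reps` has at most one invariant extension by j points of `Rest`, out of C(p,
  -- j) ≥ C(p, 3) possible ones. Vandermonde sums this saving over i + j = m without loss.
  #invariant-middle : ∀ m → 5 ≤ m → m + 5 ≤ length D → #invariant m * (p C 3) ≤ length D C m
  #invariant-middle m lo hi = begin
    #invariant m * (p C 3)
      ≡⟨ cong (_* (p C 3)) (≡-trans (∑-choose-↭ _ 𝟙-inv-↭ m D↭) (∑-choose-++ _ m Reps Rest)) ⟩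
    ∑ (antidiagonal m) F * (p C 3)
      ≡⟨ ∑-*ʳ F (p C 3) (antidiagonal m) ⟨
    ∑ (antidiagonal m) (λ ij → F ij * (p C 3))
      ≤⟨ ∑-mono (antidiagonal m) (λ {ij} ij∈ → term (proj₁ ij) (proj₂ ij) (∈-antidiagonal m ij∈)) ⟩
    ∑ (antidiagonal m) (λ ij → (r C proj₁ ij) * (p C proj₂ ij))
      ≡⟨ vandermonde r p m ⟨
    (r + p) C m
      ≡⟨ cong (_C m) r+p≡ ⟩
    length D C m ∎
    where
    open ≤-Reasoning
    F : ℕ × ℕ → ℕ
    F ij = ∑ (choose (proj₁ ij) Reps) (λ S → ∑ (choose (proj₂ ij) Rest) (λ S′ → 𝟙 (inv? (S ++ S′))))
    term : ∀ i j → i + j ≡ m → F (i , j) * (p C 3) ≤ (r C i) * (p C j)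
    term i j refl = begin
      F (i , j) * (p C 3)   ≡⟨ ∑-*ʳ _ (p C 3) (choose i Reps) ⟨
      ∑ (choose i Reps) (λ S → ∑ (choose j Rest) (λ S′ → 𝟙 (inv? (S ++ S′))) * (p C 3))
        ≤⟨ ∑-≤-const (p C j) (choose i Reps) (λ {S} S∈ → atMostOne-* (λ S′ → inv? (S ++ S′)) (choose j Rest)
              (Split.extension≤1 i j S∈)
              (λ S′∈ inv → let (q , q′) = Split.middle i j S∈ S′∈ inv lo hi in C-mono-middle p q q′)) ⟩
      length (choose i Reps) * (p C j)  ≡⟨ cong (_* (p C j)) (length-choose i Reps) ⟩
      (r C i) * (p C j) ∎

-- Factorial identities and lower bounds for binomial coefficients

C-absorption : ∀ n k → suc k * (suc n C suc k) ≡ suc n * (n C k)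
C-absorption n zero = ≡-trans (*-identityˡ _) (≡-trans (nC1≡n (suc n)) (sym (*-identityʳ _)))
C-absorption zero (suc k) = *-zeroʳ (suc (suc k))
C-absorption (suc n) (suc k) = begin
  suc (suc k) * (suc (suc n) C suc (suc k))
    ≡⟨ cong (suc (suc k) *_) (nCk+nC[k+1]≡[n+1]C[k+1] (suc n) (suc k)) ⟨
  suc (suc k) * (X + suc n C suc (suc k))
    ≡⟨ expand k X (suc n C suc (suc k)) ⟩
  X + suc k * X + suc (suc k) * (suc n C suc (suc k))
    ≡⟨ cong₂ (λ y z → X + y + z) (C-absorption n k) (C-absorption n (suc k)) ⟩
  X + suc n * (n C k) + suc n * (n C suc k)
    ≡⟨ ≡-trans (+-assoc X _ _) (cong (X +_) (sym (*-distribˡ-+ (suc n) (n C k) (n C suc k)))) ⟩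
  X + suc n * (n C k + n C suc k)
    ≡⟨ cong (λ y → X + suc n * y) (nCk+nC[k+1]≡[n+1]C[k+1] n k) ⟩
  suc (suc n) * X ∎
  where
  open ≡-Reasoning
  X = suc n C suc k
  expand : ∀ k x y → (2 + k) * (x + y) ≡ x + (1 + k) * x + (2 + k) * y
  expand = solve-∀

C*!*! : ∀ a b → ((a + b) C a) * (a ! * b !) ≡ (a + b) !
C*!*! zero    b = ≡-trans (*-identityˡ _) (*-identityˡ _)
C*!*! (suc a) b = begin
  (suc (a + b) C suc a) * (suc a * a ! * b !)    ≡⟨ regroup (suc (a + b) C suc a) (suc a) (a !) (b !) ⟩
  suc a * (suc (a + b) C suc a) * (a ! * b !)    ≡⟨ cong (_* (a ! * b !)) (C-absorption (a + b) a) ⟩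
  suc (a + b) * ((a + b) C a) * (a ! * b !)      ≡⟨ *-assoc (suc (a + b)) ((a + b) C a) (a ! * b !) ⟩
  suc (a + b) * (((a + b) C a) * (a ! * b !))    ≡⟨ cong (suc (a + b) *_) (C*!*! a b) ⟩
  suc (a + b) * (a + b) !                        ∎
  where
  open ≡-Reasoning
  regroup : ∀ c s x y → c * (s * x * y) ≡ s * c * (x * y)
  regroup = solve-∀

6*C3 : ∀ q → 6 * ((3 + q) C 3) ≡ (3 + q) * ((2 + q) * (1 + q))
6*C3 q = begin
  6 * ((3 + q) C 3)                   ≡⟨ *-assoc 2 3 ((3 + q) C 3) ⟩
  2 * (3 * ((3 + q) C 3))             ≡⟨ cong (2 *_) (C-absorption (2 + q) 2) ⟩
  2 * ((3 + q) * ((2 + q) C 2))       ≡⟨ *-exchange 2 (3 + q) ((2 + q) C 2) ⟩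
  (3 + q) * (2 * ((2 + q) C 2))       ≡⟨ cong ((3 + q) *_) (C-absorption (1 + q) 1) ⟩
  (3 + q) * ((2 + q) * ((1 + q) C 1)) ≡⟨ cong (λ z → (3 + q) * ((2 + q) * z)) (nC1≡n (1 + q)) ⟩
  (3 + q) * ((2 + q) * (1 + q))       ∎
  where
  open ≡-Reasoning

-- 27 = 3³ makes p = 3 the case of equality, and 256 = 4⁴ does the same for p = 4 in the quartic
-- version. After 3! or 4! is cleared, the difference of the two sides is a polynomial in q with
-- nonnegative coefficients, displayed in the chain.
C3-lower : ∀ {p} → 3 ≤ p → p * (p * p) ≤ 27 * (p C 3)
C3-lower {suc (suc (suc q))} (s≤s (s≤s (s≤s _))) = ℕₚ.*-cancelˡ-≤ 6 (begin
  6 * ((3 + q) * ((3 + q) * (3 + q)))                          ≤⟨ m≤m+n _ ((3 + q) * (21 * (q * q) + 45 * q)) ⟩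
  6 * ((3 + q) * ((3 + q) * (3 + q))) + (3 + q) * (21 * (q * q) + 45 * q) ≡⟨ identity q ⟩
  27 * ((3 + q) * ((2 + q) * (1 + q)))                         ≡⟨ cong (27 *_) (6*C3 q) ⟨
  27 * (6 * ((3 + q) C 3))                                     ≡⟨ *-exchange 27 6 ((3 + q) C 3) ⟩
  6 * (27 * ((3 + q) C 3))                                     ∎)
  where
  open ≤-Reasoning
  identity : ∀ q → 6 * ((3 + q) * ((3 + q) * (3 + q))) + (3 + q) * (21 * (q * q) + 45 * q) ≡ 27 * ((3 + q) * ((2 + q) * (1 + q)))
  identity = solve-∀

C4-lower : ∀ {p} → 4 ≤ p → p * (p * (p * p)) ≤ 256 * (p C 4)
C4-lower {suc (suc (suc (suc q)))} (s≤s (s≤s (s≤s (s≤s _)))) = ℕₚ.*-cancelˡ-≤ 24 (begin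
  24 * ((4 + q) * ((4 + q) * ((4 + q) * (4 + q))))
    ≤⟨ m≤m+n _ ((4 + q) * (232 * (q * (q * q)) + 1248 * (q * q) + 1664 * q)) ⟩
  24 * ((4 + q) * ((4 + q) * ((4 + q) * (4 + q)))) + (4 + q) * (232 * (q * (q * q)) + 1248 * (q * q) + 1664 * q)
    ≡⟨ identity q ⟩
  256 * ((4 + q) * ((3 + q) * ((2 + q) * (1 + q))))       ≡⟨ cong (λ z → 256 * ((4 + q) * z)) (6*C3 q) ⟨
  256 * ((4 + q) * (6 * ((3 + q) C 3)))                   ≡⟨ shuffle₁ (4 + q) ((3 + q) C 3) ⟩
  256 * (6 * ((4 + q) * ((3 + q) C 3)))                   ≡⟨ cong (λ z → 256 * (6 * z)) (C-absorption (3 + q) 3) ⟨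
  256 * (6 * (4 * ((4 + q) C 4)))                         ≡⟨ shuffle₂ ((4 + q) C 4) ⟩
  24 * (256 * ((4 + q) C 4))                              ∎)
  where
  open ≤-Reasoning
  identity : ∀ q → 24 * ((4 + q) * ((4 + q) * ((4 + q) * (4 + q)))) + (4 + q) * (232 * (q * (q * q)) + 1248 * (q * q) + 1664 * q)
           ≡ 256 * ((4 + q) * ((3 + q) * ((2 + q) * (1 + q))))
  identity = solve-∀
  shuffle₁ : ∀ a c → 256 * (a * (6 * c)) ≡ 256 * (6 * (a * c))
  shuffle₁ = solve-∀
  shuffle₂ : ∀ c → 256 * (6 * (4 * c)) ≡ 24 * (256 * c)
  shuffle₂ = solve-∀

-- Small invariant sets of a bijection without fixed points

module LowOrder {A : Set} (_≟_ : DecidableEquality A) {D : List A} (u : Unique D) (bij : Bijection D)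
                (φ≢ : ∀ {x} → x ∈ D → Bijection.φ bij x ≢ x) where
  open Bijection bij
  open Invariant _≟_ bij
  open Cover _≟_
  open import Data.List.Membership.DecPropositional _≟_ using (_∈?_)
  open import Data.List.Relation.Unary.Unique.DecPropositional _≟_ using (unique?)

  module _ {S : List A} (uS : Unique S) (S⊆ : ∀ {x} → x ∈ S → x ∈ D) (inv : Inv S) {x : A} (x∈ : x ∈ S) where

    φS : ∀ {y} → y ∈ S → φ y ∈ S
    φS y∈ = proj₁ (All.lookup inv y∈)

    injective : ∀ {y z} → y ∈ S → z ∈ S → φ y ≡ φ z → y ≡ z
    injective y∈ z∈ = φ-injective (S⊆ y∈) (S⊆ z∈)

    moved : ∀ {y} → y ∈ S → φ y ≢ y
    moved y∈ = φ≢ (S⊆ y∈)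

    orbit₂-⊆ : ∀ {e} → e ∈ x ∷ φ x ∷ [] → e ∈ S
    orbit₂-⊆ (here refl) = x∈
    orbit₂-⊆ (there (here refl)) = φS x∈

    orbit₃-⊆ : ∀ {e} → e ∈ x ∷ φ x ∷ φ (φ x) ∷ [] → e ∈ S
    orbit₃-⊆ (here refl) = x∈
    orbit₃-⊆ (there (here refl)) = φS x∈
    orbit₃-⊆ (there (there (here refl))) = φS (φS x∈)

    orbit₄-⊆ : ∀ {e} → e ∈ x ∷ φ x ∷ φ (φ x) ∷ φ (φ (φ x)) ∷ [] → e ∈ S
    orbit₄-⊆ (here refl) = x∈
    orbit₄-⊆ (there (here refl)) = φS x∈
    orbit₄-⊆ (there (there (here refl))) = φS (φS x∈)
    orbit₄-⊆ (there (there (there (here refl)))) = φS (φS (φS x∈))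

    orbits₂₂-⊆ : ∀ {v} → v ∈ S → ∀ {e} → e ∈ x ∷ φ x ∷ v ∷ φ v ∷ [] → e ∈ S
    orbits₂₂-⊆ v∈ (here refl) = x∈
    orbits₂₂-⊆ v∈ (there (here refl)) = φS x∈
    orbits₂₂-⊆ v∈ (there (there (here refl))) = v∈
    orbits₂₂-⊆ v∈ (there (there (there (here refl)))) = φS v∈

    x≢φx : x ≢ φ x
    x≢φx eq = moved x∈ (sym eq)

    φx≢φφx : φ x ≢ φ (φ x)
    φx≢φφx eq = moved (φS x∈) (sym eq)

    uOrbit₃ : φ (φ x) ≢ x → Unique (x ∷ φ x ∷ φ (φ x) ∷ [])
    uOrbit₃ ne = (x≢φx ∷ (λ eq → ne (sym eq)) ∷ []) ∷ (φx≢φφx ∷ []) ∷ [] ∷ []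

    cover₂ : length S ≡ 2 → φ (φ x) ≡ x × (∀ {e} → e ∈ S → e ∈ x ∷ φ x ∷ [])
    cover₂ len with cover {x ∷ φ x ∷ []} {S} ((x≢φx ∷ []) ∷ [] ∷ []) orbit₂-⊆ (≤-reflexive len)
    ... | c with c (φS (φS x∈))
    ...   | here eq         = eq , c
    ...   | there (here eq) = contradiction (sym eq) φx≢φφx

    -- Without fixed points, three points can only form a 3-cycle: if x were on a 2-cycle, the third
    -- point would have no image left.
    cover₃ : length S ≡ 3 → φ (φ (φ x)) ≡ x × (∀ {e} → e ∈ S → e ∈ x ∷ φ x ∷ φ (φ x) ∷ [])
    cover₃ len with φ (φ x) ≟ x
    ... | no ne with cover (uOrbit₃ ne) orbit₃-⊆ (≤-reflexive len)
    ...   | c with c (φS (φS (φS x∈)))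
    ...     | here eq                 = eq , c
    ...     | there (here eq)         = contradiction (injective (φS (φS x∈)) x∈ eq) ne
    ...     | there (there (here eq)) = contradiction eq (moved (φS (φS x∈)))
    cover₃ len | yes e₂ with escape {x ∷ φ x ∷ []} {S} uS (≤-reflexive (sym len))
    ... | v , v∈ , v∉ with cover {x ∷ φ x ∷ v ∷ []} {S}
                         ((x≢φx ∷ (λ eq → v∉ (here (sym eq))) ∷ []) ∷ ((λ eq → v∉ (there (here (sym eq)))) ∷ []) ∷ [] ∷ [])
                         (λ { (here refl) → x∈ ; (there (here refl)) → φS x∈ ; (there (there (here refl))) → v∈ })
                         (≤-reflexive len) (φS v∈)
    ...   | here eq = contradiction (there (here (injective v∈ (φS x∈) (≡-trans eq (sym e₂))))) v∉
    ...   | there (here eq) = contradiction (here (injective v∈ x∈ eq)) v∉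
    ...   | there (there (here eq)) = contradiction eq (moved v∈)

    -- If φ³ x = x, the fourth point would have to be fixed; as x is not on a 2-cycle either, its
    -- orbit fills S.
    cover₄ : length S ≡ 4 → φ (φ x) ≢ x → ∀ {e} → e ∈ S → e ∈ x ∷ φ x ∷ φ (φ x) ∷ φ (φ (φ x)) ∷ []
    cover₄ len ne with φ (φ (φ x)) ≟ x
    ... | no ne₃ = cover
      ((x≢φx ∷ (λ eq → ne (sym eq)) ∷ (λ eq → ne₃ (sym eq)) ∷ []) ∷
       (φx≢φφx ∷ (λ eq → ne (injective (φS (φS x∈)) x∈ (sym eq))) ∷ []) ∷
       ((λ eq → moved (φS (φS x∈)) (sym eq)) ∷ []) ∷ [] ∷ [])
      orbit₄-⊆ (≤-reflexive len)
    ... | yes e₃ with escape {x ∷ φ x ∷ φ (φ x) ∷ []} {S} uS (≤-reflexive (sym len))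
    ...   | v , v∈ , v∉ with cover {v ∷ x ∷ φ x ∷ φ (φ x) ∷ []} {S} (∉⇒#-All v∉ ∷ uOrbit₃ ne)
                           (λ { (here refl) → v∈ ; (there i) → orbit₃-⊆ i }) (≤-reflexive len) (φS v∈)
    ...     | here eq = contradiction eq (moved v∈)
    ...     | there (here eq) = contradiction (there (there (here (injective v∈ (φS (φS x∈)) (≡-trans eq (sym e₃)))))) v∉
    ...     | there (there (here eq)) = contradiction (here (injective v∈ x∈ eq)) v∉
    ...     | there (there (there (here eq))) = contradiction (there (here (injective v∈ (φS x∈) eq))) v∉

    cover₂₂ : length S ≡ 4 → φ (φ x) ≡ x → ∀ {v} → v ∈ S → v ≢ x → v ≢ φ x →
              ∀ {e} → e ∈ S → e ∈ x ∷ φ x ∷ v ∷ φ v ∷ []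
    cover₂₂ len e₂ {v} v∈ v≢x v≢φx = cover
      ((x≢φx ∷ (λ eq → v≢x (sym eq)) ∷ (λ eq → v≢φx (injective v∈ (φS x∈) (≡-trans (sym eq) (sym e₂)))) ∷ []) ∷
       ((λ eq → v≢φx (sym eq)) ∷ (λ eq → v≢x (injective v∈ x∈ (sym eq))) ∷ []) ∷
       ((λ eq → moved v∈ (sym eq)) ∷ []) ∷ [] ∷ [])
      (orbits₂₂-⊆ v∈) (≤-reflexive len)

  -- Distinctness is recorded because a tail counted by `rooted` is any sublist of D and might
  -- contain the root x again.
  Good : List A → Set
  Good S = Inv S × Unique S

  good? : Decidable Good
  good? S = inv? S ×-dec unique? S

  #fix₂ #fix₃ : ℕ
  #fix₂ = ∑ D (λ x → 𝟙 (φ (φ x) ≟ x))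
  #fix₃ = ∑ D (λ x → 𝟙 (φ (φ (φ x)) ≟ x))

  rooted : A → ℕ → ℕ
  rooted x m = ∑ (choose m D) (λ S → 𝟙 (good? (x ∷ S)))

  #invariant-rooted : ∀ m → #invariant (suc m) ≤ ∑ D (λ x → rooted x m)
  #invariant-rooted m = ≤-trans
    (∑-mono (choose (suc m) D) (λ {S} S∈ → 𝟙-mono (inv? S) (good? S) (λ i → i , choose-Unique (suc m) u S∈)))
    (∑-choose-suc-≤ (λ S → 𝟙 (good? S)) m D)

  ∷-⊆ : ∀ m {x S} → x ∈ D → S ∈ choose m D → ∀ {y} → y ∈ x ∷ S → y ∈ D
  ∷-⊆ m x∈ S∈ (here refl) = x∈
  ∷-⊆ m x∈ S∈ (there y∈)  = choose-⊆ m D S∈ y∈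

  tail-⊆ : {x : A} {S S′ : List A} → Unique (x ∷ S) → (∀ {e} → e ∈ x ∷ S → e ∈ x ∷ S′) → ∀ {e} → e ∈ S → e ∈ S′
  tail-⊆ (x# ∷ _) f e∈ with f (there e∈)
  ... | here refl = contradiction refl (All.lookup x# e∈)
  ... | there i   = i

  module _ (m : ℕ) {x : A} (x∈ : x ∈ D) where

    rooted≤1 : (L : List A) → (∀ {S} → S ∈ choose m D → Good (x ∷ S) → (∀ {e} → e ∈ x ∷ S → e ∈ L) × (∀ {e} → e ∈ L → e ∈ x ∷ S)) →
               rooted x m ≤ 1
    rooted≤1 L h = ∑-atMostOne (good? ∘ (x ∷_)) (Unique-choose u m) λ S∈ S′∈ g g′ →
      choose-ext m u S∈ S′∈ (tail-⊆ (proj₂ g) (proj₂ (h S′∈ g′) ∘ proj₁ (h S∈ g)))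
                            (tail-⊆ (proj₂ g′) (proj₂ (h S∈ g) ∘ proj₁ (h S′∈ g′)))

    ∷-length : ∀ {S} → S ∈ choose m D → length (x ∷ S) ≡ suc m
    ∷-length S∈ = cong suc (choose-length m D S∈)

  #invariant-0 : #invariant 0 ≤ 1
  #invariant-0 = ≤-trans (≤-reflexive (∑-choose-0 (λ S → 𝟙 (inv? S)) D)) (𝟙≤1 (inv? []))

  #invariant-1 : #invariant 1 ≤ 0
  #invariant-1 = ≤-reflexive (∑-0 (choose 1 D) (λ {S} S∈ → 𝟙-no (inv? S) (impossible S∈)))
    where
    impossible : ∀ {S} → S ∈ choose 1 D → ¬ Inv S
    impossible {S} S∈ i with S | choose-length 1 D S∈ | choose-⊆ 1 D S∈ | i
    ... | x ∷ [] | _ | S⊆ | (here eq , _) ∷ [] = φ≢ (S⊆ (here refl)) eq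

  #invariant-2 : #invariant 2 ≤ #fix₂
  #invariant-2 = ≤-trans (#invariant-rooted 1) (∑-mono D (λ {x} x∈ → begin
    rooted x 1       ≡⟨ *-identityʳ _ ⟨
    rooted x 1 * 1   ≤⟨ atMostOne-* (good? ∘ (x ∷_)) (choose 1 D)
       (rooted≤1 1 x∈ (x ∷ φ x ∷ []) (λ S∈ g →
          proj₂ (cover₂ (proj₂ g) (∷-⊆ 1 x∈ S∈) (proj₁ g) (here refl) (∷-length 1 x∈ S∈)) ,
          orbit₂-⊆ (proj₂ g) (∷-⊆ 1 x∈ S∈) (proj₁ g) (here refl)))
       (λ S∈ g → ≤-reflexive (sym (𝟙-yes (φ (φ x) ≟ x)
          (proj₁ (cover₂ (proj₂ g) (∷-⊆ 1 x∈ S∈) (proj₁ g) (here refl) (∷-length 1 x∈ S∈)))))) ⟩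
    𝟙 (φ (φ x) ≟ x)  ∎))
    where open ≤-Reasoning

  #invariant-3 : #invariant 3 ≤ #fix₃
  #invariant-3 = ≤-trans (#invariant-rooted 2) (∑-mono D (λ {x} x∈ → begin
    rooted x 2       ≡⟨ *-identityʳ _ ⟨
    rooted x 2 * 1   ≤⟨ atMostOne-* (good? ∘ (x ∷_)) (choose 2 D)
       (rooted≤1 2 x∈ (x ∷ φ x ∷ φ (φ x) ∷ []) (λ S∈ g →
          proj₂ (cover₃ (proj₂ g) (∷-⊆ 2 x∈ S∈) (proj₁ g) (here refl) (∷-length 2 x∈ S∈)) ,
          orbit₃-⊆ (proj₂ g) (∷-⊆ 2 x∈ S∈) (proj₁ g) (here refl)))
       (λ S∈ g → ≤-reflexive (sym (𝟙-yes (φ (φ (φ x)) ≟ x)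
          (proj₁ (cover₃ (proj₂ g) (∷-⊆ 2 x∈ S∈) (proj₁ g) (here refl) (∷-length 2 x∈ S∈)))))) ⟩
    𝟙 (φ (φ (φ x)) ≟ x)  ∎))
    where open ≤-Reasoning

  -- When x lies on a 2-cycle, a four-element invariant set is {x, φ x, v, φ v}, and v can be read
  -- off the list: one of the first two entries of the tail differs from φ x. The fallback x is for
  -- tails too short to occur.
  avoid : A → List A → A
  avoid x (y ∷ z ∷ _) with y ≟ φ x
  ... | yes _ = z
  ... | no _  = y
  avoid x _ = x

  avoid-spec : ∀ x {S} → 2 ≤ length S → Unique S → avoid x S ∈ S × avoid x S ≢ φ x
  avoid-spec x {y ∷ z ∷ S} _ ((y≢z ∷ _) ∷ _) with y ≟ φ x
  ... | yes eq = there (here refl) , λ z≡ → y≢z (≡-trans eq (sym z≡))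
  ... | no ne  = here refl , ne
  avoid-spec x {_ ∷ []} (s≤s ()) _

  -- If x is not on a 2-cycle, the set must be the 4-cycle of x. Otherwise it is determined by its
  -- second 2-cycle, hence by the single point `avoid x S`.
  rooted-3 : ∀ {x} → x ∈ D → rooted x 3 ≤ 1 + 𝟙 (φ (φ x) ≟ x) * length D
  rooted-3 {x} x∈ with φ (φ x) ≟ x
  ... | no ne = rooted≤1 3 x∈ (x ∷ φ x ∷ φ (φ x) ∷ φ (φ (φ x)) ∷ []) λ S∈ g →
    cover₄ (proj₂ g) (∷-⊆ 3 x∈ S∈) (proj₁ g) (here refl) (∷-length 3 x∈ S∈) ne ,
    orbit₄-⊆ (proj₂ g) (∷-⊆ 3 x∈ S∈) (proj₁ g) (here refl)
  ... | yes e₂ = ≤-trans (count-injection _≟_ (Unique-choose u 3) (good? ∘ (x ∷_)) (avoid x) into inj)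
                         (≤-trans (≤-reflexive (sym (+-identityʳ _))) (ℕₚ.n≤1+n _))
    where
    spec : ∀ {S} → S ∈ choose 3 D → Good (x ∷ S) → avoid x S ∈ S × avoid x S ≢ φ x
    spec S∈ (_ , _ ∷ uS) = avoid-spec x (≤-trans (s≤s (s≤s z≤n)) (≤-reflexive (sym (choose-length 3 D S∈)))) uS
    into : ∀ {S} → S ∈ choose 3 D → Good (x ∷ S) → avoid x S ∈ D
    into S∈ g = choose-⊆ 3 D S∈ (proj₁ (spec S∈ g))
    covered : ∀ {S} → S ∈ choose 3 D → Good (x ∷ S) → ∀ {e} → e ∈ x ∷ S → e ∈ x ∷ φ x ∷ avoid x S ∷ φ (avoid x S) ∷ []
    covered {S} S∈ g@(i , uS@(x# ∷ _)) = cover₂₂ uS (∷-⊆ 3 x∈ S∈) i (here refl) (∷-length 3 x∈ S∈) e₂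
      (there (proj₁ (spec S∈ g))) (λ eq → All.lookup x# (proj₁ (spec S∈ g)) (sym eq)) (proj₂ (spec S∈ g))
    half : ∀ {S S′} → S ∈ choose 3 D → S′ ∈ choose 3 D → Good (x ∷ S) → Good (x ∷ S′) → avoid x S ≡ avoid x S′ →
           ∀ {e} → e ∈ S → e ∈ S′
    half {S} {S′} S∈ S′∈ g g′ eq = tail-⊆ (proj₂ g) λ e∈ →
      orbits₂₂-⊆ (proj₂ g′) (∷-⊆ 3 x∈ S′∈) (proj₁ g′) (here refl) (there (proj₁ (spec S′∈ g′)))
        (subst (λ v → _ ∈ x ∷ φ x ∷ v ∷ φ v ∷ []) eq (covered S∈ g e∈))
    inj : ∀ {S S′} → S ∈ choose 3 D → S′ ∈ choose 3 D → Good (x ∷ S) → Good (x ∷ S′) → avoid x S ≡ avoid x S′ → S ≡ S′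
    inj S∈ S′∈ g g′ eq = choose-ext 3 u S∈ S′∈ (half S∈ S′∈ g g′ eq) (half S′∈ S∈ g′ g (sym eq))

  #invariant-4 : #invariant 4 ≤ length D * (1 + #fix₂)
  #invariant-4 = begin
    #invariant 4                                             ≤⟨ #invariant-rooted 3 ⟩
    ∑ D (λ x → rooted x 3)                                   ≤⟨ ∑-mono D rooted-3 ⟩
    ∑ D (λ x → 1 + 𝟙 (φ (φ x) ≟ x) * length D)               ≡⟨ ∑-+ (λ _ → 1) _ D ⟩
    ∑ D (λ _ → 1) + ∑ D (λ x → 𝟙 (φ (φ x) ≟ x) * length D)   ≡⟨ cong₂ _+_ (∑-1 D) (∑-*ʳ _ (length D) D) ⟩
    length D + #fix₂ * length D                              ≡⟨ *-comm (1 + #fix₂) (length D) ⟩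
    length D * (1 + #fix₂)                                   ∎
    where open ≤-Reasoning

∑-antidiagonal-shift : (f : ℕ × ℕ → ℕ) (m k : ℕ) →
  ∑ (antidiagonal k) (λ ij → f (m + proj₁ ij , proj₂ ij)) ≤ ∑ (antidiagonal (m + k)) f
∑-antidiagonal-shift f zero    k = ≤-refl
∑-antidiagonal-shift f (suc m) k = ≤-trans
  (∑-antidiagonal-shift (λ ij → f (suc (proj₁ ij) , proj₂ ij)) m k)
  (≤-trans (m≤n+m _ (f (0 , suc (m + k)))) (≤-reflexive (sym (∑-antidiagonal-suc f (m + k)))))

C-drop₃ : ∀ f j → f C (3 + j) ≤ f * (f * f) * (f C j)
C-drop₃ f j = begin
  f C (3 + j)                  ≤⟨ C-suc-≤ f (2 + j) ⟩
  f * (f C (2 + j))            ≤⟨ *-monoʳ-≤ f (C-suc-≤ f (1 + j)) ⟩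
  f * (f * (f C (1 + j)))      ≤⟨ *-monoʳ-≤ f (*-monoʳ-≤ f (C-suc-≤ f j)) ⟩
  f * (f * (f * (f C j)))      ≡⟨ regroup f (f C j) ⟩
  f * (f * f) * (f C j)        ∎
  where
  open ≤-Reasoning
  regroup : ∀ f c → f * (f * (f * c)) ≡ f * (f * f) * c
  regroup = solve-∀

-- Counting the invariant sets of a single bijection

module FewInvariant {A : Set} (_≟_ : DecidableEquality A) {D : List A} (u : Unique D) (bij : Bijection D) where
  open Bijection bij
  open Invariant _≟_ bij

  fixed? : ∀ x → Dec (φ x ≡ x)
  fixed? x = φ x ≟ x

  Fixed Moved : List A
  Fixed = filter fixed? D
  Moved = filter (¬? ∘ fixed?) D

  ∈Moved⁻ : ∀ {x} → x ∈ Moved → x ∈ D × φ x ≢ x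
  ∈Moved⁻ = ∈ₚ.∈-filter⁻ (¬? ∘ fixed?) {xs = D}

  bijMoved : Bijection Moved
  bijMoved = record
    { φ = φ ; ψ = ψ
    ; φ∈ = λ x∈ → let (x∈D , ne) = ∈Moved⁻ x∈ in
        ∈ₚ.∈-filter⁺ (¬? ∘ fixed?) (φ∈ x∈D) (λ eq → ne (φ-injective (φ∈ x∈D) x∈D eq))
    ; ψ∈ = λ x∈ → let (x∈D , ne) = ∈Moved⁻ x∈ in
        ∈ₚ.∈-filter⁺ (¬? ∘ fixed?) (ψ∈ x∈D) (λ eq → ne (≡-trans (cong φ (≡-trans (sym (φψ x∈D)) eq)) (φψ x∈D)))
    ; ψφ = λ x∈ → ψφ (proj₁ (∈Moved⁻ x∈))
    ; φψ = λ x∈ → φψ (proj₁ (∈Moved⁻ x∈)) }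

  uMoved : Unique Moved
  uMoved = Uniqueₚ.filter⁺ (¬? ∘ fixed?) u

  private
    module M  = Invariant _≟_ bijMoved
    module L  = LowOrder _≟_ uMoved bijMoved (λ x∈ → proj₂ (∈Moved⁻ x∈))
    module In = Independent _≟_ uMoved bijMoved (λ x∈ → proj₂ (∈Moved⁻ x∈))

  N f s #fix₁ #fix₂ #fix₃ : ℕ
  N = length D
  f = length Fixed
  s = length Moved
  #fix₁ = ∑ D (λ x → 𝟙 (φ x ≟ x))
  #fix₂ = ∑ D (λ x → 𝟙 (φ (φ x) ≟ x))
  #fix₃ = ∑ D (λ x → 𝟙 (φ (φ (φ x)) ≟ x))

  f≡#fix₁ : f ≡ #fix₁
  f≡#fix₁ = length-filter fixed? D

  D↭ : D ↭ Moved ++ Fixed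
  D↭ = ↭-trans (filter-split-↭ fixed? D) (↭ₚ.++-comm Fixed Moved)

  s+f≡N : s + f ≡ N
  s+f≡N = sym (≡-trans (↭ₚ.↭-length D↭) (Listₚ.length-++ Moved))

  Moved-≤ : {P : A → Set} (P? : Decidable P) → ∑ Moved (λ x → 𝟙 (P? x)) ≤ ∑ D (λ x → 𝟙 (P? x))
  Moved-≤ P? = ∑-reindex-≤ _≟_ uMoved id (λ x → 𝟙 (P? x)) (λ x∈ → proj₁ (∈Moved⁻ x∈)) (λ _ _ eq → eq)

  Inv-Moved : ∀ m a {S S′} → S ∈ choose m Moved → S′ ∈ choose a Fixed → Inv (S ++ S′) → M.Inv S
  Inv-Moved m a {S} {S′} S∈ S′∈ inv = All.tabulate λ x∈ → let
      x∈M = choose-⊆ m Moved S∈ x∈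
      (φx∈ , ψx∈) = All.lookup inv (∈ₚ.∈-++⁺ˡ x∈) in
      keep (Bijection.φ∈ bijMoved x∈M) φx∈ , keep (Bijection.ψ∈ bijMoved x∈M) ψx∈
    where
    keep : ∀ {y} → y ∈ Moved → y ∈ S ++ S′ → y ∈ S
    keep y∈M y∈ with ∈ₚ.∈-++⁻ S y∈
    ... | inj₁ i = i
    ... | inj₂ i = contradiction (proj₂ (∈ₚ.∈-filter⁻ fixed? {xs = D} (choose-⊆ a Fixed S′∈ i))) (proj₂ (∈Moved⁻ y∈M))

  -- Fixed points may be added to or removed from an invariant set at will, so only its moved part
  -- is constrained.
  #invariant-split : ∀ k → #invariant k ≤ ∑ (antidiagonal k) (λ ma → M.#invariant (proj₁ ma) * (f C proj₂ ma))
  #invariant-split k = begin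
    #invariant k ≡⟨ ≡-trans (∑-choose-↭ _ 𝟙-inv-↭ k D↭) (∑-choose-++ _ k Moved Fixed) ⟩
    ∑ (antidiagonal k) (λ ma → ∑ (choose (proj₁ ma) Moved) (λ S → ∑ (choose (proj₂ ma) Fixed) (λ S′ → 𝟙 (inv? (S ++ S′)))))
      ≤⟨ ∑-mono (antidiagonal k) (λ {ma} _ → ∑-mono (choose (proj₁ ma) Moved) (λ {S} S∈ →
           ∑-≤-const (𝟙 (M.inv? S)) (choose (proj₂ ma) Fixed) (λ {S′} S′∈ →
             𝟙-mono (inv? (S ++ S′)) (M.inv? S) (Inv-Moved (proj₁ ma) (proj₂ ma) S∈ S′∈)))) ⟩
    ∑ (antidiagonal k) (λ ma → ∑ (choose (proj₁ ma) Moved) (λ S → length (choose (proj₂ ma) Fixed) * 𝟙 (M.inv? S)))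
      ≡⟨ ∑-cong (antidiagonal k) (λ {ma} _ → ≡-trans (∑-*ˡ (length (choose (proj₂ ma) Fixed)) (λ S → 𝟙 (M.inv? S)) (choose (proj₁ ma) Moved))
           (≡-trans (*-comm (length (choose (proj₂ ma) Fixed)) (M.#invariant (proj₁ ma))) (cong (M.#invariant (proj₁ ma) *_) (length-choose (proj₂ ma) Fixed)))) ⟩
    ∑ (antidiagonal k) (λ ma → M.#invariant (proj₁ ma) * (f C proj₂ ma)) ∎
    where open ≤-Reasoning

  module _ (4f≤N : 4 * f ≤ N) (20≤N : 20 ≤ N) where

    X : ℕ
    X = N * (N * N)

    3N≤4s : 3 * N ≤ 4 * s
    3N≤4s = ℕₚ.+-cancelʳ-≤ (4 * f) (3 * N) (4 * s) (begin
      3 * N + 4 * f   ≤⟨ +-monoʳ-≤ (3 * N) 4f≤N ⟩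
      3 * N + N       ≡⟨ +-comm (3 * N) N ⟩
      4 * N           ≡⟨ cong (4 *_) s+f≡N ⟨
      4 * (s + f)     ≡⟨ *-distribˡ-+ 4 s f ⟩
      4 * s + 4 * f   ∎)
      where open ≤-Reasoning

    N≤2s : N ≤ 2 * s
    N≤2s = ℕₚ.*-cancelˡ-≤ 2 (begin
      2 * N   ≤⟨ *-monoˡ-≤ N {2} {3} (s≤s (s≤s z≤n)) ⟩
      3 * N   ≤⟨ 3N≤4s ⟩
      4 * s   ≡⟨ *-assoc 2 2 s ⟩
      2 * (2 * s) ∎)
      where open ≤-Reasoning

    s≤2p : s ≤ 2 * In.p
    s≤2p = begin
      s             ≡⟨ In.r+p≡ ⟨
      In.r + In.p   ≤⟨ +-monoˡ-≤ In.p In.r≤p ⟩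
      In.p + In.p   ≡⟨ cong (In.p +_) (sym (+-identityʳ In.p)) ⟩
      2 * In.p      ∎
      where open ≤-Reasoning

    N≤4p : N ≤ 4 * In.p
    N≤4p = ≤-trans N≤2s (≤-trans (*-monoʳ-≤ 2 s≤2p) (≤-reflexive (sym (*-assoc 2 2 In.p))))

    large : ∀ c a b → N ≤ c * a → c * b < 20 → b ≤ a
    large c a b N≤ lt with b ≤? a
    ... | yes q = q
    ... | no ¬q = contradiction (≤-trans 20≤N N≤) (ℕₚ.<⇒≱ (ℕₚ.≤-<-trans (*-monoʳ-≤ c (ℕₚ.<⇒≤ (ℕₚ.≰⇒> ¬q))) lt))

    cube : ∀ c a → N ≤ c * a → 3 ≤ a → X ≤ (c * (c * c)) * (27 * (a C 3))
    cube c a N≤ 3≤a = begin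
      N * (N * N)                       ≤⟨ *-mono-≤ N≤ (*-mono-≤ N≤ N≤) ⟩
      (c * a) * ((c * a) * (c * a))     ≡⟨ regroup c a ⟩
      (c * (c * c)) * (a * (a * a))     ≤⟨ *-monoʳ-≤ (c * (c * c)) (C3-lower {a} 3≤a) ⟩
      (c * (c * c)) * (27 * (a C 3))    ∎
      where
      open ≤-Reasoning
      regroup : ∀ c a → (c * a) * ((c * a) * (c * a)) ≡ (c * (c * c)) * (a * (a * a))
      regroup = solve-∀

    -- 216 = 2³ · 27 from N ≤ 2s, and 1728 = 4³ · 27 below from N ≤ 4p; the factor 27 is that of
    -- `C3-lower`. In the same way 2048 = 2³ · 256.
    X≤s3 : X ≤ 216 * (s C 3)
    X≤s3 = ≤-trans (cube 2 s N≤2s (large 2 s 3 N≤2s (ℕₚ.m≤m+n 7 13))) (≤-reflexive (sym (*-assoc 8 27 (s C 3))))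

    X≤p3 : X ≤ 1728 * (In.p C 3)
    X≤p3 = ≤-trans (cube 4 In.p N≤4p (large 4 In.p 3 N≤4p (ℕₚ.m≤m+n 13 7))) (≤-reflexive (sym (*-assoc 64 27 (In.p C 3))))

    X*s≤s4 : X * s ≤ 2048 * (s C 4)
    X*s≤s4 = begin
      N * (N * N) * s                          ≤⟨ *-monoˡ-≤ s (*-mono-≤ N≤2s (*-mono-≤ N≤2s N≤2s)) ⟩
      (2 * s) * ((2 * s) * (2 * s)) * s        ≡⟨ regroup s ⟩
      8 * (s * (s * (s * s)))                  ≤⟨ *-monoʳ-≤ 8 (C4-lower {s} (large 2 s 4 N≤2s (ℕₚ.m≤m+n 9 11))) ⟩
      8 * (256 * (s C 4))                      ≡⟨ sym (*-assoc 8 256 (s C 4)) ⟩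
      2048 * (s C 4)                           ∎
      where
      open ≤-Reasoning
      regroup : ∀ s → (2 * s) * ((2 * s) * (2 * s)) * s ≡ 8 * (s * (s * (s * s)))
      regroup = solve-∀

    G : ℕ × ℕ → ℕ
    G ma = M.#invariant (proj₁ ma) * (f C proj₂ ma)

    B-term : ∀ i j → (s C i) * (f C j) ≤ N C (i + j)
    B-term i j = ≤-trans (vandermonde-≤ s f i j) (≤-reflexive (cong (_C (i + j)) s+f≡N))

    -- The exchange behind the small cases: N³ is at most a multiple of C(s, 3), so a configuration
    -- of weight w with j freely chosen fixed points is traded for three free moved points, and
    -- Vandermonde bounds the outcome by C(N, 3 + j).
    bound₃ : ∀ j w {g} → g ≤ w * (f C j) → g * X ≤ 216 * w * (N C (3 + j))
    bound₃ j w {g} g≤ = begin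
      g * X                                 ≤⟨ *-mono-≤ g≤ X≤s3 ⟩
      w * (f C j) * (216 * (s C 3))         ≡⟨ regroup 216 w (f C j) (s C 3) ⟩
      216 * w * ((s C 3) * (f C j))         ≤⟨ *-monoʳ-≤ (216 * w) (B-term 3 j) ⟩
      216 * w * (N C (3 + j))               ∎
      where
      open ≤-Reasoning
      regroup : ∀ k w a b → w * a * (k * b) ≡ k * w * (b * a)
      regroup = solve-∀

    term₀ : ∀ j → G (0 , 3 + j) * X ≤ 216 * (f * (f * f)) * (N C (3 + j))
    term₀ j = bound₃ j (f * (f * f)) (≤-trans (*-monoˡ-≤ (f C (3 + j)) L.#invariant-0) (≤-trans (≤-reflexive (*-identityˡ _)) (C-drop₃ f j)))

    term₁ : ∀ a → G (1 , a) * X ≤ 0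
    term₁ a = ≤-trans (*-monoˡ-≤ X (*-monoˡ-≤ (f C a) L.#invariant-1)) z≤n

    term₂ : ∀ j → G (2 , 1 + j) * X ≤ 216 * (f * #fix₂) * (N C (3 + j))
    term₂ j = bound₃ j (f * #fix₂) (begin
      M.#invariant 2 * (f C suc j)   ≤⟨ *-mono-≤ (≤-trans L.#invariant-2 (Moved-≤ (λ x → φ (φ x) ≟ x))) (C-suc-≤ f j) ⟩
      #fix₂ * (f * (f C j))          ≡⟨ regroup #fix₂ f (f C j) ⟩
      f * #fix₂ * (f C j)            ∎)
      where
      open ≤-Reasoning
      regroup : ∀ a b c → a * (b * c) ≡ b * a * c
      regroup = solve-∀

    term₃ : ∀ j → G (3 , j) * X ≤ 216 * #fix₃ * (N C (3 + j))
    term₃ j = bound₃ j #fix₃ (*-monoˡ-≤ (f C j) (≤-trans L.#invariant-3 (Moved-≤ (λ x → φ (φ (φ x)) ≟ x))))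

    -- The bound for four moved points carries an extra factor s; asking for four free moved points
    -- in exchange, instead of three, absorbs it.
    term₄ : ∀ j → G (4 , j) * X ≤ 2048 * (1 + #fix₂) * (N C (4 + j))
    term₄ j = begin
      M.#invariant 4 * (f C j) * X            ≤⟨ *-monoˡ-≤ X (*-monoˡ-≤ (f C j) (≤-trans L.#invariant-4 (*-monoʳ-≤ s (+-monoʳ-≤ 1 (Moved-≤ (λ x → φ (φ x) ≟ x)))))) ⟩
      s * (1 + #fix₂) * (f C j) * X           ≡⟨ regroup s (1 + #fix₂) (f C j) X ⟩
      (1 + #fix₂) * (f C j) * (X * s)         ≤⟨ *-monoʳ-≤ ((1 + #fix₂) * (f C j)) X*s≤s4 ⟩
      (1 + #fix₂) * (f C j) * (2048 * (s C 4)) ≡⟨ regroup′ 2048 (1 + #fix₂) (f C j) (s C 4) ⟩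
      2048 * (1 + #fix₂) * ((s C 4) * (f C j)) ≤⟨ *-monoʳ-≤ (2048 * (1 + #fix₂)) (B-term 4 j) ⟩
      2048 * (1 + #fix₂) * (N C (4 + j))      ∎
      where
      open ≤-Reasoning
      regroup : ∀ s g c x → s * g * c * x ≡ g * c * (x * s)
      regroup = solve-∀
      regroup′ : ∀ k w a b → w * a * (k * b) ≡ k * w * (b * a)
      regroup′ = solve-∀

    -- All numbers of moved points from five on are treated at once: each term gains C(p, 3) and is
    -- compared with its own Vandermonde term, so the whole sum costs a single binomial coefficient.
    tail₅ : ∀ j → 2 * (5 + j) ≤ N → ∑ (antidiagonal j) (λ ma → G (5 + proj₁ ma , proj₂ ma)) * X ≤ 1728 * (N C (5 + j))
    tail₅ j 2k≤N = begin
      ∑ (antidiagonal j) (λ ma → G (5 + proj₁ ma , proj₂ ma)) * X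
        ≡⟨ ∑-*ʳ (λ ma → G (5 + proj₁ ma , proj₂ ma)) X (antidiagonal j) ⟨
      ∑ (antidiagonal j) (λ ma → G (5 + proj₁ ma , proj₂ ma) * X)
        ≤⟨ ∑-mono (antidiagonal j) (λ {ma} ma∈ → term (proj₁ ma) (proj₂ ma) (∈-antidiagonal j ma∈)) ⟩
      ∑ (antidiagonal j) (λ ma → 1728 * ((s C (5 + proj₁ ma)) * (f C proj₂ ma)))
        ≡⟨ ∑-*ˡ 1728 (λ ma → (s C (5 + proj₁ ma)) * (f C proj₂ ma)) (antidiagonal j) ⟩
      1728 * ∑ (antidiagonal j) (λ ma → (s C (5 + proj₁ ma)) * (f C proj₂ ma))
        ≤⟨ *-monoʳ-≤ 1728 (∑-antidiagonal-shift (λ ma → (s C proj₁ ma) * (f C proj₂ ma)) 5 j) ⟩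
      1728 * ∑ (antidiagonal (5 + j)) (λ ma → (s C proj₁ ma) * (f C proj₂ ma))
        ≡⟨ cong (1728 *_) (≡-trans (sym (vandermonde s f (5 + j))) (cong (_C (5 + j)) s+f≡N)) ⟩
      1728 * (N C (5 + j)) ∎
      where
      open ≤-Reasoning
      -- Since 2k ≤ N and 3N ≤ 4s, a set of k = 5 + j points leaves five moved points over once N ≥
      -- 20; `#invariant-middle` needs this for every number of moved points up to k.
      room : 5 + j + 5 ≤ s
      room = ℕₚ.*-cancelˡ-≤ 4 (begin
        4 * (5 + j + 5)          ≡⟨ regroup j ⟩
        20 + 2 * (2 * (5 + j))   ≤⟨ +-mono-≤ 20≤N (*-monoʳ-≤ 2 2k≤N) ⟩
        N + 2 * N                ≡⟨⟩
        3 * N                    ≤⟨ 3N≤4s ⟩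
        4 * s                    ∎)
        where
        regroup : ∀ j → 4 * (5 + j + 5) ≡ 20 + 2 * (2 * (5 + j))
        regroup = solve-∀
      term : ∀ m a → m + a ≡ j → G (5 + m , a) * X ≤ 1728 * ((s C (5 + m)) * (f C a))
      term m a refl = begin
        M.#invariant (5 + m) * (f C a) * X                    ≤⟨ *-monoʳ-≤ (M.#invariant (5 + m) * (f C a)) X≤p3 ⟩
        M.#invariant (5 + m) * (f C a) * (1728 * (In.p C 3))  ≡⟨ regroup (M.#invariant (5 + m)) (f C a) 1728 (In.p C 3) ⟩
        1728 * (M.#invariant (5 + m) * (In.p C 3) * (f C a))
          ≤⟨ *-monoʳ-≤ 1728 (*-monoˡ-≤ (f C a) (In.#invariant-middle (5 + m) (m≤m+n 5 m)
               (≤-trans (+-monoˡ-≤ 5 (+-monoʳ-≤ 5 (m≤m+n m a))) room))) ⟩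
        1728 * ((s C (5 + m)) * (f C a)) ∎
        where
        regroup : ∀ g c k d → g * c * (k * d) ≡ k * (g * d * c)
        regroup = solve-∀

    weight : ℕ
    weight = f * (f * f) + f * #fix₂ + #fix₂ + #fix₃ + 1

    tail₃ : ∀ j → 2 * (3 + j) ≤ N →
            ∑ (antidiagonal j) (λ ma → G (3 + proj₁ ma , proj₂ ma)) * X ≤ (216 * #fix₃ + (2048 * (1 + #fix₂) + 1728)) * (N C (3 + j))
    tail₃ zero _ = begin
      (G (3 , 0) + 0) * X                 ≡⟨ cong (_* X) (+-identityʳ (G (3 , 0))) ⟩
      G (3 , 0) * X                       ≤⟨ term₃ 0 ⟩
      216 * #fix₃ * (N C 3)               ≤⟨ *-monoˡ-≤ (N C 3) (m≤m+n (216 * #fix₃) _) ⟩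
      (216 * #fix₃ + (2048 * (1 + #fix₂) + 1728)) * (N C 3) ∎
      where open ≤-Reasoning
    tail₃ (suc zero) _ = begin
      (G (3 , 1) + (G (4 , 0) + 0)) * X   ≡⟨ ≡-trans (cong (λ z → (G (3 , 1) + z) * X) (+-identityʳ (G (4 , 0)))) (*-distribʳ-+ X (G (3 , 1)) (G (4 , 0))) ⟩
      G (3 , 1) * X + G (4 , 0) * X       ≤⟨ +-mono-≤ (term₃ 1) (≤-trans (term₄ 0) (*-monoˡ-≤ (N C 4) (m≤m+n (2048 * (1 + #fix₂)) 1728))) ⟩
      216 * #fix₃ * (N C 4) + (2048 * (1 + #fix₂) + 1728) * (N C 4)  ≡⟨ *-distribʳ-+ (N C 4) (216 * #fix₃) _ ⟨
      (216 * #fix₃ + (2048 * (1 + #fix₂) + 1728)) * (N C 4) ∎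
      where open ≤-Reasoning
    tail₃ (suc (suc j)) 2k≤N = begin
      ∑ (antidiagonal (2 + j)) (λ ma → G (3 + proj₁ ma , proj₂ ma)) * X
        ≡⟨ cong (_* X) (≡-trans (∑-antidiagonal-suc (λ ma → G (3 + proj₁ ma , proj₂ ma)) (suc j)) (cong (G (3 , 2 + j) +_) (∑-antidiagonal-suc (λ ma → G (4 + proj₁ ma , proj₂ ma)) j))) ⟩
      (G (3 , 2 + j) + (G (4 , 1 + j) + Σ₅)) * X
        ≡⟨ expand (G (3 , 2 + j)) (G (4 , 1 + j)) Σ₅ X ⟩
      G (3 , 2 + j) * X + (G (4 , 1 + j) * X + Σ₅ * X)
        ≤⟨ +-mono-≤ (term₃ (2 + j)) (+-mono-≤ (term₄ (1 + j)) (tail₅ j 2k≤N)) ⟩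
      216 * #fix₃ * Bₖ + (2048 * (1 + #fix₂) * Bₖ + 1728 * Bₖ)
        ≡⟨ expand (216 * #fix₃) (2048 * (1 + #fix₂)) 1728 Bₖ ⟨
      (216 * #fix₃ + (2048 * (1 + #fix₂) + 1728)) * Bₖ ∎
      where
      open ≤-Reasoning
      Bₖ Σ₅ : ℕ
      Bₖ = N C (5 + j)
      Σ₅ = ∑ (antidiagonal j) (λ ma → G (5 + proj₁ ma , proj₂ ma))
      expand : ∀ a b c x → (a + (b + c)) * x ≡ a * x + (b * x + c * x)
      expand = solve-∀

    #invariant-bound : ∀ k → 3 ≤ k → 2 * k ≤ N → #invariant k * X ≤ 4000 * weight * (N C k)
    #invariant-bound (suc (suc (suc j))) (s≤s (s≤s (s≤s _))) 2k≤N = begin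
      #invariant (3 + j) * X ≤⟨ *-monoˡ-≤ X (#invariant-split (3 + j)) ⟩
      ∑ (antidiagonal (3 + j)) G * X
        ≡⟨ cong (_* X) (≡-trans (∑-antidiagonal-suc G (2 + j)) (cong (G (0 , 3 + j) +_)
              (≡-trans (∑-antidiagonal-suc (λ ma → G (1 + proj₁ ma , proj₂ ma)) (1 + j)) (cong (G (1 , 2 + j) +_) (∑-antidiagonal-suc (λ ma → G (2 + proj₁ ma , proj₂ ma)) j))))) ⟩
      (G (0 , 3 + j) + (G (1 , 2 + j) + (G (2 , 1 + j) + Σ₃))) * X
        ≡⟨ expand (G (0 , 3 + j)) (G (1 , 2 + j)) (G (2 , 1 + j)) Σ₃ X ⟩
      G (0 , 3 + j) * X + (G (1 , 2 + j) * X + (G (2 , 1 + j) * X + Σ₃ * X))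
        ≤⟨ +-mono-≤ (term₀ j) (+-mono-≤ (term₁ (2 + j)) (+-mono-≤ (term₂ j) (tail₃ j 2k≤N))) ⟩
      216 * (f * (f * f)) * Bₖ + (0 + (216 * (f * #fix₂) * Bₖ + (216 * #fix₃ + (2048 * (1 + #fix₂) + 1728)) * Bₖ))
        ≡⟨ collect 216 2048 1728 (f * (f * f)) (f * #fix₂) #fix₂ #fix₃ Bₖ ⟩
      (216 * (f * (f * f)) + 216 * (f * #fix₂) + (2048 * #fix₂) + 216 * #fix₃ + (2048 + 1728)) * Bₖ
        -- 4000 is a round bound for all coefficients; the largest of them is 2048 + 1728.
        ≤⟨ *-monoˡ-≤ Bₖ (+-mono-≤ (+-mono-≤ (+-mono-≤ (+-mono-≤
             (*-monoˡ-≤ (f * (f * f)) 216≤) (*-monoˡ-≤ (f * #fix₂) 216≤)) (*-monoˡ-≤ #fix₂ 2048≤)) (*-monoˡ-≤ #fix₃ 216≤)) 3776≤) ⟩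
      (4000 * (f * (f * f)) + 4000 * (f * #fix₂) + 4000 * #fix₂ + 4000 * #fix₃ + 4000) * Bₖ
        ≡⟨ cong (_* Bₖ) (factor 4000 (f * (f * f)) (f * #fix₂) #fix₂ #fix₃) ⟩
      4000 * weight * Bₖ ∎
      where
      open ≤-Reasoning
      Bₖ Σ₃ : ℕ
      Bₖ = N C (3 + j)
      Σ₃ = ∑ (antidiagonal j) (λ ma → G (3 + proj₁ ma , proj₂ ma))
      expand : ∀ a b c d x → (a + (b + (c + d))) * x ≡ a * x + (b * x + (c * x + d * x))
      expand = solve-∀
      collect : ∀ k l m a b c d x → k * a * x + (0 + (k * b * x + (k * d + (l * (1 + c) + m)) * x))
              ≡ (k * a + k * b + l * c + k * d + (l + m)) * x
      collect = solve-∀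
      factor : ∀ k a b c d → k * a + k * b + k * c + k * d + k ≡ k * (a + b + c + d + 1)
      factor = solve-∀
      216≤ : 216 ≤ 4000
      216≤ = ℕₚ.m≤m+n 216 3784
      2048≤ : 2048 ≤ 4000
      2048≤ = ℕₚ.m≤m+n 2048 1952
      3776≤ : 3776 ≤ 4000
      3776≤ = ℕₚ.m≤m+n 3776 224

-- The symmetric group

module _ {n : ℕ} where

  lookup-ext : {A : Set} {x y : Vec A n} → (∀ i → lookup x i ≡ lookup y i) → x ≡ y
  lookup-ext {x = x} {y} h = ≡-trans (sym (Vecₚ.tabulate∘lookup x)) (≡-trans (Vecₚ.tabulate-cong h) (Vecₚ.tabulate∘lookup y))

  lookup-· : (x y : Perm n) (i : Fin n) → lookup (x · y) i ≡ lookup x (lookup y i)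
  lookup-· x y = Vecₚ.lookup∘tabulate (λ i → lookup x (lookup y i))

  ε : Perm n
  ε = tabulate id

  lookup-ε : (i : Fin n) → lookup ε i ≡ i
  lookup-ε = Vecₚ.lookup∘tabulate id

  ·-assoc : (x y z : Perm n) → (x · y) · z ≡ x · (y · z)
  ·-assoc x y z = lookup-ext λ i → begin
    lookup ((x · y) · z) i              ≡⟨ lookup-· (x · y) z i ⟩
    lookup (x · y) (lookup z i)         ≡⟨ lookup-· x y (lookup z i) ⟩
    lookup x (lookup y (lookup z i))    ≡⟨ cong (lookup x) (lookup-· y z i) ⟨
    lookup x (lookup (y · z) i)         ≡⟨ lookup-· x (y · z) i ⟨
    lookup (x · (y · z)) i              ∎
    where open ≡-Reasoning

  ·-identityˡ : (x : Perm n) → ε · x ≡ x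
  ·-identityˡ x = lookup-ext λ i → ≡-trans (lookup-· ε x i) (lookup-ε (lookup x i))

  ·-identityʳ : (x : Perm n) → x · ε ≡ x
  ·-identityʳ x = lookup-ext λ i → ≡-trans (lookup-· x ε i) (cong (lookup x) (lookup-ε i))

∈-toList : ∀ {A : Set} {n} (v : Vec A n) (i : Fin n) → lookup v i ∈ toList v
∈-toList (x ∷ v) zero    = here refl
∈-toList (x ∷ v) (suc i) = there (∈-toList v i)

toList-∈ : ∀ {A : Set} {n} (v : Vec A n) {y} → y ∈ toList v → ∃ λ i → lookup v i ≡ y
toList-∈ (x ∷ v) (here refl) = zero , refl
toList-∈ (x ∷ v) (there y∈)  = let (i , eq) = toList-∈ v y∈ in suc i , eq

Unique⇒injective : ∀ {A : Set} {n} (v : Vec A n) → Unique (toList v) → ∀ {i j} → lookup v i ≡ lookup v j → i ≡ j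
Unique⇒injective (x ∷ v) (x# ∷ u) {zero}  {zero}  eq = refl
Unique⇒injective (x ∷ v) (x# ∷ u) {zero}  {suc j} eq = contradiction eq (All.lookup x# (∈-toList v j))
Unique⇒injective (x ∷ v) (x# ∷ u) {suc i} {zero}  eq = contradiction (sym eq) (All.lookup x# (∈-toList v i))
Unique⇒injective (x ∷ v) (x# ∷ u) {suc i} {suc j} eq = cong suc (Unique⇒injective v u eq)

injective⇒Unique : ∀ {A : Set} {n} (v : Vec A n) → (∀ {i j} → lookup v i ≡ lookup v j → i ≡ j) → Unique (toList v)
injective⇒Unique []      inj = []
injective⇒Unique (x ∷ v) inj =
  All.tabulate (λ y∈ eq → let (i , eq′) = toList-∈ v y∈ in Finₚ.0≢1+n (inj {zero} {suc i} (≡-trans eq (sym eq′)))) ∷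
  injective⇒Unique v (Finₚ.suc-injective ∘ inj)

∈-allVecs : ∀ m {n} (v : Vec (Fin m) n) → v ∈ allVecs m n
∈-allVecs m [] = here refl
∈-allVecs m {suc n} (i ∷ v) = ∈ₚ.∈-concatMap⁺ (λ i → map (i ∷_) (allVecs m n)) {xs = allFin m}
  (lose (∈ₚ.∈-allFin i) (∈ₚ.∈-map⁺ (i ∷_) (∈-allVecs m v)))

Unique-concatMap : {A B : Set} (f : A → List B) {xs : List A} → Unique xs → (∀ x → Unique (f x)) →
  (∀ {x y b} → b ∈ f x → b ∈ f y → x ≡ y) → Unique (concatMap f xs)
Unique-concatMap f [] uf dis = []
Unique-concatMap f {x ∷ xs} (x# ∷ u) uf dis = Uniqueₚ.++⁺ (uf x) (Unique-concatMap f u uf dis) disjoint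
  where
  disjoint : ∀ {b} → b ∈ f x × b ∈ concatMap f xs → ⊥
  disjoint (i , j) with find (∈ₚ.∈-concatMap⁻ f {xs = xs} j)
  ... | y , y∈ , b∈ = All.lookup x# y∈ (dis i b∈)

Unique-allVecs : ∀ m n → Unique (allVecs m n)
Unique-allVecs m zero = [] ∷ []
Unique-allVecs m (suc n) = Unique-concatMap _ (Uniqueₚ.allFin⁺ m)
  (λ i → Uniqueₚ.map⁺ Vecₚ.∷-injectiveʳ (Unique-allVecs m n)) same-head
  where
  same-head : ∀ {i j v} → v ∈ map (i ∷_) (allVecs m n) → v ∈ map (j ∷_) (allVecs m n) → i ≡ j
  same-head i∈ j∈ with ∈ₚ.∈-map⁻ _ i∈ | ∈ₚ.∈-map⁻ _ j∈
  ... | _ , _ , refl | _ , _ , eq = Vecₚ.∷-injectiveˡ eq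

∑-allVecs : ∀ m n (F : Vec (Fin m) (suc n) → ℕ) →
  ∑ (allVecs m (suc n)) F ≡ ∑ (allFin m) (λ i → ∑ (allVecs m n) (λ v → F (i ∷ v)))
∑-allVecs m n F = ≡-trans (∑-concatMap F (λ i → map (i ∷_) (allVecs m n)) (allFin m))
  (∑-cong (allFin m) (λ {i} _ → ∑-map F (i ∷_) (allVecs m n)))

Unique-Sym : ∀ n → Unique (Sym n)
Unique-Sym n = Uniqueₚ.filter⁺ isPerm? (Unique-allVecs n n)

∈-Sym⁺ : ∀ {n} {x : Perm n} → (∀ {i j} → lookup x i ≡ lookup x j → i ≡ j) → x ∈ Sym n
∈-Sym⁺ {n} {x} inj = ∈ₚ.∈-filter⁺ isPerm? (∈-allVecs n x) (injective⇒Unique x inj)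

∈-Sym-Unique : ∀ {n} {x : Perm n} → x ∈ Sym n → Unique (toList x)
∈-Sym-Unique {n} x∈ = proj₂ (∈ₚ.∈-filter⁻ isPerm? {xs = allVecs n n} x∈)

∈-Sym⁻ : ∀ {n} {x : Perm n} → x ∈ Sym n → ∀ {i j} → lookup x i ≡ lookup x j → i ≡ j
∈-Sym⁻ {n} {x} x∈ = Unique⇒injective x (∈-Sym-Unique x∈)

length-allFin : ∀ n → length (allFin n) ≡ n
length-allFin n = Listₚ.length-tabulate id

Sym-surjective : ∀ {n} {x : Perm n} → x ∈ Sym n → ∀ j → ∃ λ i → lookup x i ≡ j
Sym-surjective {n} {x} x∈ j = toList-∈ x (Cover.cover _≟F_ (∈-Sym-Unique x∈) (λ _ → ∈ₚ.∈-allFin _)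
  (≤-reflexive (≡-trans (length-allFin n) (sym (≡-trans (Vecₚ.length-toList x) (length-vec x))))) (∈ₚ.∈-allFin j))
  where
  length-vec : ∀ {A : Set} {n} (v : Vec A n) → Data.Vec.length v ≡ n
  length-vec []      = refl
  length-vec (_ ∷ v) = cong suc (length-vec v)

module _ {n : ℕ} where

  -- A search keeps the inverse defined on every vector; the fallback j is returned only if j is not
  -- a value of x, which does not happen for members of `Sym n`.
  preimage : Perm n → Fin n → Fin n
  preimage x j with Finₚ.any? (λ i → lookup x i ≟F j)
  ... | yes (i , _) = i
  ... | no _        = j

  lookup-preimage : ∀ {x} → x ∈ Sym n → ∀ j → lookup x (preimage x j) ≡ j
  lookup-preimage {x} x∈ j with Finₚ.any? (λ i → lookup x i ≟F j)
  ... | yes (_ , eq) = eq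
  ... | no ¬a        = contradiction (Sym-surjective x∈ j) ¬a

  _⁻¹ : Perm n → Perm n
  x ⁻¹ = tabulate (preimage x)

  module _ {x : Perm n} (x∈ : x ∈ Sym n) where

    lookup-inverseʳ : ∀ j → lookup x (lookup (x ⁻¹) j) ≡ j
    lookup-inverseʳ j = ≡-trans (cong (lookup x) (Vecₚ.lookup∘tabulate (preimage x) j)) (lookup-preimage x∈ j)

    lookup-inverseˡ : ∀ j → lookup (x ⁻¹) (lookup x j) ≡ j
    lookup-inverseˡ j = ∈-Sym⁻ x∈ (lookup-inverseʳ (lookup x j))

    ·-inverseʳ : x · (x ⁻¹) ≡ ε
    ·-inverseʳ = lookup-ext λ i → ≡-trans (lookup-· x (x ⁻¹) i) (≡-trans (lookup-inverseʳ i) (sym (lookup-ε i)))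

    ·-inverseˡ : (x ⁻¹) · x ≡ ε
    ·-inverseˡ = lookup-ext λ i → ≡-trans (lookup-· (x ⁻¹) x i) (≡-trans (lookup-inverseˡ i) (sym (lookup-ε i)))

    inverse-∈ : x ⁻¹ ∈ Sym n
    inverse-∈ = ∈-Sym⁺ λ {i} {j} eq → ≡-trans (sym (lookup-inverseʳ i)) (≡-trans (cong (lookup x) eq) (lookup-inverseʳ j))

    inverse-cancelˡ : ∀ y → (x ⁻¹) · (x · y) ≡ y
    inverse-cancelˡ y = ≡-trans (sym (·-assoc (x ⁻¹) x y)) (≡-trans (cong (_· y) ·-inverseˡ) (·-identityˡ y))

    inverse-cancelˡ′ : ∀ y → x · ((x ⁻¹) · y) ≡ y
    inverse-cancelˡ′ y = ≡-trans (sym (·-assoc x (x ⁻¹) y)) (≡-trans (cong (_· y) ·-inverseʳ) (·-identityˡ y))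

    inverse-cancelʳ : ∀ y → (y · x) · (x ⁻¹) ≡ y
    inverse-cancelʳ y = ≡-trans (·-assoc y x (x ⁻¹)) (≡-trans (cong (y ·_) ·-inverseʳ) (·-identityʳ y))

    inverse-cancelʳ′ : ∀ y → (y · (x ⁻¹)) · x ≡ y
    inverse-cancelʳ′ y = ≡-trans (·-assoc y (x ⁻¹) x) (≡-trans (cong (y ·_) ·-inverseˡ) (·-identityʳ y))

    ·-cancelˡ : ∀ {y z} → x · y ≡ x · z → y ≡ z
    ·-cancelˡ {y} {z} eq = ≡-trans (sym (inverse-cancelˡ y)) (≡-trans (cong ((x ⁻¹) ·_) eq) (inverse-cancelˡ z))

    ·-cancelʳ : ∀ {y z} → y · x ≡ z · x → y ≡ z
    ·-cancelʳ {y} {z} eq = ≡-trans (sym (inverse-cancelʳ y)) (≡-trans (cong (_· (x ⁻¹)) eq) (inverse-cancelʳ z))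

  ε-∈ : ε ∈ Sym n
  ε-∈ = ∈-Sym⁺ λ {i} {j} eq → ≡-trans (sym (lookup-ε i)) (≡-trans eq (lookup-ε j))

  ·-∈ : ∀ {x y} → x ∈ Sym n → y ∈ Sym n → x · y ∈ Sym n
  ·-∈ {x} {y} x∈ y∈ = ∈-Sym⁺ λ {i} {j} eq → ∈-Sym⁻ y∈ (∈-Sym⁻ x∈
    (≡-trans (sym (lookup-· x y i)) (≡-trans eq (lookup-· x y j))))

  ∑-Sym-·ˡ : (F : Perm n → ℕ) → ∀ {a} → a ∈ Sym n → ∑ (Sym n) (λ g → F (a · g)) ≡ ∑ (Sym n) F
  ∑-Sym-·ˡ F {a} a∈ = ℕₚ.≤-antisym (translate F a∈) (≤-trans
    (≤-reflexive (∑-cong (Sym n) (λ {g} _ → cong F (sym (inverse-cancelˡ′ a∈ g)))))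
    (translate (λ g → F (a · g)) (inverse-∈ a∈)))
    where
    translate : (F : Perm n → ℕ) → ∀ {a} → a ∈ Sym n → ∑ (Sym n) (λ g → F (a · g)) ≤ ∑ (Sym n) F
    translate F a∈ = ∑-reindex-≤ _≟P_ (Unique-Sym n) _ F (·-∈ a∈) (λ _ _ → ·-cancelˡ a∈)

  ∑-Sym-·ʳ : (F : Perm n → ℕ) → ∀ {a} → a ∈ Sym n → ∑ (Sym n) (λ g → F (g · a)) ≡ ∑ (Sym n) F
  ∑-Sym-·ʳ F {a} a∈ = ℕₚ.≤-antisym (translate F a∈) (≤-trans
    (≤-reflexive (∑-cong (Sym n) (λ {g} _ → cong F (sym (inverse-cancelʳ′ a∈ g)))))
    (translate (λ g → F (g · a)) (inverse-∈ a∈)))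
    where
    translate : (F : Perm n → ℕ) → ∀ {a} → a ∈ Sym n → ∑ (Sym n) (λ g → F (g · a)) ≤ ∑ (Sym n) F
    translate F a∈ = ∑-reindex-≤ _≟P_ (Unique-Sym n) _ F (λ g∈ → ·-∈ g∈ a∈) (λ _ _ → ·-cancelʳ a∈)

module _ (m : ℕ) where
  open import Data.List.Membership.DecPropositional (_≟F_ {m}) using (_∈?_)
  open import Data.List.Relation.Unary.Unique.DecPropositional (_≟F_ {m}) using (unique?)

  Fresh : List (Fin m) → List (Fin m) → Set
  Fresh U l = Unique l × All (_∉ U) l

  fresh? : ∀ U l → Dec (Fresh U l)
  fresh? U l = unique? l ×-dec All.all? (¬? ∘ (_∈? U)) l

  𝟙-fresh-∷ : ∀ U i l → 𝟙 (fresh? U (i ∷ l)) ≡ 𝟙 (¬? (i ∈? U)) * 𝟙 (fresh? (i ∷ U) l)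
  𝟙-fresh-∷ U i l = 𝟙-product (fresh? U (i ∷ l)) (¬? (i ∈? U)) (fresh? (i ∷ U) l)
    (λ { (i# ∷ ul , i∉ ∷ l∉) → i∉ , ul , All.tabulate (λ { j∈ (here refl) → All.lookup i# j∈ refl ; j∈ (there q) → All.lookup l∉ j∈ q }) })
    (λ { i∉ (ul , l∉) → All.tabulate (λ j∈ eq → All.lookup l∉ j∈ (here (sym eq))) ∷ ul , i∉ ∷ All.map (λ q → q ∘ there) l∉ })

  count-fresh : ∀ k U → Unique U → length U + k ≡ m → ∑ (allVecs m k) (λ v → 𝟙 (fresh? U (toList v))) ≡ k !
  count-fresh zero U uU _ = refl
  count-fresh (suc k) U uU eq = begin
    ∑ (allVecs m (suc k)) (λ v → 𝟙 (fresh? U (toList v)))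
      ≡⟨ ∑-allVecs m k _ ⟩
    ∑ (allFin m) (λ i → ∑ (allVecs m k) (λ v → 𝟙 (fresh? U (i ∷ toList v))))
      ≡⟨ ∑-cong (allFin m) (λ {i} _ → ≡-trans (∑-cong (allVecs m k) (λ {v} _ → 𝟙-fresh-∷ U i (toList v)))
           (∑-*ˡ (𝟙 (¬? (i ∈? U))) (λ v → 𝟙 (fresh? (i ∷ U) (toList v))) (allVecs m k))) ⟩
    ∑ (allFin m) (λ i → 𝟙 (¬? (i ∈? U)) * ∑ (allVecs m k) (λ v → 𝟙 (fresh? (i ∷ U) (toList v))))
      ≡⟨ ∑-cong (allFin m) (λ {i} _ → step i) ⟩
    ∑ (allFin m) (λ i → 𝟙 (¬? (i ∈? U)) * k !)
      ≡⟨ ∑-*ʳ (λ i → 𝟙 (¬? (i ∈? U))) (k !) (allFin m) ⟩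
    ∑ (allFin m) (λ i → 𝟙 (¬? (i ∈? U))) * k !
      ≡⟨ cong (_* k !) (≡-trans (sym (length-filter (¬? ∘ (_∈? U)) (allFin m))) size) ⟩
    suc k * k ! ∎
    where
    open ≡-Reasoning
    step : ∀ i → 𝟙 (¬? (i ∈? U)) * ∑ (allVecs m k) (λ v → 𝟙 (fresh? (i ∷ U) (toList v))) ≡ 𝟙 (¬? (i ∈? U)) * k !
    step i = stepDec (i ∈? U)
      where
      stepDec : (d : Dec (i ∈ U)) → 𝟙 (¬? d) * ∑ (allVecs m k) (λ v → 𝟙 (fresh? (i ∷ U) (toList v))) ≡ 𝟙 (¬? d) * k !
      stepDec (yes _) = refl
      stepDec (no i∉) = cong (_+ 0) (count-fresh k (i ∷ U) (Cover.∉⇒#-All _≟F_ i∉ ∷ uU) (≡-trans (sym (ℕₚ.+-suc (length U) k)) eq))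
    size : length (filter (¬? ∘ (_∈? U)) (allFin m)) ≡ suc k
    size = ℕₚ.+-cancelˡ-≡ (length U) _ _ (≡-trans
      (filter-∉-length _≟F_ (Uniqueₚ.allFin⁺ m) uU (λ _ → ∈ₚ.∈-allFin _))
      (≡-trans (length-allFin m) (sym eq)))

length-Sym : ∀ n → length (Sym n) ≡ n !
length-Sym n = ≡-trans (length-filter isPerm? (allVecs n n)) (≡-trans
  (∑-cong (allVecs n n) (λ {v} _ → 𝟙-cong (isPerm? v) (fresh? n [] (toList v)) (λ u → u , All.tabulate (λ _ ())) proj₁))
  (count-fresh n n [] [] refl))

-- Orbit counting

module Classes {A : Set} (R : A → A → Set) (R? : ∀ x y → Dec (R x y)) where

  count : List A → List A → ℕ
  count seen [] = 0
  count seen (x ∷ xs) with Any.any? (λ y → R? y x) seen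
  ... | yes _ = count seen xs
  ... | no _  = suc (count (x ∷ seen) xs)

  -- The left-hand side of go-count is the local function of countClasses, which cannot be
  -- named here; it is inferred from the call in countClasses-count.
  mutual
    countClasses-count : ∀ xs → countClasses R R? xs ≡ count [] xs
    countClasses-count []       = refl
    countClasses-count (x ∷ xs) with List._∷_ x List.[]
    ... | seen = cong suc (go-count seen xs)

    go-count : ∀ seen xs → _ ≡ count seen xs
    go-count seen []       = refl
    go-count seen (x ∷ xs) with Any.any? (λ y → R? y x) seen
    ... | yes _ = go-count seen xs
    ... | no _  = cong suc (go-count (x ∷ seen) xs)

  reps : List A → List A → List A
  reps seen [] = seen
  reps seen (x ∷ xs) with Any.any? (λ y → R? y x) seen
  ... | yes _ = reps seen xs
  ... | no _  = reps (x ∷ seen) xs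

  length-reps : ∀ seen xs → length (reps seen xs) ≡ count seen xs + length seen
  length-reps seen [] = refl
  length-reps seen (x ∷ xs) with Any.any? (λ y → R? y x) seen
  ... | yes _ = length-reps seen xs
  ... | no _  = ≡-trans (length-reps (x ∷ seen) xs) (ℕₚ.+-suc (count (x ∷ seen) xs) (length seen))

  module _ {X : List A}
           (R-refl : ∀ {x} → x ∈ X → R x x)
           (R-sym : ∀ {x y} → R x y → R y x)
           (R-trans : ∀ {x y z} → R x y → R y z → R x z)
           (c : A → A → ℕ) (W : A → ℕ)
           (c-yes : ∀ {x y} → R x y → c x y ≡ W y)
           (c-no : ∀ {x y} → ¬ R x y → c x y ≡ 0) where

    -- A condition on columns: the entries of `seen` related to x contribute `W x` in total, as a
    -- single one of them would. This is the form in which pairwise inequivalence of the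
    -- representatives is used.
    Good : List A → Set
    Good seen = (∀ {y} → y ∈ seen → y ∈ X) × (∀ {x} → Any (λ y → R y x) seen → ∑ seen (λ y → c y x) ≡ W x)

    unrelated : ∀ {seen x} → ¬ Any (λ y → R y x) seen → ∑ seen (λ y → c y x) ≡ 0
    unrelated {seen} ¬a = ∑-0 seen (λ y∈ → c-no (λ r → ¬a (lose y∈ r)))

    good-∷ : ∀ {seen x} → x ∈ X → ¬ Any (λ y → R y x) seen → Good seen → Good (x ∷ seen)
    good-∷ {seen} {x} x∈ ¬a (⊆X , total) = (λ { (here refl) → x∈ ; (there i) → ⊆X i }) , total′
      where
      total′ : ∀ {z} → Any (λ y → R y z) (x ∷ seen) → ∑ (x ∷ seen) (λ y → c y z) ≡ W z
      total′ {z} (here r) = ≡-trans (cong₂ _+_ (c-yes r) (unrelated (λ a → ¬a (Any.map (λ q → R-trans q (R-sym r)) a)))) (+-identityʳ _)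
      total′ {z} (there a) = cong₂ _+_ (c-no (λ r → ¬a (Any.map (λ q → R-trans q (R-sym r)) a))) (total a)

    reps-good : ∀ seen xs → (∀ {x} → x ∈ xs → x ∈ X) → Good seen → Good (reps seen xs)
    reps-good seen [] _ g = g
    reps-good seen (x ∷ xs) ⊆X g with Any.any? (λ y → R? y x) seen
    ... | yes _ = reps-good seen xs (⊆X ∘ there) g
    ... | no ¬a = reps-good (x ∷ seen) xs (⊆X ∘ there) (good-∷ (⊆X (here refl)) ¬a g)

    reps-keep : ∀ seen xs {x} → Any (λ y → R y x) seen → Any (λ y → R y x) (reps seen xs)
    reps-keep seen [] a = a
    reps-keep seen (x ∷ xs) a with Any.any? (λ y → R? y x) seen
    ... | yes _ = reps-keep seen xs a
    ... | no _  = reps-keep (x ∷ seen) xs (there a)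

    reps-cover : ∀ seen xs → (∀ {x} → x ∈ xs → x ∈ X) → ∀ {x} → x ∈ xs → Any (λ y → R y x) (reps seen xs)
    reps-cover seen (x ∷ xs) ⊆X z∈ with Any.any? (λ y → R? y x) seen | z∈
    ... | yes a | here refl = reps-keep seen xs a
    ... | yes _ | there i   = reps-cover seen xs (⊆X ∘ there) i
    ... | no _  | here refl = reps-keep (x ∷ seen) xs (here (R-refl (⊆X (here refl))))
    ... | no _  | there i   = reps-cover (x ∷ seen) xs (⊆X ∘ there) i

    -- Double counting of c over representatives and elements: a row adds up to M, and the column of
    -- x to `W x`, since exactly one representative is equivalent to x. With c the number of group
    -- elements moving one set to another, this is Burnside's lemma without passing through orbit
    -- sizes.
    countClasses-* : ∀ M → (∀ {r} → r ∈ X → ∑ X (c r) ≡ M) → countClasses R R? X * M ≡ ∑ X W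
    countClasses-* M row = begin
      countClasses R R? X * M                      ≡⟨ cong (_* M) (countClasses-count X) ⟩
      count [] X * M                               ≡⟨ cong (_* M) (≡-trans (length-reps [] X) (+-identityʳ _)) ⟨
      length (reps [] X) * M                       ≡⟨ ∑-const M (reps [] X) ⟨
      ∑ (reps [] X) (λ _ → M)                      ≡⟨ ∑-cong (reps [] X) (λ r∈ → sym (row (proj₁ good r∈))) ⟩
      ∑ (reps [] X) (λ r → ∑ X (c r))              ≡⟨ ∑-swap c (reps [] X) X ⟩
      ∑ X (λ x → ∑ (reps [] X) (λ r → c r x))      ≡⟨ ∑-cong X (λ x∈ → proj₂ good (reps-cover [] X id x∈)) ⟩
      ∑ X W                                        ∎
      where
      open ≡-Reasoning
      good : Good (reps [] X)
      good = reps-good [] X id ((λ ()) , λ ())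

module Burnside (n : ℕ) where

  open import Data.List.Membership.DecPropositional (_≟P_ {n}) using (_∈?_)

  SameSet-sym : {S S′ : List (Perm n)} → SameSet S S′ → SameSet S′ S
  SameSet-sym (p , q) = q , p

  SameSet-trans : {S S′ S″ : List (Perm n)} → SameSet S S′ → SameSet S′ S″ → SameSet S S″
  SameSet-trans (p , q) (p′ , q′) = All.map (All.lookup p′) p , All.map (All.lookup q) q′

  SameSet-act : ∀ g h {S S′ : List (Perm n)} → SameSet S S′ → SameSet (act g h S) (act g h S′)
  SameSet-act g h (p , q) = half p , half q
    where
    half : {S S′ : List (Perm n)} → All (_∈ S′) S → All (_∈ act g h S′) (act g h S)
    half p = All.tabulate λ y∈ → let (x , x∈ , eq) = ∈ₚ.∈-map⁻ _ y∈ in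
      subst (_∈ _) (sym eq) (∈ₚ.∈-map⁺ _ (All.lookup p x∈))

  two-sided-∘ : ∀ g h g′ h′ (x : Perm n) → (g · ((g′ · x) · h′)) · h ≡ ((g · g′) · x) · (h′ · h)
  two-sided-∘ g h g′ h′ x = begin
    (g · ((g′ · x) · h′)) · h     ≡⟨ cong (_· h) (·-assoc g (g′ · x) h′) ⟨
    ((g · (g′ · x)) · h′) · h     ≡⟨ ·-assoc (g · (g′ · x)) h′ h ⟩
    (g · (g′ · x)) · (h′ · h)     ≡⟨ cong (_· (h′ · h)) (·-assoc g g′ x) ⟨
    ((g · g′) · x) · (h′ · h)     ∎
    where open ≡-Reasoning

  act-act : ∀ g h g′ h′ (S : List (Perm n)) → act g h (act g′ h′ S) ≡ act (g · g′) (h′ · h) S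
  act-act g h g′ h′ S = ≡-trans (sym (Listₚ.map-∘ S)) (Listₚ.map-cong (two-sided-∘ g h g′ h′) S)

  act-ε : (S : List (Perm n)) → act ε ε S ≡ S
  act-ε S = ≡-trans (Listₚ.map-cong (λ x → ≡-trans (·-identityʳ (ε · x)) (·-identityˡ x)) S) (Listₚ.map-id S)

  SameSet-refl : (S : List (Perm n)) → SameSet S S
  SameSet-refl S = All.tabulate id , All.tabulate id

  Moves : List (Perm n) → List (Perm n) → Set
  Moves S S′ = ∃ λ g → ∃ λ h → g ∈ Sym n × h ∈ Sym n × SameSet (act g h S) S′

  SameOrbit⇒Moves : ∀ {S S′} → SameOrbit n S S′ → Moves S S′
  SameOrbit⇒Moves o = let (g , g∈ , o′) = find o ; (h , h∈ , s) = find o′ in g , h , g∈ , h∈ , s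

  Moves⇒SameOrbit : ∀ {S S′} → Moves S S′ → SameOrbit n S S′
  Moves⇒SameOrbit (g , h , g∈ , h∈ , s) = lose g∈ (lose h∈ s)

  orbit-refl : ∀ S → SameOrbit n S S
  orbit-refl S = Moves⇒SameOrbit (ε , ε , ε-∈ , ε-∈ , subst (λ S′ → SameSet S′ S) (sym (act-ε S)) (SameSet-refl S))

  orbit-sym : ∀ {S S′} → SameOrbit n S S′ → SameOrbit n S′ S
  orbit-sym {S} {S′} o with SameOrbit⇒Moves o
  ... | g , h , g∈ , h∈ , s = Moves⇒SameOrbit (g ⁻¹ , h ⁻¹ , inverse-∈ g∈ , inverse-∈ h∈ ,
    SameSet-trans (SameSet-act (g ⁻¹) (h ⁻¹) (SameSet-sym s)) (subst (λ S″ → SameSet S″ S) (sym undo) (SameSet-refl S)))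
    where
    undo : act (g ⁻¹) (h ⁻¹) (act g h S) ≡ S
    undo = ≡-trans (act-act (g ⁻¹) (h ⁻¹) g h S)
      (≡-trans (cong₂ (λ a b → act a b S) (·-inverseˡ g∈) (·-inverseʳ h∈)) (act-ε S))

  orbit-trans : ∀ {S S′ S″} → SameOrbit n S S′ → SameOrbit n S′ S″ → SameOrbit n S S″
  orbit-trans {S} {S′} {S″} o o′ with SameOrbit⇒Moves o | SameOrbit⇒Moves o′
  ... | g , h , g∈ , h∈ , s | g′ , h′ , g′∈ , h′∈ , s′ = Moves⇒SameOrbit (g′ · g , h · h′ , ·-∈ g′∈ g∈ , ·-∈ h∈ h′∈ ,
    subst (λ S‴ → SameSet S‴ S″) (act-act g′ h′ g h S) (SameSet-trans (SameSet-act g′ h′ s) s′))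

  #moves : List (Perm n) → List (Perm n) → ℕ
  #moves S S′ = ∑ (Sym n) (λ g → ∑ (Sym n) (λ h → 𝟙 (sameSet? (act g h S) S′)))

  -- The pairs moving S to S′ form a coset of the stabilizer of S′; translation by one of them, (a ,
  -- b), leaves the double sum unchanged.
  #moves-yes : ∀ {S S′} → SameOrbit n S S′ → #moves S S′ ≡ #moves S′ S′
  #moves-yes {S} {S′} o with SameOrbit⇒Moves o
  ... | a , b , a∈ , b∈ , s = sym (begin
    ∑ (Sym n) (λ g → ∑ (Sym n) (λ h → 𝟙 (sameSet? (act g h S′) S′)))
      ≡⟨ ∑-cong (Sym n) (λ {g} _ → ∑-cong (Sym n) (λ {h} _ → shift g h)) ⟩
    ∑ (Sym n) (λ g → ∑ (Sym n) (λ h → 𝟙 (sameSet? (act (g · a) (b · h) S) S′)))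
      ≡⟨ ∑-cong (Sym n) (λ {g} _ → ∑-Sym-·ˡ (λ h → 𝟙 (sameSet? (act (g · a) h S) S′)) b∈) ⟩
    ∑ (Sym n) (λ g → ∑ (Sym n) (λ h → 𝟙 (sameSet? (act (g · a) h S) S′)))
      ≡⟨ ∑-Sym-·ʳ (λ g → ∑ (Sym n) (λ h → 𝟙 (sameSet? (act g h S) S′))) a∈ ⟩
    #moves S S′ ∎)
    where
    open ≡-Reasoning
    shift : ∀ g h → 𝟙 (sameSet? (act g h S′) S′) ≡ 𝟙 (sameSet? (act (g · a) (b · h) S) S′)
    shift g h = 𝟙-cong (sameSet? (act g h S′) S′) (sameSet? (act (g · a) (b · h) S) S′)
      (λ q → subst (λ S″ → SameSet S″ S′) (act-act g h a b S) (SameSet-trans (SameSet-act g h s) q))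
      (λ q → SameSet-trans (SameSet-act g h (SameSet-sym s)) (subst (λ S″ → SameSet S″ S′) (sym (act-act g h a b S)) q))

  #moves-no : ∀ {S S′} → ¬ SameOrbit n S S′ → #moves S S′ ≡ 0
  #moves-no {S} {S′} ¬o = ∑-0 (Sym n) (λ {g} g∈ → ∑-0 (Sym n) (λ {h} h∈ →
    𝟙-no (sameSet? (act g h S) S′) (λ s → ¬o (Moves⇒SameOrbit (g , h , g∈ , h∈ , s)))))

  two-sided-injective : ∀ {g h} → g ∈ Sym n → h ∈ Sym n → {x y : Perm n} → (g · x) · h ≡ (g · y) · h → x ≡ y
  two-sided-injective g∈ h∈ eq = ·-cancelˡ g∈ (·-cancelʳ h∈ eq)

  module _ (k : ℕ) where

    X : List (List (Perm n))
    X = choose k (Sym n)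

    unique-image : ∀ {g h S} → g ∈ Sym n → h ∈ Sym n → S ∈ X → ∑ X (λ S′ → 𝟙 (sameSet? (act g h S) S′)) ≡ 1
    unique-image {g} {h} {S} g∈ h∈ S∈ = ℕₚ.≤-antisym
      (∑-atMostOne (sameSet? (act g h S)) (Unique-choose (Unique-Sym n) k)
        (λ i j p q → Cover.choose-ext _≟P_ k (Unique-Sym n) i j
           (All.lookup (proj₁ (SameSet-trans (SameSet-sym p) q))) (All.lookup (proj₁ (SameSet-trans (SameSet-sym q) p)))))
      (≤-trans (≤-reflexive (sym (𝟙-yes (sameSet? (act g h S) S′) same))) (∑-∈ {f = λ S′ → 𝟙 (sameSet? (act g h S) S′)} S′∈))
      where
      S′ : List (Perm n)
      S′ = filter (_∈? act g h S) (Sym n)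
      uact : Unique (act g h S)
      uact = Uniqueₚ.map⁺ (two-sided-injective g∈ h∈) (choose-Unique k (Unique-Sym n) S∈)
      act⊆ : ∀ {y} → y ∈ act g h S → y ∈ Sym n
      act⊆ y∈ = let (x , x∈ , eq) = ∈ₚ.∈-map⁻ _ y∈ in
        subst (_∈ Sym n) (sym eq) (·-∈ (·-∈ g∈ (choose-⊆ k (Sym n) S∈ x∈)) h∈)
      S′∈ : S′ ∈ X
      S′∈ = subst (λ m → S′ ∈ choose m (Sym n))
        (≡-trans (filter-∈-length _≟P_ (Unique-Sym n) uact act⊆) (≡-trans (Listₚ.length-map _ S) (choose-length k (Sym n) S∈)))
        (filter-∈-choose (_∈? act g h S) (Sym n))
      same : SameSet (act g h S) S′
      same = All.tabulate (λ y∈ → ∈ₚ.∈-filter⁺ (_∈? act g h S) (act⊆ y∈) y∈) ,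
             All.tabulate (λ y∈ → proj₂ (∈ₚ.∈-filter⁻ (_∈? act g h S) {xs = Sym n} y∈))

    #moves-row : ∀ {S} → S ∈ X → ∑ X (#moves S) ≡ n ! * n !
    #moves-row {S} S∈ = begin
      ∑ X (λ S′ → ∑ (Sym n) (λ g → ∑ (Sym n) (λ h → 𝟙 (sameSet? (act g h S) S′))))
        ≡⟨ ∑-swap _ X (Sym n) ⟩
      ∑ (Sym n) (λ g → ∑ X (λ S′ → ∑ (Sym n) (λ h → 𝟙 (sameSet? (act g h S) S′))))
        ≡⟨ ∑-cong (Sym n) (λ {g} g∈ → ≡-trans (∑-swap (λ S′ h → 𝟙 (sameSet? (act g h S) S′)) X (Sym n))
             (≡-trans (∑-cong (Sym n) (λ h∈ → unique-image g∈ h∈ S∈)) (≡-trans (∑-1 (Sym n)) (length-Sym n)))) ⟩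
      ∑ (Sym n) (λ _ → n !)   ≡⟨ ∑-const (n !) (Sym n) ⟩
      length (Sym n) * n !    ≡⟨ cong (_* n !) (length-Sym n) ⟩
      n ! * n !               ∎
      where open ≡-Reasoning

    #fixed : Perm n → Perm n → ℕ
    #fixed g h = ∑ X (λ S → 𝟙 (sameSet? (act g h S) S))

    burnside : T n k * (n ! * n !) ≡ ∑ (Sym n) (λ g → ∑ (Sym n) (λ h → #fixed g h))
    burnside = begin
      T n k * (n ! * n !)
        ≡⟨ Classes.countClasses-* (SameOrbit n) (sameOrbit? n) {X} (λ {S} _ → orbit-refl S) orbit-sym orbit-trans
             #moves (λ S → #moves S S) #moves-yes #moves-no (n ! * n !) #moves-row ⟩
      ∑ X (λ S → ∑ (Sym n) (λ g → ∑ (Sym n) (λ h → 𝟙 (sameSet? (act g h S) S))))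
        ≡⟨ ∑-swap _ X (Sym n) ⟩
      ∑ (Sym n) (λ g → ∑ X (λ S → ∑ (Sym n) (λ h → 𝟙 (sameSet? (act g h S) S))))
        ≡⟨ ∑-cong (Sym n) (λ {g} _ → ∑-swap (λ S h → 𝟙 (sameSet? (act g h S) S)) X (Sym n)) ⟩
      ∑ (Sym n) (λ g → ∑ (Sym n) (λ h → #fixed g h)) ∎
      where open ≡-Reasoning

-- Centralizers

module Arrangements {A : Set} (_≟_ : DecidableEquality A) where
  open import Data.List.Membership.DecPropositional _≟_ using (_∈?_)

  remove : A → List A → List A
  remove x = filter (¬? ∘ (_∈? (x ∷ [])))

  arrangements : ℕ → List A → List (List A)
  arrangements zero    xs = [] ∷ []
  arrangements (suc m) xs = concatMap (λ x → map (x ∷_) (arrangements m (remove x xs))) xs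

  ∈-arrangements : ∀ {l xs} → Unique l → (∀ {x} → x ∈ l → x ∈ xs) → l ∈ arrangements (length l) xs
  ∈-arrangements {[]} _ _ = here refl
  ∈-arrangements {a ∷ l} {xs} (a# ∷ u) ⊆xs = ∈ₚ.∈-concatMap⁺ _ {xs = xs} (lose (⊆xs (here refl)) (∈ₚ.∈-map⁺ (a ∷_)
    (∈-arrangements u (λ x∈ → ∈ₚ.∈-filter⁺ (¬? ∘ (_∈? (a ∷ []))) (⊆xs (there x∈))
      (λ { (here refl) → All.lookup a# x∈ refl })))))

  length-remove : ∀ {x xs} → Unique xs → x ∈ xs → suc (length (remove x xs)) ≡ length xs
  length-remove {x} u x∈ = filter-∉-length _≟_ {S = x ∷ []} u ([] ∷ []) (λ { (here refl) → x∈ })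

  length-arrangements : ∀ m c xs → Unique xs → length xs ≡ m + c → length (arrangements m xs) * c ! ≡ (m + c) !
  length-arrangements zero c xs u eq = *-identityˡ (c !)
  length-arrangements (suc m) c xs u eq = begin
    length (arrangements (suc m) xs) * c !
      ≡⟨ cong (_* c !) (≡-trans (sym (∑-1 (arrangements (suc m) xs))) (∑-concatMap _ _ xs)) ⟩
    ∑ xs (λ x → ∑ (map (x ∷_) (arrangements m (remove x xs))) (λ _ → 1)) * c !
      ≡⟨ ∑-*ʳ _ (c !) xs ⟨
    ∑ xs (λ x → ∑ (map (x ∷_) (arrangements m (remove x xs))) (λ _ → 1) * c !)
      ≡⟨ ∑-cong xs (λ {x} x∈ → ≡-trans
           (cong (_* c !) (≡-trans (∑-1 (map (x ∷_) (arrangements m (remove x xs)))) (Listₚ.length-map (x ∷_) (arrangements m (remove x xs)))))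
           (length-arrangements m c (remove x xs) (Uniqueₚ.filter⁺ (¬? ∘ (_∈? (x ∷ []))) u)
             (ℕₚ.suc-injective (≡-trans (length-remove u x∈) eq)))) ⟩
    ∑ xs (λ _ → (m + c) !)
      ≡⟨ ∑-const ((m + c) !) xs ⟩
    length xs * (m + c) !
      ≡⟨ cong (_* (m + c) !) eq ⟩
    suc (m + c) * (m + c) ! ∎
    where open ≡-Reasoning

  length-arrangements-all : ∀ xs → Unique xs → length (arrangements (length xs) xs) ≡ length xs !
  length-arrangements-all xs u = ≡-trans (sym (*-identityʳ _)) (≡-trans
    (length-arrangements (length xs) 0 xs u (sym (+-identityʳ (length xs)))) (cong _! (+-identityʳ (length xs))))

map-agree : {A B : Set} {f g : A → B} (xs : List A) → map f xs ≡ map g xs → ∀ {x} → x ∈ xs → f x ≡ g x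
map-agree (x ∷ xs) eq (here refl) = Listₚ.∷-injectiveˡ eq
map-agree (x ∷ xs) eq (there x∈)  = map-agree xs (Listₚ.∷-injectiveʳ eq) x∈

length-cartesianProduct : {A B : Set} (xs : List A) (ys : List B) →
  length (cartesianProduct xs ys) ≡ length xs * length ys
length-cartesianProduct []       ys = refl
length-cartesianProduct (x ∷ xs) ys = ≡-trans (Listₚ.length-++ (map (x ,_) ys))
  (cong₂ _+_ (Listₚ.length-map (x ,_) ys) (length-cartesianProduct xs ys))

module _ {n : ℕ} where

  open Arrangements (_≟F_ {n})

  moved? : (z : Perm n) (i : Fin n) → Dec (lookup z i ≢ i)
  moved? z i = ¬? (lookup z i ≟F i)

  support : Perm n → List (Fin n)
  support z = filter (moved? z) (allFin n)

  permBijection : ∀ {z} → z ∈ Sym n → Bijection (allFin n)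
  permBijection {z} z∈ = record
    { φ = lookup z ; ψ = lookup (z ⁻¹)
    ; φ∈ = λ _ → ∈ₚ.∈-allFin _ ; ψ∈ = λ _ → ∈ₚ.∈-allFin _
    ; ψφ = λ {x} _ → lookup-inverseˡ z∈ x ; φψ = λ {x} _ → lookup-inverseʳ z∈ x }

  commute? : (u z : Perm n) → Dec (u · z ≡ z · u)
  commute? u z = (u · z) ≟P (z · u)

  #centralizer : Perm n → ℕ
  #centralizer z = ∑ (Sym n) (λ u → 𝟙 (commute? u z))

  module Centralizer {z : Perm n} (z∈ : z ∈ Sym n) where
    module F = FewInvariant _≟F_ (Uniqueₚ.allFin⁺ n) (permBijection z∈)
    module I = Independent _≟F_ F.uMoved F.bijMoved (λ x∈ → proj₂ (F.∈Moved⁻ x∈))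

    t : ℕ
    t = length (support z)

    f+t≡n : F.f + t ≡ n
    f+t≡n = ≡-trans (+-comm F.f t) (≡-trans F.s+f≡N (length-allFin n))

    t≤2p : t ≤ I.p + I.p
    t≤2p = ≤-trans (≤-reflexive (sym I.r+p≡)) (+-monoˡ-≤ I.p I.r≤p)

    commutes : ∀ {u} → u · z ≡ z · u → ∀ i → lookup u (lookup z i) ≡ lookup z (lookup u i)
    commutes {u} eq i = ≡-trans (sym (lookup-· u z i)) (≡-trans (cong (λ w → lookup w i) eq) (lookup-· z u i))

    fixed-image : ∀ {u} → u · z ≡ z · u → ∀ {i} → i ∈ F.Fixed → lookup u i ∈ F.Fixed
    fixed-image {u} eq {i} i∈ = ∈ₚ.∈-filter⁺ F.fixed? (∈ₚ.∈-allFin _)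
      (≡-trans (sym (commutes {u} eq i)) (cong (lookup u) (proj₂ (∈ₚ.∈-filter⁻ F.fixed? {xs = allFin n} i∈))))

    moved-image : ∀ {u} → u ∈ Sym n → u · z ≡ z · u → ∀ {i} → i ∈ F.Moved → lookup u i ∈ F.Moved
    moved-image {u} u∈ eq {i} i∈ = ∈ₚ.∈-filter⁺ (¬? ∘ F.fixed?) (∈ₚ.∈-allFin _)
      (λ fix → proj₂ (F.∈Moved⁻ i∈) (∈-Sym⁻ u∈ (≡-trans (commutes {u} eq i) fix)))

    agree : ∀ {u v} → u · z ≡ z · u → v · z ≡ z · v →
            map (lookup u) F.Fixed ≡ map (lookup v) F.Fixed → map (lookup u) I.Reps ≡ map (lookup v) I.Reps → u ≡ v
    agree {u} {v} cu cv eqF eqR = lookup-ext at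
      where
      onReps : ∀ {i} → i ∈ I.Reps → lookup u i ≡ lookup v i
      onReps = map-agree I.Reps eqR
      onRest : ∀ {i} → i ∈ I.Rest → lookup u i ≡ lookup v i
      onRest {i} i∈ with I.neighbour i∈
      ... | inj₁ φi∈ = ∈-Sym⁻ z∈ (≡-trans (sym (commutes {u} cu i)) (≡-trans (onReps φi∈) (commutes {v} cv i)))
      ... | inj₂ ψi∈ = subst (λ j → lookup u j ≡ lookup v j) (lookup-inverseʳ z∈ i)
        (≡-trans (commutes {u} cu (lookup (z ⁻¹) i)) (≡-trans (cong (lookup z) (onReps ψi∈)) (sym (commutes {v} cv (lookup (z ⁻¹) i)))))
      at : ∀ i → lookup u i ≡ lookup v i
      at i with ∈ₚ.∈-++⁻ F.Moved (↭ₚ.∈-resp-↭ F.D↭ (∈ₚ.∈-allFin i))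
      ... | inj₂ fx = map-agree F.Fixed eqF fx
      ... | inj₁ mv with ∈ₚ.∈-++⁻ I.Reps (↭ₚ.∈-resp-↭ I.D↭ mv)
      ...   | inj₁ rp = onReps rp
      ...   | inj₂ rs = onRest rs

    -- An element of the centralizer permutes the fixed points of z and injects `Reps` into the
    -- moved points; its values on `Rest` follow by commuting along an edge to a neighbour in
    -- `Reps`. The first part has f! possibilities, the second t! / p!.
    #centralizer-≤ : #centralizer z * I.p ! ≤ F.f ! * t !
    #centralizer-≤ = begin
      #centralizer z * I.p !
        ≤⟨ *-monoˡ-≤ (I.p !) (count-injection (×-≡-dec (Listₚ.≡-dec _≟F_) (Listₚ.≡-dec _≟F_)) {ys = ys} (Unique-Sym n)
             (λ u → commute? u z) (λ u → map (lookup u) F.Fixed , map (lookup u) I.Reps) into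
             (λ {u} {v} _ _ cu cv eq → agree {u} {v} cu cv (cong proj₁ eq) (cong proj₂ eq))) ⟩
      length ys * I.p !
        ≡⟨ cong (_* I.p !) (length-cartesianProduct (arrangements F.f F.Fixed) (arrangements I.r F.Moved)) ⟩
      length (arrangements F.f F.Fixed) * length (arrangements I.r F.Moved) * I.p !
        ≡⟨ *-assoc (length (arrangements F.f F.Fixed)) (length (arrangements I.r F.Moved)) (I.p !) ⟩
      length (arrangements F.f F.Fixed) * (length (arrangements I.r F.Moved) * I.p !)
        ≡⟨ cong₂ _*_ (length-arrangements-all F.Fixed (Uniqueₚ.filter⁺ F.fixed? (Uniqueₚ.allFin⁺ n)))
                     (≡-trans (length-arrangements I.r I.p F.Moved F.uMoved (sym I.r+p≡)) (cong _! I.r+p≡)) ⟩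
      F.f ! * t ! ∎
      where
      open ≤-Reasoning
      ys : List (List (Fin n) × List (Fin n))
      ys = cartesianProduct (arrangements F.f F.Fixed) (arrangements I.r F.Moved)
      into : ∀ {u} → u ∈ Sym n → u · z ≡ z · u → (map (lookup u) F.Fixed , map (lookup u) I.Reps) ∈ ys
      into {u} u∈ cu = ∈ₚ.∈-cartesianProduct⁺
        (subst (λ m → map (lookup u) F.Fixed ∈ arrangements m F.Fixed) (Listₚ.length-map (lookup u) F.Fixed)
          (∈-arrangements (Uniqueₚ.map⁺ (∈-Sym⁻ u∈) (Uniqueₚ.filter⁺ F.fixed? (Uniqueₚ.allFin⁺ n)))
            (λ y∈ → let (x , x∈ , eq) = ∈ₚ.∈-map⁻ _ y∈ in subst (_∈ F.Fixed) (sym eq) (fixed-image {u} cu x∈))))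
        (subst (λ m → map (lookup u) I.Reps ∈ arrangements m F.Moved) (Listₚ.length-map (lookup u) I.Reps)
          (∈-arrangements (Uniqueₚ.map⁺ (∈-Sym⁻ u∈) I.uReps)
            (λ y∈ → let (x , x∈ , eq) = ∈ₚ.∈-map⁻ _ y∈ in subst (_∈ F.Moved) (sym eq) (moved-image {u} u∈ cu (proj₁ (I.∈Reps⁻ x∈))))))

    2≤t : z ≢ ε → 2 ≤ t
    2≤t z≢ε with Any.any? (moved? z) (allFin n)
    ... | no none = contradiction (lookup-ext λ i → ≡-trans (fix i) (sym (lookup-ε i))) z≢ε
      where
      fix : ∀ i → lookup z i ≡ i
      fix i with lookup z i ≟F i
      ... | yes eq = eq
      ... | no ne  = contradiction (lose (∈ₚ.∈-allFin i) ne) none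
    ... | yes some with find some
    ...   | i , i∈ , ne = length-injection _≟F_ {xs = i ∷ lookup z i ∷ []} {ys = F.Moved}
      (((λ eq → ne (sym eq)) ∷ []) ∷ [] ∷ []) id
      (λ { (here refl) → i∈M ; (there (here refl)) → Bijection.φ∈ F.bijMoved i∈M }) (λ _ _ eq → eq)
      where
      i∈M : i ∈ F.Moved
      i∈M = ∈ₚ.∈-filter⁺ (¬? ∘ F.fixed?) i∈ ne

  -- A permutation is recorded by its support and its values there; derangements of the support are
  -- bounded by all its arrangements.
  support-count : ∀ t → ∑ (Sym n) (λ z → 𝟙 (length (support z) ≟ℕ t)) ≤ (n C t) * t !
  support-count t = ≤-trans
    (count-injection (×-≡-dec (Listₚ.≡-dec _≟F_) (Listₚ.≡-dec _≟F_)) {ys = ys} (Unique-Sym n)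
      (λ z → length (support z) ≟ℕ t) (λ z → support z , map (lookup z) (support z)) into inj)
    (≤-reflexive size)
    where
    code : List (Fin n) → List (List (Fin n) × List (Fin n))
    code S = map (S ,_) (arrangements t S)
    ys : List (List (Fin n) × List (Fin n))
    ys = concatMap code (choose t (allFin n))
    into : ∀ {z} → z ∈ Sym n → length (support z) ≡ t → (support z , map (lookup z) (support z)) ∈ ys
    into {z} z∈ refl = ∈ₚ.∈-concatMap⁺ code {xs = choose t (allFin n)} (lose (filter-∈-choose (moved? z) (allFin n))
      (∈ₚ.∈-map⁺ (support z ,_) (subst (λ m → map (lookup z) (support z) ∈ arrangements m (support z)) (Listₚ.length-map (lookup z) (support z))
        (∈-arrangements (Uniqueₚ.map⁺ (∈-Sym⁻ z∈) (Uniqueₚ.filter⁺ (moved? z) (Uniqueₚ.allFin⁺ n)))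
          (λ y∈ → let (x , x∈ , eq) = ∈ₚ.∈-map⁻ _ y∈ in
             subst (_∈ support z) (sym eq) (Bijection.φ∈ (Centralizer.F.bijMoved z∈) x∈))))))
    inj : ∀ {z w} → z ∈ Sym n → w ∈ Sym n → length (support z) ≡ t → length (support w) ≡ t →
          (support z , map (lookup z) (support z)) ≡ (support w , map (lookup w) (support w)) → z ≡ w
    inj {z} {w} _ _ _ _ eq = lookup-ext at
      where
      supp≡ : support z ≡ support w
      supp≡ = cong proj₁ eq
      vals≡ : map (lookup z) (support z) ≡ map (lookup w) (support z)
      vals≡ = ≡-trans (cong proj₂ eq) (cong (map (lookup w)) (sym supp≡))
      at : ∀ i → lookup z i ≡ lookup w i
      at i with lookup z i ≟F i | lookup w i ≟F i
      ... | yes p | yes q = ≡-trans p (sym q)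
      ... | no p  | _     = map-agree (support z) vals≡ (∈ₚ.∈-filter⁺ (moved? z) (∈ₚ.∈-allFin i) p)
      ... | yes p | no q  = contradiction p (proj₂ (∈ₚ.∈-filter⁻ (moved? z) {xs = allFin n}
                              (subst (i ∈_) (sym supp≡) (∈ₚ.∈-filter⁺ (moved? w) (∈ₚ.∈-allFin i) q))))
    size : length ys ≡ (n C t) * t !
    size = begin
      length ys                                                ≡⟨ ∑-1 ys ⟨
      ∑ ys (λ _ → 1)                                           ≡⟨ ∑-concatMap (λ _ → 1) code (choose t (allFin n)) ⟩
      ∑ (choose t (allFin n)) (λ S → ∑ (code S) (λ _ → 1))     ≡⟨ ∑-cong (choose t (allFin n)) (λ {S} S∈ → ≡-trans (∑-1 (code S)) (≡-trans (Listₚ.length-map (S ,_) (arrangements t S)) (each S S∈))) ⟩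
      ∑ (choose t (allFin n)) (λ _ → t !)                      ≡⟨ ∑-const (t !) (choose t (allFin n)) ⟩
      length (choose t (allFin n)) * t !                       ≡⟨ cong (_* t !) (≡-trans (length-choose t (allFin n)) (cong (_C t) (length-allFin n))) ⟩
      (n C t) * t !                                            ∎
      where
      open ≡-Reasoning
      each : ∀ S → S ∈ choose t (allFin n) → length (arrangements t S) ≡ t !
      each S S∈ = subst (λ m → length (arrangements m S) ≡ m !) (choose-length t (allFin n) S∈)
        (length-arrangements-all S (choose-Unique t (Uniqueₚ.allFin⁺ n) S∈))

-- Commuting pairs

!-mono : ∀ {m n} → m ≤ n → m ! ≤ n !
!-mono {zero}  {n}     _         = ℕₚ.1≤n! n
!-mono {suc m} {suc n} (s≤s m≤n) = *-mono-≤ (s≤s m≤n) (!-mono m≤n)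

C≤2^ : ∀ n k → n C k ≤ 2 ^ n
C≤2^ n zero = ℕₚ.m^n>0 2 n
C≤2^ zero (suc k) = z≤n
C≤2^ (suc n) (suc k) = ≤-trans (≤-reflexive (sym (nCk+nC[k+1]≡[n+1]C[k+1] n k)))
  (≤-trans (+-mono-≤ (C≤2^ n k) (C≤2^ n (suc k))) (≤-reflexive (cong (2 ^ n +_) (sym (+-identityʳ (2 ^ n))))))

!≤2^*!*! : ∀ {r p} → r ≤ p → (r + p) ! ≤ 2 ^ (r + p) * (p ! * p !)
!≤2^*!*! {r} {p} r≤p = ≤-trans (≤-reflexive (sym (C*!*! r p)))
  (*-mono-≤ (C≤2^ (r + p) r) (*-monoˡ-≤ (p !) (!-mono r≤p)))

module Orbits {n : ℕ} {z : Perm n} (z∈ : z ∈ Sym n) where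

  pow : ℕ → Fin n → Fin n
  pow zero    r = r
  pow (suc i) r = lookup z (pow i r)

  pow-+ : ∀ i j r → pow (i + j) r ≡ pow i (pow j r)
  pow-+ zero    j r = refl
  pow-+ (suc i) j r = cong (lookup z) (pow-+ i j r)

  pow-injective : ∀ i {r s} → pow i r ≡ pow i s → r ≡ s
  pow-injective zero    eq = eq
  pow-injective (suc i) eq = pow-injective i (∈-Sym⁻ z∈ eq)

  period : ∀ r → ∃ λ d → suc d ≤ n × pow (suc d) r ≡ r
  period r with Finₚ.pigeonhole (ℕₚ.n<1+n n) (λ i → pow (toℕ i) r)
  ... | i , j , i<j , eq with ℕₚ.m≤n⇒∃[o]m+o≡n i<j
  ...   | d , eq′ = d , ≤-trans (m≤n+m (suc d) (toℕ i)) (≤-trans (≤-reflexive (≡-trans (ℕₚ.+-suc (toℕ i) d) eq′)) (s≤s⁻¹ (Finₚ.toℕ<n j))) ,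
    pow-injective (toℕ i) (≡-trans (sym (pow-+ (toℕ i) (suc d) r))
      (≡-trans (cong (λ m → pow m r) (≡-trans (ℕₚ.+-suc (toℕ i) d) eq′)) (sym eq)))

  -- Exponents are bounded by n so that reachability is decidable. The bound loses nothing, because
  -- `period` provides a return time of at most n.
  Reach : Fin n → Fin n → Set
  Reach r x = ∃ λ (i : Fin n) → pow (toℕ i) r ≡ x

  reach? : ∀ x r → Dec (Reach r x)
  reach? x r = Finₚ.any? (λ i → pow (toℕ i) r ≟F x)

  reach : ∀ {i r x} → i < n → pow i r ≡ x → Reach r x
  reach {i} {r} i<n eq = fromℕ< i<n , ≡-trans (cong (λ m → pow m r) (Finₚ.toℕ-fromℕ< i<n)) eq

  reach-step : ∀ {r x} → Reach r x → Reach r (lookup z x)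
  reach-step {r} (i , eq) with suc (toℕ i) <? n
  ... | yes lt = reach {suc (toℕ i)} lt (cong (lookup z) eq)
  ... | no ¬lt with period r
  ...   | d , d<n , per with ℕₚ.m≤n⇒∃[o]m+o≡n d<n
  ...     | o , eq′ = reach {o} (≤-trans (s≤s (m≤n+m o d)) (≤-reflexive eq′)) (begin
    pow o r                   ≡⟨ cong (pow o) per ⟨
    pow o (pow (suc d) r)     ≡⟨ pow-+ o (suc d) r ⟨
    pow (o + suc d) r         ≡⟨ cong (λ m → pow m r) (≡-trans (+-comm o (suc d)) (≡-trans eq′ (ℕₚ.≤-antisym (ℕₚ.≮⇒≥ ¬lt) (Finₚ.toℕ<n i)))) ⟩
    pow (suc (toℕ i)) r       ≡⟨ cong (lookup z) eq ⟩
    lookup z _                ∎)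
    where open ≡-Reasoning

  reach-back : ∀ {r x} → Reach r (lookup z x) → Reach r x
  reach-back {r} {x} (i , eq) = go (toℕ i) (Finₚ.toℕ<n i) eq
    where
    go : ∀ i → i < n → pow i r ≡ lookup z x → Reach r x
    go (suc i) i<n eq = reach {i} (ℕₚ.<-trans (ℕₚ.n<1+n i) i<n) (∈-Sym⁻ z∈ eq)
    go zero    _   eq = let (d , d<n , per) = period r in reach {d} d<n (∈-Sym⁻ z∈ (≡-trans per eq))

  headOr : Fin n → List (Fin n) → Fin n
  headOr d []      = d
  headOr d (x ∷ _) = x

  headOr-default : ∀ {d e xs y} → y ∈ xs → headOr d xs ≡ headOr e xs
  headOr-default (here _)  = refl
  headOr-default (there _) = refl

  headOr-∈ : ∀ {d xs y} → y ∈ xs → headOr d xs ∈ xs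
  headOr-∈ (here _)  = here refl
  headOr-∈ (there _) = here refl

  sources : Fin n → List (Fin n)
  sources x = filter (reach? x) (allFin n)

  self-source : ∀ x → x ∈ sources x
  self-source x = ∈ₚ.∈-filter⁺ (reach? x) (∈ₚ.∈-allFin x) (reach {0} (≤-trans (s≤s z≤n) (Finₚ.toℕ<n x)) refl)

  sources-step : ∀ x → sources (lookup z x) ≡ sources x
  sources-step x = filter-cong-∈ (reach? (lookup z x)) (reach? x) (allFin n) (λ _ → reach-back , reach-step)

  -- The first point of `allFin n` from which x is reached: a canonical element of the cycle of x.
  -- The list `sources x` depends only on the cycle and contains x, so the fallback value is never
  -- taken.
  rep : Fin n → Fin n
  rep x = headOr x (sources x)

  rep-step : ∀ x → rep (lookup z x) ≡ rep x
  rep-step x = ≡-trans (cong (headOr (lookup z x)) (sources-step x)) (headOr-default (self-source x))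

  rep-reach : ∀ x → Reach (rep x) x
  rep-reach x = proj₂ (∈ₚ.∈-filter⁻ (reach? x) {xs = allFin n} (headOr-∈ {d = x} (self-source x)))

  ρ : Perm n
  ρ = tabulate rep

  ρ·z≡ρ : ρ · z ≡ ρ
  ρ·z≡ρ = lookup-ext λ i → begin
    lookup (ρ · z) i        ≡⟨ lookup-· ρ z i ⟩
    lookup ρ (lookup z i)   ≡⟨ Vecₚ.lookup∘tabulate rep (lookup z i) ⟩
    rep (lookup z i)        ≡⟨ rep-step i ⟩
    rep i                   ≡⟨ Vecₚ.lookup∘tabulate rep i ⟨
    lookup ρ i              ∎
    where open ≡-Reasoning

  commute-pow : ∀ {u} → u · z ≡ z · u → ∀ i r → lookup u (pow i r) ≡ pow i (lookup u r)
  commute-pow cu zero    r = refl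
  commute-pow {u} cu (suc i) r = ≡-trans (Centralizer.commutes z∈ {u} cu (pow i r)) (cong (lookup z) (commute-pow {u} cu i r))

  ·ρ-injective : ∀ {u v} → u · z ≡ z · u → v · z ≡ z · v → u · ρ ≡ v · ρ → u ≡ v
  ·ρ-injective {u} {v} cu cv eq = lookup-ext λ x → let (i , reaches) = rep-reach x in begin
    lookup u x                            ≡⟨ cong (lookup u) reaches ⟨
    lookup u (pow (toℕ i) (rep x))        ≡⟨ commute-pow {u} cu (toℕ i) (rep x) ⟩
    pow (toℕ i) (lookup u (rep x))        ≡⟨ cong (pow (toℕ i)) (at x) ⟩
    pow (toℕ i) (lookup v (rep x))        ≡⟨ commute-pow {v} cv (toℕ i) (rep x) ⟨
    lookup v (pow (toℕ i) (rep x))        ≡⟨ cong (lookup v) reaches ⟩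
    lookup v x                            ∎
    where
    open ≡-Reasoning
    value : ∀ w x → lookup (w · ρ) x ≡ lookup w (rep x)
    value w x = ≡-trans (lookup-· w ρ x) (cong (lookup w) (Vecₚ.lookup∘tabulate rep x))
    at : ∀ x → lookup u (rep x) ≡ lookup v (rep x)
    at x = ≡-trans (sym (value u x)) (≡-trans (cong (λ w → lookup w x) eq) (value v x))

  -- For u commuting with z the map `u · ρ` is constant on cycles, and u can be rebuilt from its
  -- values on the representatives because it commutes with all powers of z. Such a map need not be
  -- a permutation, so F ranges over all vectors.
  #centralizer≤#invariant-maps : #centralizer z ≤ ∑ (allVecs n n) (λ F → 𝟙 ((F · z) ≟P F))
  #centralizer≤#invariant-maps = ≤-trans
    (count-injection _≟P_ {ys = filter (λ F → (F · z) ≟P F) (allVecs n n)} (Unique-Sym n) (λ u → commute? u z) (_· ρ)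
      (λ {u} _ _ → ∈ₚ.∈-filter⁺ (λ F → (F · z) ≟P F) (∈-allVecs n (u · ρ)) (≡-trans (·-assoc u ρ z) (cong (u ·_) ρ·z≡ρ)))
      (λ {u} {v} _ _ cu cv → ·ρ-injective {u} {v} cu cv))
    (≤-reflexive (length-filter (λ F → (F · z) ≟P F) (allVecs n n)))

module Fibres (y : ℕ) where

  occurrences : ∀ {m} → Fin y → Vec (Fin y) m → ℕ
  occurrences v G = ∑ (toList G) (λ a → 𝟙 (a ≟F v))

  -- weight G = ∏ᵥ (occurrences v G)!, the number of permutations preserving the labelling G
  weight : ∀ {m} → Vec (Fin y) m → ℕ
  weight []      = 1
  weight (v ∷ G) = (1 + occurrences v G) * weight G

  -- The rising factorial y (y + 1) ... (y + m - 1).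
  rising : ℕ → ℕ
  rising zero    = 1
  rising (suc m) = (y + m) * rising m

  ∑-occurrences : ∀ {m} (G : Vec (Fin y) m) → ∑ (allFin y) (λ v → 1 + occurrences v G) ≤ y + m
  ∑-occurrences {m} G = begin
    ∑ (allFin y) (λ v → 1 + occurrences v G)
      ≡⟨ ∑-+ (λ _ → 1) (λ v → occurrences v G) (allFin y) ⟩
    ∑ (allFin y) (λ _ → 1) + ∑ (allFin y) (λ v → ∑ (toList G) (λ a → 𝟙 (a ≟F v)))
      ≡⟨ cong₂ _+_ (≡-trans (∑-1 (allFin y)) (length-allFin y)) (∑-swap (λ v a → 𝟙 (a ≟F v)) (allFin y) (toList G)) ⟩
    y + ∑ (toList G) (λ a → ∑ (allFin y) (λ v → 𝟙 (a ≟F v)))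
      ≤⟨ +-monoʳ-≤ y (∑-≤-const 1 (toList G) (λ {a} _ → ∑-atMostOne (a ≟F_) (Uniqueₚ.allFin⁺ y) (λ _ _ p q → ≡-trans (sym p) q))) ⟩
    y + length (toList G) * 1
      ≡⟨ cong (y +_) (≡-trans (*-identityʳ (length (toList G))) (size G)) ⟩
    y + m ∎
    where
    open ≤-Reasoning
    size : ∀ {A : Set} {m} (G : Vec A m) → length (toList G) ≡ m
    size []      = refl
    size (_ ∷ G) = cong suc (size G)

  -- Putting v in front of G multiplies its weight by 1 plus the number of occurrences of v in G,
  -- and over all v these factors add up to at most y + m.
  ∑-weight : ∀ m → ∑ (allVecs y m) weight ≤ rising m
  ∑-weight zero = ≤-refl
  ∑-weight (suc m) = begin
    ∑ (allVecs y (suc m)) weight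
      ≡⟨ ∑-allVecs y m weight ⟩
    ∑ (allFin y) (λ v → ∑ (allVecs y m) (λ G → (1 + occurrences v G) * weight G))
      ≡⟨ ∑-swap (λ v G → (1 + occurrences v G) * weight G) (allFin y) (allVecs y m) ⟩
    ∑ (allVecs y m) (λ G → ∑ (allFin y) (λ v → (1 + occurrences v G) * weight G))
      ≤⟨ ∑-mono (allVecs y m) (λ {G} _ → ≤-trans (≤-reflexive (∑-*ʳ (λ v → 1 + occurrences v G) (weight G) (allFin y))) (*-monoˡ-≤ (weight G) (∑-occurrences G))) ⟩
    ∑ (allVecs y m) (λ G → (y + m) * weight G)
      ≡⟨ ∑-*ˡ (y + m) weight (allVecs y m) ⟩
    (y + m) * ∑ (allVecs y m) weight
      ≤⟨ *-monoʳ-≤ (y + m) (∑-weight m) ⟩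
    (y + m) * rising m ∎
    where open ≤-Reasoning

  rising-! : ∀ m → rising m * y ! ≤ (y + m) !
  rising-! zero = ≤-reflexive (≡-trans (*-identityˡ (y !)) (cong _! (sym (+-identityʳ y))))
  rising-! (suc m) = begin
    (y + m) * rising m * y !     ≡⟨ *-assoc (y + m) (rising m) (y !) ⟩
    (y + m) * (rising m * y !)   ≤⟨ *-mono-≤ (ℕₚ.n≤1+n (y + m)) (rising-! m) ⟩
    suc (y + m) * (y + m) !      ≡⟨ cong _! (ℕₚ.+-suc y m) ⟨
    (y + suc m) !                ∎
    where open ≤-Reasoning

  module _ (label : Fin y → Fin y) where
    open import Data.List.Membership.DecPropositional (_≟F_ {y}) using (_∈?_)

    labelled? : ∀ {k} (z G : Vec (Fin y) k) → Dec (Data.Vec.map label z ≡ G)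
    labelled? z G = Vecₚ.≡-dec _≟F_ (Data.Vec.map label z) G

    available : List (Fin y) → Fin y → ℕ
    available U v = ∑ (allFin y) (λ a → 𝟙 (¬? (a ∈? U) ×-dec (label a ≟F v)))

    available-∷-≤ : ∀ U i v → available (i ∷ U) v ≤ available U v
    available-∷-≤ U i v = ∑-mono (allFin y) λ {a} _ →
      𝟙-mono (¬? (a ∈? (i ∷ U)) ×-dec (label a ≟F v)) (¬? (a ∈? U) ×-dec (label a ≟F v)) (λ { (p , q) → p ∘ there , q })

    available-∷-< : ∀ U i → i ∉ U → suc (available (i ∷ U) (label i)) ≤ available U (label i)
    available-∷-< U i i∉ = begin
      suc (available (i ∷ U) v)     ≤⟨ +-monoˡ-≤ (available (i ∷ U) v) (≤-trans (≤-reflexive (sym (𝟙-yes (i ≟F i) refl))) (∑-∈ {f = λ a → 𝟙 (a ≟F i)} (∈ₚ.∈-allFin i))) ⟩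
      ∑ (allFin y) (λ a → 𝟙 (a ≟F i)) + available (i ∷ U) v
        ≡⟨ ∑-+ (λ a → 𝟙 (a ≟F i)) _ (allFin y) ⟨
      ∑ (allFin y) (λ a → 𝟙 (a ≟F i) + 𝟙 (¬? (a ∈? (i ∷ U)) ×-dec (label a ≟F v)))
        ≤⟨ ∑-mono (allFin y) (λ {a} _ → each a (a ≟F i)) ⟩
      available U v ∎
      where
      open ≤-Reasoning
      v = label i
      each : ∀ a (d : Dec (a ≡ i)) → 𝟙 d + 𝟙 (¬? (a ∈? (i ∷ U)) ×-dec (label a ≟F v)) ≤ 𝟙 (¬? (a ∈? U) ×-dec (label a ≟F v))
      each a (yes refl) = ≤-reflexive (≡-trans
        (cong suc (𝟙-no (¬? (a ∈? (i ∷ U)) ×-dec (label a ≟F v)) (λ { (p , _) → p (here refl) })))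
        (sym (𝟙-yes (¬? (a ∈? U) ×-dec (label a ≟F v)) (i∉ , refl))))
      each a (no _) = 𝟙-mono (¬? (a ∈? (i ∷ U)) ×-dec (label a ≟F v)) (¬? (a ∈? U) ×-dec (label a ≟F v)) (λ { (p , q) → p ∘ there , q })

    count-labelled : ∀ k (G : Vec (Fin y) k) U → (∀ v → available U v ≤ occurrences v G) →
      ∑ (allVecs y k) (λ z → 𝟙 (fresh? y U (toList z) ×-dec labelled? z G)) ≤ weight G
    count-labelled zero [] U _ = ≤-trans (≤-reflexive (+-identityʳ _)) (𝟙≤1 (fresh? y U [] ×-dec labelled? [] []))
    count-labelled (suc k) (v ∷ G) U enough = begin
      ∑ (allVecs y (suc k)) (λ z → 𝟙 (fresh? y U (toList z) ×-dec labelled? z (v ∷ G)))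
        ≡⟨ ∑-allVecs y k (λ z → 𝟙 (fresh? y U (toList z) ×-dec labelled? z (v ∷ G))) ⟩
      ∑ (allFin y) (λ i → ∑ (allVecs y k) (λ z → 𝟙 (fresh? y U (i ∷ toList z) ×-dec labelled? (i ∷ z) (v ∷ G))))
        ≤⟨ ∑-mono (allFin y) (λ {i} _ → each i (¬? (i ∈? U) ×-dec (label i ≟F v))) ⟩
      ∑ (allFin y) (λ i → 𝟙 (¬? (i ∈? U) ×-dec (label i ≟F v)) * weight G)
        ≡⟨ ∑-*ʳ (λ i → 𝟙 (¬? (i ∈? U) ×-dec (label i ≟F v))) (weight G) (allFin y) ⟩
      available U v * weight G
        ≤⟨ *-monoˡ-≤ (weight G) (≤-trans (enough v) (≤-reflexive (cong (_+ occurrences v G) (𝟙-yes (v ≟F v) refl)))) ⟩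
      (1 + occurrences v G) * weight G ∎
      where
      open ≤-Reasoning
      enough′ : ∀ {i} → i ∉ U → label i ≡ v → ∀ w → available (i ∷ U) w ≤ occurrences w G
      enough′ {i} i∉ refl w with label i ≟F w
      ... | yes refl = s≤s⁻¹ (≤-trans (available-∷-< U i i∉) (≤-trans (enough (label i)) (≤-reflexive (cong (_+ occurrences (label i) G) (𝟙-yes (label i ≟F label i) refl)))))
      ... | no ne = ≤-trans (available-∷-≤ U i w) (≤-trans (enough w) (≤-reflexive (cong (_+ occurrences w G) (𝟙-no (label i ≟F w) ne))))
      each : ∀ i (d : Dec (i ∉ U × label i ≡ v)) →
             ∑ (allVecs y k) (λ z → 𝟙 (fresh? y U (i ∷ toList z) ×-dec labelled? (i ∷ z) (v ∷ G))) ≤ 𝟙 d * weight G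
      each i (yes (i∉ , lab)) = ≤-trans (∑-mono (allVecs y k) (λ {z} _ →
          𝟙-mono (fresh? y U (i ∷ toList z) ×-dec labelled? (i ∷ z) (v ∷ G)) (fresh? y (i ∷ U) (toList z) ×-dec labelled? z G)
            (λ { ((i# ∷ uz , _ ∷ z∉) , eq) →
              (uz , All.tabulate (λ { j∈ (here refl) → All.lookup i# j∈ refl ; j∈ (there q) → All.lookup z∉ j∈ q })) , Vecₚ.∷-injectiveʳ eq })))
        (≤-trans (count-labelled k G (i ∷ U) (enough′ i∉ lab)) (≤-reflexive (sym (+-identityʳ (weight G)))))
      each i (no ¬d) = ≤-reflexive (∑-0 (allVecs y k) (λ {z} _ →
        𝟙-no (fresh? y U (i ∷ toList z) ×-dec labelled? (i ∷ z) (v ∷ G)) (λ { ((_ , i∉ ∷ _) , eq) → ¬d (i∉ , Vecₚ.∷-injectiveˡ eq) })))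

module _ (n : ℕ) where
  open Fibres n
  open import Data.List.Membership.DecPropositional (_≟F_ {n}) using (_∈?_)

  -- F z = F says that z preserves the fibres of F: if values are labelled by F, the word z has
  -- label sequence F. This is the situation of `count-labelled` with no value used yet.
  #stabilizer≤weight : (F : Perm n) → ∑ (Sym n) (λ z → 𝟙 ((F · z) ≟P F)) ≤ weight F
  #stabilizer≤weight F = begin
    ∑ (Sym n) (λ z → 𝟙 ((F · z) ≟P F))
      ≡⟨ ∑-filter isPerm? _ (allVecs n n) ⟩
    ∑ (allVecs n n) (λ z → 𝟙 (isPerm? z) * 𝟙 ((F · z) ≟P F))
      ≤⟨ ∑-mono (allVecs n n) (λ {z} _ → 𝟙*-≤ (isPerm? z) (λ uz → 𝟙-mono ((F · z) ≟P F) (fresh? n [] (toList z) ×-dec labelled? (lookup F) z F)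
           (λ eq → (uz , All.tabulate (λ _ ())) , ≡-trans (lookup-ext (λ i → ≡-trans (Vecₚ.lookup-map i (lookup F) z) (sym (lookup-· F z i)))) eq))) ⟩
    ∑ (allVecs n n) (λ z → 𝟙 (fresh? n [] (toList z) ×-dec labelled? (lookup F) z F))
      ≤⟨ count-labelled (lookup F) n F [] enough ⟩
    weight F ∎
    where
    open ≤-Reasoning
    tabulated : ∀ {m} (G : Vec (Fin n) m) v → ∑ (allFin m) (λ a → 𝟙 (lookup G a ≟F v)) ≡ occurrences v G
    tabulated {m} G v = ≡-trans (sym (∑-map (λ b → 𝟙 (b ≟F v)) (lookup G) (allFin m))) (cong (λ l → ∑ l (λ b → 𝟙 (b ≟F v))) (list G))
      where
      list : ∀ {m} (G : Vec (Fin n) m) → map (lookup G) (allFin m) ≡ toList G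
      list G = ≡-trans (Listₚ.map-tabulate id (lookup G)) (go G)
        where
        go : ∀ {m} (G : Vec (Fin n) m) → Data.List.tabulate (lookup G) ≡ toList G
        go []      = refl
        go (x ∷ G) = cong (x ∷_) (go G)
    enough : ∀ v → available (lookup F) [] v ≤ occurrences v F
    enough v = ≤-trans (∑-mono (allFin n) (λ {a} _ → 𝟙-mono (¬? (a ∈? []) ×-dec (lookup F a ≟F v)) (lookup F a ≟F v) proj₂))
      (≤-reflexive (tabulated F v))

  -- The pairs (z , F) with F z = F are counted the other way round, by F: the fibre weights add up
  -- to at most (2n)! / n!, and the bound on the central binomial coefficient turns this into 4ⁿ n!.
  commuting-pairs : ∑ (Sym n) #centralizer ≤ 4 ^ n * n !
  commuting-pairs = ℕₚ.*-cancelʳ-≤ _ _ (n !) {{n ℕₚ.!≢0}} (begin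
    ∑ (Sym n) #centralizer * n !
      ≤⟨ *-monoˡ-≤ (n !) (∑-mono (Sym n) (λ z∈ → Orbits.#centralizer≤#invariant-maps z∈)) ⟩
    ∑ (Sym n) (λ z → ∑ (allVecs n n) (λ F → 𝟙 ((F · z) ≟P F))) * n !
      ≡⟨ cong (_* n !) (∑-swap (λ z F → 𝟙 ((F · z) ≟P F)) (Sym n) (allVecs n n)) ⟩
    ∑ (allVecs n n) (λ F → ∑ (Sym n) (λ z → 𝟙 ((F · z) ≟P F))) * n !
      ≤⟨ *-monoˡ-≤ (n !) (∑-mono (allVecs n n) (λ {F} _ → #stabilizer≤weight F)) ⟩
    ∑ (allVecs n n) weight * n !
      ≤⟨ *-monoˡ-≤ (n !) (∑-weight n) ⟩
    rising n * n !
      ≤⟨ rising-! n ⟩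
    (n + n) !
      ≤⟨ !≤2^*!*! (≤-refl {n}) ⟩
    2 ^ (n + n) * (n ! * n !)
      ≡⟨ cong (_* (n ! * n !)) (≡-trans (cong (λ m → 2 ^ (n + m)) (sym (+-identityʳ n))) (sym (ℕₚ.^-*-assoc 2 2 n))) ⟩
    4 ^ n * (n ! * n !)
      ≡⟨ *-assoc (4 ^ n) (n !) (n !) ⟨
    4 ^ n * n ! * n ! ∎)
    where open ≤-Reasoning

-- Sums of squares of centralizer orders

n≤2^n : ∀ n → n ≤ 2 ^ n
n≤2^n zero    = z≤n
n≤2^n (suc n) = ≤-trans (+-mono-≤ (ℕₚ.m^n>0 2 n) (n≤2^n n)) (≤-reflexive (cong (2 ^ n +_) (sym (+-identityʳ (2 ^ n)))))

^-distribʳ-* : ∀ n a b → (a * b) ^ n ≡ a ^ n * b ^ n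
^-distribʳ-* zero    a b = refl
^-distribʳ-* (suc n) a b = ≡-trans (cong (a * b *_) (^-distribʳ-* n a b)) (interchange a b (a ^ n) (b ^ n))
  where
  interchange : ∀ a b c d → a * b * (c * d) ≡ a * c * (b * d)
  interchange = solve-∀

-- The witness Mᴹ covers q ≤ M; from then on each new factor M is at most the new factor of the
-- factorial.
power≤factorial : ∀ M → 1 ≤ M → ∃ λ K → ∀ q → M ^ q ≤ K * q !
power≤factorial M 1≤M = M ^ M , bound
  where
  instance
    M≢0 : NonZero M
    M≢0 = >-nonZero 1≤M
  bound : ∀ q → M ^ q ≤ M ^ M * q !
  bound zero = ≤-trans (ℕₚ.m^n>0 M M) (≤-reflexive (sym (*-identityʳ (M ^ M))))
  bound (suc q) with M ≤? suc q
  ... | yes M≤ = ≤-trans (*-mono-≤ M≤ (bound q)) (≤-reflexive (*-exchange (suc q) (M ^ M) (q !)))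
  ... | no ¬M≤ = ≤-trans (ℕₚ.^-monoʳ-≤ M (ℕₚ.<⇒≤ (ℕₚ.≰⇒> ¬M≤))) (≤-trans (≤-reflexive (sym (*-identityʳ (M ^ M)))) (*-monoʳ-≤ (M ^ M) (ℕₚ.1≤n! (suc q))))

-- The bound n² ≤ 4ⁿ turns the left side into 16ⁿ, and n ≤ 8 (n / 8 + 1) turns that into a power of
-- 16⁸ with exponent n / 8 + 1. M stays a variable, tied to 16⁸ only by the hypothesis, so that no
-- power of it is computed.
growth-from : ∀ M → 1 ≤ M → (∀ j → 16 ^ (8 * j) ≡ M ^ j) → ∃ λ K → ∀ n → n * n * 4 ^ n ≤ K * (n / 8) !
growth-from M 1≤M 16^8j = M * K₀ , bound
  where
  K₀ : ℕ
  K₀ = proj₁ (power≤factorial M 1≤M)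
  bound : ∀ n → n * n * 4 ^ n ≤ M * K₀ * (n / 8) !
  bound n = begin
    n * n * 4 ^ n                ≤⟨ *-monoˡ-≤ (4 ^ n) (*-mono-≤ (n≤2^n n) (n≤2^n n)) ⟩
    2 ^ n * 2 ^ n * 4 ^ n        ≡⟨ cong (_* 4 ^ n) (^-distribʳ-* n 2 2) ⟨
    4 ^ n * 4 ^ n                ≡⟨ ^-distribʳ-* n 4 4 ⟨
    16 ^ n                       ≤⟨ ℕₚ.^-monoʳ-≤ 16 n≤ ⟩
    16 ^ (8 * suc (n / 8))       ≡⟨ 16^8j (suc (n / 8)) ⟩
    M * M ^ (n / 8)              ≤⟨ *-monoʳ-≤ M (proj₂ (power≤factorial M 1≤M) (n / 8)) ⟩
    M * (K₀ * (n / 8) !)         ≡⟨ *-assoc M K₀ ((n / 8) !) ⟨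
    M * K₀ * (n / 8) !           ∎
    where
    open ≤-Reasoning
    n≤ : n ≤ 8 * suc (n / 8)
    n≤ = ≤-trans (≤-reflexive (m≡m%n+[m/n]*n n 8)) (≤-trans (+-monoˡ-≤ (n / 8 * 8) (<⇒≤ (m%n<n n 8))) (≤-reflexive (*-comm (suc (n / 8)) 8)))

-- Opaque because the witness contains M ^ M for M = 16 ^ 8, which must never be evaluated.
opaque
  growth : ∃ λ K → ∀ n → n * n * 4 ^ n ≤ K * (n / 8) !
  growth = growth-from (16 ^ 8) (ℕₚ.m^n>0 16 8) (λ j → sym (ℕₚ.^-*-assoc 16 8 j))

!*!≤! : ∀ a b → a ! * b ! ≤ (a + b) !
!*!≤! a b = ≤-trans (≤-reflexive (sym (*-identityˡ _))) (≤-trans (*-monoˡ-≤ (a ! * b !) (C-pos (m≤m+n a b))) (≤-reflexive (C*!*! a b)))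

square*!≤ : ∀ m → (2 + m) * (2 + m) * m ! ≤ 2 * (2 + m) !
square*!≤ m = ≤-trans (m≤m+n _ ((2 + m) * m * m !)) (≤-reflexive (identity m (m !)))
  where
  identity : ∀ m x → (2 + m) * (2 + m) * x + (2 + m) * m * x ≡ 2 * ((2 + m) * ((1 + m) * x))
  identity = solve-∀

cube*!≤ : ∀ m → (3 + m) * (3 + m) * (3 + m) * m ! ≤ 5 * (3 + m) !
cube*!≤ m = ≤-trans (m≤m+n _ ((3 + m) * (4 * (m * m) + 9 * m + 1) * m !)) (≤-reflexive (identity m (m !)))
  where
  identity : ∀ m x → (3 + m) * (3 + m) * (3 + m) * x + (3 + m) * (4 * (m * m) + 9 * m + 1) * x ≡ 5 * ((3 + m) * ((2 + m) * ((1 + m) * x)))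
  identity = solve-∀

-- Moving one point from the support to the fixed points multiplies the left side by (f + 1) / (2t),
-- which is at least 1 because 4t ≤ f + t gives 2t ≤ f. The descent stops at t = 3, where 3! · 2³ =
-- 48.
small-support-step : ∀ d f → 4 * (3 + d) ≤ f + (3 + d) → f ! * ((3 + d) ! * 2 ^ (3 + d)) ≤ (f + d) ! * 48
small-support-step zero f _ = ≤-reflexive (cong (λ m → m ! * 48) (sym (+-identityʳ f)))
small-support-step (suc d) f 4t≤n = begin
  f ! * ((4 + d) ! * 2 ^ (4 + d))                    ≡⟨ regroup (f !) (4 + d) ((3 + d) !) (2 ^ (3 + d)) ⟩
  2 * (4 + d) * f ! * ((3 + d) ! * 2 ^ (3 + d))      ≤⟨ *-monoˡ-≤ ((3 + d) ! * 2 ^ (3 + d)) (*-monoˡ-≤ (f !) (≤-trans 2t≤f (ℕₚ.n≤1+n f))) ⟩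
  suc f ! * ((3 + d) ! * 2 ^ (3 + d))                ≤⟨ small-support-step d (suc f) (≤-trans (*-monoʳ-≤ 4 (ℕₚ.n≤1+n (3 + d))) (≤-trans 4t≤n (≤-reflexive (ℕₚ.+-suc f (3 + d))))) ⟩
  (suc f + d) ! * 48                                 ≡⟨ cong (λ m → m ! * 48) (ℕₚ.+-suc f d) ⟨
  (f + suc d) ! * 48                                 ∎
  where
  open ≤-Reasoning
  regroup : ∀ x t y w → x * (t * y * (2 * w)) ≡ 2 * t * x * (y * w)
  regroup = solve-∀
  3t≤f : 3 * (4 + d) ≤ f
  3t≤f = ℕₚ.+-cancelʳ-≤ (4 + d) (3 * (4 + d)) f (≤-trans (≤-reflexive (+-comm (3 * (4 + d)) (4 + d))) 4t≤n)
  2t≤f : 2 * (4 + d) ≤ f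
  2t≤f = ≤-trans (*-monoˡ-≤ (4 + d) {2} {3} (s≤s (s≤s z≤n))) 3t≤f

-- 240 = 5 · 48, with 5 from `cube*!≤`. A saving of n³ rather than n² is available from t = 3 on; it
-- compensates for the summation over all such t.
small-support₃ : ∀ t f → 3 ≤ t → 4 * t ≤ f + t → (f + t) * (f + t) * (f + t) * (f ! * (t ! * 2 ^ t)) ≤ 240 * (f + t) !
small-support₃ (suc (suc (suc d))) f (s≤s (s≤s (s≤s _))) 4t≤n = begin
  n * n * n * (f ! * ((3 + d) ! * 2 ^ (3 + d)))   ≤⟨ *-monoʳ-≤ (n * n * n) (small-support-step d f 4t≤n) ⟩
  n * n * n * ((f + d) ! * 48)                    ≡⟨ *-assoc (n * n * n) ((f + d) !) 48 ⟨
  n * n * n * (f + d) ! * 48                      ≡⟨ cong (λ m → m * m * m * (f + d) ! * 48) eq ⟩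
  (3 + (f + d)) * (3 + (f + d)) * (3 + (f + d)) * (f + d) ! * 48  ≤⟨ *-monoˡ-≤ 48 (cube*!≤ (f + d)) ⟩
  5 * (3 + (f + d)) ! * 48                        ≡⟨ regroup ((3 + (f + d)) !) ⟩
  240 * (3 + (f + d)) !                           ≡⟨ cong (λ m → 240 * m !) eq ⟨
  240 * n !                                       ∎
  where
  open ≤-Reasoning
  n : ℕ
  n = f + (3 + d)
  eq : n ≡ 3 + (f + d)
  eq = shift f d
    where
    shift : ∀ f d → f + (3 + d) ≡ 3 + (f + d)
    shift = solve-∀
  regroup : ∀ x → 5 * x * 48 ≡ 240 * x
  regroup = solve-∀

small-support₂ : ∀ f → (f + 2) * (f + 2) * (f ! * (2 ! * 2 ^ 2)) ≤ 16 * (f + 2) !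
small-support₂ f = begin
  (f + 2) * (f + 2) * (f ! * 8)        ≡⟨ cong (λ m → m * m * (f ! * 8)) (+-comm f 2) ⟩
  (2 + f) * (2 + f) * (f ! * 8)        ≡⟨ *-assoc ((2 + f) * (2 + f)) (f !) 8 ⟨
  (2 + f) * (2 + f) * f ! * 8          ≤⟨ *-monoˡ-≤ 8 (square*!≤ f) ⟩
  2 * (2 + f) ! * 8                    ≡⟨ regroup ((2 + f) !) ⟩
  16 * (2 + f) !                       ≡⟨ cong (λ m → 16 * m !) (+-comm 2 f) ⟩
  16 * (f + 2) !                       ∎
  where
  open ≤-Reasoning
  regroup : ∀ x → 2 * x * 8 ≡ 16 * x
  regroup = solve-∀

module _ {n : ℕ} where

  t# : Perm n → ℕ
  t# z = length (support z)

  c² : Perm n → ℕ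
  c² z = #centralizer z * #centralizer z

  -- Squaring c p! ≤ f! t! and using t! ≤ 2ᵗ (p!)² removes p. The factor C(n, t) t! bounds the
  -- number of permutations with support of size t, and C(n, t) t! f! = n!; hence c² sums over all
  -- of them to at most n! f! t! 2ᵗ.
  centralizer-square : ∀ {z} (z∈ : z ∈ Sym n) → let open Centralizer z∈ in
    c² z * ((n C t) * t !) ≤ n ! * (F.f ! * (t ! * 2 ^ t))
  centralizer-square {z} z∈ = ℕₚ.*-cancelʳ-≤ _ _ (I.p ! * I.p !) {{ℕₚ.m*n≢0 (I.p !) (I.p !) {{I.p ℕₚ.!≢0}} {{I.p ℕₚ.!≢0}}}} (begin
    c * c * (b * t !) * (I.p ! * I.p !)              ≡⟨ regroup₁ c (b * t !) (I.p !) ⟩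
    (c * I.p !) * (c * I.p !) * (b * t !)            ≤⟨ *-monoˡ-≤ (b * t !) (*-mono-≤ #centralizer-≤ #centralizer-≤) ⟩
    (F.f ! * t !) * (F.f ! * t !) * (b * t !)        ≡⟨ regroup₂ (F.f !) (t !) b ⟩
    (b * (t ! * F.f !)) * (F.f ! * t !) * t !        ≡⟨ cong (λ m → m * (F.f ! * t !) * t !) total ⟩
    n ! * (F.f ! * t !) * t !                        ≤⟨ *-monoʳ-≤ (n ! * (F.f ! * t !)) t!≤ ⟩
    n ! * (F.f ! * t !) * (2 ^ t * (I.p ! * I.p !))  ≡⟨ regroup₃ (n !) (F.f !) (t !) (2 ^ t) (I.p ! * I.p !) ⟩
    n ! * (F.f ! * (t ! * 2 ^ t)) * (I.p ! * I.p !)  ∎)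
    where
    open ≤-Reasoning
    open Centralizer z∈
    c b : ℕ
    c = #centralizer z
    b = n C t
    total : b * (t ! * F.f !) ≡ n !
    total = subst (λ m → (m C t) * (t ! * F.f !) ≡ m !) (≡-trans (+-comm t F.f) f+t≡n) (C*!*! t F.f)
    t!≤ : t ! ≤ 2 ^ t * (I.p ! * I.p !)
    t!≤ = subst (λ m → m ! ≤ 2 ^ m * (I.p ! * I.p !)) I.r+p≡ (!≤2^*!*! I.r≤p)
    regroup₁ : ∀ c x p → c * c * x * (p * p) ≡ (c * p) * (c * p) * x
    regroup₁ = solve-∀
    regroup₂ : ∀ f t b → (f * t) * (f * t) * (b * t) ≡ (b * (t * f)) * (f * t) * t
    regroup₂ = solve-∀
    regroup₃ : ∀ n f t w p → n * (f * t) * (w * p) ≡ n * (f * (t * w)) * p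
    regroup₃ = solve-∀

  square-sum-at : ∀ f t → f + t ≡ n → ∑ (Sym n) (λ z → 𝟙 (t# z ≟ℕ t) * c² z) ≤ n ! * (f ! * (t ! * 2 ^ t))
  square-sum-at f t f+t≡n = ℕₚ.*-cancelʳ-≤ _ _ Qₜ {{>-nonZero (*-mono-≤ (C-pos t≤n) (ℕₚ.1≤n! t))}} (begin
    ∑ (Sym n) (λ z → 𝟙 (t# z ≟ℕ t) * c² z) * Qₜ       ≡⟨ ∑-*ʳ (λ z → 𝟙 (t# z ≟ℕ t) * c² z) Qₜ (Sym n) ⟨
    ∑ (Sym n) (λ z → 𝟙 (t# z ≟ℕ t) * c² z * Qₜ)       ≤⟨ ∑-mono (Sym n) (λ {z} z∈ → each z∈ (t# z ≟ℕ t)) ⟩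
    ∑ (Sym n) (λ z → 𝟙 (t# z ≟ℕ t) * Y)              ≡⟨ ∑-*ʳ (λ z → 𝟙 (t# z ≟ℕ t)) Y (Sym n) ⟩
    ∑ (Sym n) (λ z → 𝟙 (t# z ≟ℕ t)) * Y              ≤⟨ *-monoˡ-≤ Y (support-count t) ⟩
    Qₜ * Y                                                    ≡⟨ *-comm Qₜ Y ⟩
    Y * Qₜ                                                    ∎)
    where
    open ≤-Reasoning
    Qₜ Y : ℕ
    Qₜ = (n C t) * t !
    Y = n ! * (f ! * (t ! * 2 ^ t))
    t≤n : t ≤ n
    t≤n = ≤-trans (m≤n+m t f) (≤-reflexive f+t≡n)
    each : ∀ {z} → z ∈ Sym n → (d : Dec (t# z ≡ t)) → 𝟙 d * c² z * Qₜ ≤ 𝟙 d * Y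
    each z∈ (no _) = z≤n
    each {z} z∈ (yes refl) = begin
      (c² z + 0) * Qₜ       ≡⟨ cong (_* Qₜ) (+-identityʳ (c² z)) ⟩
      c² z * Qₜ             ≤⟨ centralizer-square z∈ ⟩
      n ! * (Centralizer.F.f z∈ ! * (t ! * 2 ^ t))  ≡⟨ cong (λ m → n ! * (m ! * (t ! * 2 ^ t))) (ℕₚ.+-cancelʳ-≡ t _ _ (≡-trans (Centralizer.f+t≡n z∈) (sym f+t≡n))) ⟩
      Y                    ≡⟨ +-identityʳ Y ⟨
      Y + 0                ∎

  -- Here p ≥ t / 2 > n / 8, so the factor p! saved in the centralizer is at least (n / 8)!, which
  -- outgrows every exponential.
  large-support : ∀ {z} → z ∈ Sym n → n < 4 * t# z → #centralizer z * (n / 8) ! ≤ n !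
  large-support {z} z∈ n<4t = begin
    #centralizer z * (n / 8) !   ≤⟨ *-monoʳ-≤ (#centralizer z) (!-mono q≤p) ⟩
    #centralizer z * I.p !       ≤⟨ #centralizer-≤ ⟩
    F.f ! * t !                  ≤⟨ !*!≤! F.f t ⟩
    (F.f + t) !                  ≡⟨ cong _! f+t≡n ⟩
    n !                          ∎
    where
    open ≤-Reasoning
    open Centralizer z∈
    q≤p : n / 8 ≤ I.p
    q≤p = ℕₚ.*-cancelʳ-≤ (n / 8) I.p 8 (begin
      n / 8 * 8            ≤⟨ m/n*n≤m n 8 ⟩
      n                    ≤⟨ <⇒≤ n<4t ⟩
      4 * t                ≤⟨ *-monoʳ-≤ 4 t≤2p ⟩
      4 * (I.p + I.p)      ≡⟨ double I.p ⟩
      I.p * 8              ∎)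
      where
      double : ∀ p → 4 * (p + p) ≡ p * 8
      double = solve-∀

Kᵍ : ℕ
Kᵍ = proj₁ growth

growth-bound : ∀ n → n * n * 4 ^ n ≤ Kᵍ * (n / 8) !
growth-bound = proj₂ growth

square≤growth : ∀ n → n * n ≤ Kᵍ * (n / 8) !
square≤growth n = ≤-trans (≤-reflexive (sym (*-identityʳ (n * n)))) (≤-trans (*-monoʳ-≤ (n * n) (ℕₚ.m^n>0 4 n)) (growth-bound n))

-- The mean square needs a companion for each single z: it bounds f for every nontrivial pair, and
-- thereby f₂ and f₃ whenever the pair of squares or of cubes is nontrivial.
centralizer-max : ∀ {n} {z : Perm n} → z ∈ Sym n → z ≢ ε → n * n * #centralizer z ≤ (240 + Kᵍ) * n !
centralizer-max {n} {z} z∈ z≢ε with n <? 4 * t# z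
... | yes n<4t = begin
  n * n * c                  ≤⟨ *-monoˡ-≤ c (square≤growth n) ⟩
  Kᵍ * (n / 8) ! * c         ≡⟨ regroup Kᵍ ((n / 8) !) c ⟩
  Kᵍ * (c * (n / 8) !)       ≤⟨ *-monoʳ-≤ Kᵍ (large-support z∈ n<4t) ⟩
  Kᵍ * n !                   ≤⟨ *-monoˡ-≤ (n !) (m≤n+m Kᵍ 240) ⟩
  (240 + Kᵍ) * n !           ∎
  where
  open ≤-Reasoning
  c = #centralizer z
  regroup : ∀ k q c → k * q * c ≡ k * (c * q)
  regroup = solve-∀
... | no ¬n<4t = begin
  n * n * c                            ≤⟨ *-monoʳ-≤ (n * n) c≤ ⟩
  n * n * (F.f ! * (t ! * 2 ^ t))      ≤⟨ small (ℕₚ.m≤n⇒m<n∨m≡n (2≤t z≢ε)) ⟩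
  240 * n !                            ≤⟨ *-monoˡ-≤ (n !) (m≤m+n 240 Kᵍ) ⟩
  (240 + Kᵍ) * n !                     ∎
  where
  open ≤-Reasoning
  open Centralizer z∈
  c = #centralizer z
  c≤ : c ≤ F.f ! * (t ! * 2 ^ t)
  c≤ = begin
    c                          ≡⟨ *-identityʳ c ⟨
    c * 1                      ≤⟨ *-monoʳ-≤ c (ℕₚ.1≤n! I.p) ⟩
    c * I.p !                  ≤⟨ #centralizer-≤ ⟩
    F.f ! * t !                ≤⟨ *-monoʳ-≤ (F.f !) (≤-trans (≤-reflexive (sym (*-identityʳ (t !)))) (*-monoʳ-≤ (t !) (ℕₚ.m^n>0 2 t))) ⟩
    F.f ! * (t ! * 2 ^ t)      ∎
  small : 3 ≤ t ⊎ 2 ≡ t → n * n * (F.f ! * (t ! * 2 ^ t)) ≤ 240 * n !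
  small (inj₂ 2≡t) = ≤-trans
    (subst₂ (λ s m → m * m * (F.f ! * (s ! * 2 ^ s)) ≤ 16 * m !) 2≡t (≡-trans (cong (F.f +_) 2≡t) f+t≡n) (small-support₂ F.f))
    (*-monoˡ-≤ (n !) (m≤m+n 16 224))
  small (inj₁ 3≤t) = ≤-trans (*-monoˡ-≤ (F.f ! * (t ! * 2 ^ t)) (ℕₚ.m≤m*n (n * n) n {{>-nonZero 1≤n}}))
    (subst (λ m → m * m * m * (F.f ! * (t ! * 2 ^ t)) ≤ 240 * m !) f+t≡n
      (small-support₃ t F.f 3≤t (≤-trans (ℕₚ.≮⇒≥ ¬n<4t) (≤-reflexive (sym f+t≡n)))))
    where
    1≤n : 1 ≤ n
    1≤n = ≤-trans (≤-trans (s≤s z≤n) 3≤t) (≤-trans (m≤n+m t F.f) (≤-reflexive f+t≡n))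

module SquareSum (n : ℕ) where

  medium? : ∀ t → Dec (3 ≤ t × 4 * t ≤ n)
  medium? t = (3 ≤? t) ×-dec (4 * t ≤? n)

  -- Supports of size two are kept apart: they have the true order n!² / n², with no power of n to
  -- spare for a sum over t. The other two ranges meet at 4t = n, the limit of `small-support-step`.
  A₂ A₃ A∞ : ℕ
  A₂ = ∑ (Sym n) (λ z → 𝟙 (t# z ≟ℕ 2) * c² z)
  A₃ = ∑ (Sym n) (λ z → 𝟙 (medium? (t# z)) * c² z)
  A∞ = ∑ (Sym n) (λ z → 𝟙 (n <? 4 * t# z) * c² z)

  t#≤n : ∀ z → t# z ≤ n
  t#≤n z = ≤-trans (Listₚ.length-filter (moved? z) (allFin n)) (≤-reflexive (length-allFin n))

  A₂-bound : n * n * A₂ ≤ 16 * (n ! * n !)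
  A₂-bound with 2 ≤? n
  ... | yes 2≤n with ℕₚ.m≤n⇒∃[o]m+o≡n 2≤n
  ...   | f , refl = begin
    n * n * A₂                              ≤⟨ *-monoʳ-≤ (n * n) (square-sum-at f 2 (+-comm f 2)) ⟩
    n * n * (n ! * (f ! * 8))               ≡⟨ *-exchange (n * n) (n !) (f ! * 8) ⟩
    n ! * (n * n * (f ! * 8))               ≤⟨ *-monoʳ-≤ (n !) (subst (λ m → m * m * (f ! * 8) ≤ 16 * m !) (+-comm f 2) (small-support₂ f)) ⟩
    n ! * (16 * n !)                        ≡⟨ *-exchange (n !) 16 (n !) ⟩
    16 * (n ! * n !)                        ∎
    where
    open ≤-Reasoning
  A₂-bound | no ¬2≤n = ≤-trans (≤-reflexive (≡-trans (cong (n * n *_) (∑-0 (Sym n) (λ {z} _ →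
      cong (_* c² z) (𝟙-no (t# z ≟ℕ 2) (λ eq → ¬2≤n (subst (_≤ n) eq (t#≤n z))))))) (*-zeroʳ (n * n)))) z≤n

  A₃-fibres : A₃ ≤ ∑ (upTo (suc n)) (λ t → 𝟙 (medium? t) * ∑ (Sym n) (λ z → 𝟙 (t# z ≟ℕ t) * c² z))
  A₃-fibres = begin
    ∑ (Sym n) (λ z → 𝟙 (medium? (t# z)) * c² z)
      ≤⟨ ∑-mono (Sym n) (λ {z} _ → pick z) ⟩
    ∑ (Sym n) (λ z → ∑ (upTo (suc n)) (λ t → 𝟙 (medium? t) * (𝟙 (t# z ≟ℕ t) * c² z)))
      ≡⟨ ∑-swap (λ z t → 𝟙 (medium? t) * (𝟙 (t# z ≟ℕ t) * c² z)) (Sym n) (upTo (suc n)) ⟩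
    ∑ (upTo (suc n)) (λ t → ∑ (Sym n) (λ z → 𝟙 (medium? t) * (𝟙 (t# z ≟ℕ t) * c² z)))
      ≡⟨ ∑-cong (upTo (suc n)) (λ {t} _ → ∑-*ˡ (𝟙 (medium? t)) (λ z → 𝟙 (t# z ≟ℕ t) * c² z) (Sym n)) ⟩
    ∑ (upTo (suc n)) (λ t → 𝟙 (medium? t) * ∑ (Sym n) (λ z → 𝟙 (t# z ≟ℕ t) * c² z)) ∎
    where
    open ≤-Reasoning
    pick : ∀ z → 𝟙 (medium? (t# z)) * c² z ≤ ∑ (upTo (suc n)) (λ t → 𝟙 (medium? t) * (𝟙 (t# z ≟ℕ t) * c² z))
    pick z = ≤-trans (≤-reflexive (cong (𝟙 (medium? (t# z)) *_) (sym (≡-trans (cong (_* c² z) (𝟙-yes (t# z ≟ℕ t# z) refl)) (+-identityʳ (c² z))))))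
      (∑-∈ {f = λ t → 𝟙 (medium? t) * (𝟙 (t# z ≟ℕ t) * c² z)} (∈ₚ.∈-upTo⁺ (s≤s (t#≤n z))))

  fibre-bound : ∀ t → n * n * n * (𝟙 (medium? t) * ∑ (Sym n) (λ z → 𝟙 (t# z ≟ℕ t) * c² z)) ≤ 240 * (n ! * n !)
  fibre-bound t = ≤-trans (≤-reflexive (*-exchange (n * n * n) (𝟙 (medium? t)) _)) (𝟙*-≤ (medium? t) bound)
    where
    open ≤-Reasoning
    bound : 3 ≤ t × 4 * t ≤ n → n * n * n * ∑ (Sym n) (λ z → 𝟙 (t# z ≟ℕ t) * c² z) ≤ 240 * (n ! * n !)
    bound (3≤t , 4t≤n) with ℕₚ.m≤n⇒∃[o]m+o≡n (≤-trans (m≤m+n t (3 * t)) 4t≤n)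
    ... | f , t+f≡n = begin
      n * n * n * ∑ (Sym n) (λ z → 𝟙 (t# z ≟ℕ t) * c² z)
        ≤⟨ *-monoʳ-≤ (n * n * n) (square-sum-at f t f+t≡n) ⟩
      n * n * n * (n ! * (f ! * (t ! * 2 ^ t)))
        ≡⟨ *-exchange (n * n * n) (n !) (f ! * (t ! * 2 ^ t)) ⟩
      n ! * (n * n * n * (f ! * (t ! * 2 ^ t)))
        ≤⟨ *-monoʳ-≤ (n !) (subst (λ m → m * m * m * (f ! * (t ! * 2 ^ t)) ≤ 240 * m !) f+t≡n
             (small-support₃ t f 3≤t (≤-trans 4t≤n (≤-reflexive (sym f+t≡n))))) ⟩
      n ! * (240 * n !)
        ≡⟨ *-exchange (n !) 240 (n !) ⟩
      240 * (n ! * n !) ∎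
      where
      f+t≡n : f + t ≡ n
      f+t≡n = ≡-trans (+-comm f t) t+f≡n

  -- At most n + 1 ≤ 2n values of t contribute, each with a saving of n³; hence 480 = 2 · 240.
  A₃-bound : n * n * A₃ ≤ 480 * (n ! * n !)
  A₃-bound with n ≟ℕ 0
  ... | yes refl = z≤n
  ... | no n≢0 = ℕₚ.*-cancelʳ-≤ _ _ n {{≢-nonZero n≢0}} (begin
    n * n * A₃ * n          ≡⟨ regroup n A₃ ⟩
    n * n * n * A₃          ≤⟨ *-monoʳ-≤ (n * n * n) A₃-fibres ⟩
    n * n * n * ∑ (upTo (suc n)) G   ≡⟨ ∑-*ˡ (n * n * n) G (upTo (suc n)) ⟨
    ∑ (upTo (suc n)) (λ t → n * n * n * G t)   ≤⟨ ∑-≤-const (240 * (n ! * n !)) (upTo (suc n)) (λ {t} _ → fibre-bound t) ⟩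
    length (upTo (suc n)) * (240 * (n ! * n !))  ≡⟨ cong (_* (240 * (n ! * n !))) (Listₚ.length-upTo (suc n)) ⟩
    (1 + n) * (240 * (n ! * n !))     ≤⟨ *-monoˡ-≤ (240 * (n ! * n !)) (+-monoˡ-≤ n (ℕₚ.n≢0⇒n>0 n≢0)) ⟩
    (n + n) * (240 * (n ! * n !))     ≡⟨ regroup′ n (n ! * n !) ⟩
    480 * (n ! * n !) * n             ∎)
    where
    open ≤-Reasoning
    G : ℕ → ℕ
    G t = 𝟙 (medium? t) * ∑ (Sym n) (λ z → 𝟙 (t# z ≟ℕ t) * c² z)
    regroup : ∀ n a → n * n * a * n ≡ n * n * n * a
    regroup = solve-∀
    regroup′ : ∀ n x → (n + n) * (240 * x) ≡ 480 * x * n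
    regroup′ = solve-∀

  A∞-bound : n * n * A∞ ≤ Kᵍ * (n ! * n !)
  A∞-bound = ℕₚ.*-cancelʳ-≤ _ _ ((n / 8) !) {{(n / 8) ℕₚ.!≢0}} (begin
    n * n * A∞ * (n / 8) !
      ≡⟨ *-assoc (n * n) A∞ ((n / 8) !) ⟩
    n * n * (A∞ * (n / 8) !)
      ≤⟨ *-monoʳ-≤ (n * n) inner ⟩
    n * n * (n ! * (4 ^ n * n !))
      ≡⟨ regroup (n * n) (n !) (4 ^ n) ⟩
    n * n * 4 ^ n * (n ! * n !)
      ≤⟨ *-monoˡ-≤ (n ! * n !) (growth-bound n) ⟩
    Kᵍ * (n / 8) ! * (n ! * n !)
      ≡⟨ regroup′ Kᵍ ((n / 8) !) (n ! * n !) ⟩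
    Kᵍ * (n ! * n !) * (n / 8) ! ∎)
    where
    open ≤-Reasoning
    regroup : ∀ a b c → a * (b * (c * b)) ≡ a * c * (b * b)
    regroup = solve-∀
    regroup′ : ∀ a b c → a * b * c ≡ a * c * b
    regroup′ = solve-∀
    each : ∀ {z} → z ∈ Sym n → (d : Dec (n < 4 * t# z)) → 𝟙 d * c² z * (n / 8) ! ≤ n ! * #centralizer z
    each z∈ (no _) = z≤n
    each {z} z∈ (yes lt) = begin
      (c * c + 0) * (n / 8) !    ≡⟨ cong (_* (n / 8) !) (+-identityʳ (c * c)) ⟩
      c * c * (n / 8) !          ≡⟨ *-assoc c c ((n / 8) !) ⟩
      c * (c * (n / 8) !)        ≤⟨ *-monoʳ-≤ c (large-support z∈ lt) ⟩
      c * n !                    ≡⟨ *-comm c (n !) ⟩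
      n ! * c                    ∎
      where
      c : ℕ
      c = #centralizer z
    inner : A∞ * (n / 8) ! ≤ n ! * (4 ^ n * n !)
    inner = begin
      A∞ * (n / 8) !     ≡⟨ ∑-*ʳ (λ z → 𝟙 (n <? 4 * t# z) * c² z) ((n / 8) !) (Sym n) ⟨
      ∑ (Sym n) (λ z → 𝟙 (n <? 4 * t# z) * c² z * (n / 8) !)  ≤⟨ ∑-mono (Sym n) (λ {z} z∈ → each z∈ (n <? 4 * t# z)) ⟩
      ∑ (Sym n) (λ z → n ! * #centralizer z)    ≡⟨ ∑-*ˡ (n !) #centralizer (Sym n) ⟩
      n ! * ∑ (Sym n) #centralizer              ≤⟨ *-monoʳ-≤ (n !) (commuting-pairs n) ⟩
      n ! * (4 ^ n * n !)                       ∎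

  centralizer-square-sum : n * n * ∑ (Sym n) (λ z → 𝟙 (¬? (z ≟P ε)) * c² z) ≤ (496 + Kᵍ) * (n ! * n !)
  centralizer-square-sum = begin
    n * n * ∑ (Sym n) (λ z → 𝟙 (¬? (z ≟P ε)) * c² z)
      ≤⟨ *-monoʳ-≤ (n * n) (∑-mono (Sym n) (λ {z} z∈ → 𝟙*-≤ (¬? (z ≟P ε)) (cases z∈))) ⟩
    n * n * ∑ (Sym n) (λ z → B₂ z + (B₃ z + B∞ z))
      ≡⟨ cong (n * n *_) (≡-trans (∑-+ B₂ (λ z → B₃ z + B∞ z) (Sym n)) (cong (A₂ +_) (∑-+ B₃ B∞ (Sym n)))) ⟩
    n * n * (A₂ + (A₃ + A∞))
      ≡⟨ expand (n * n) A₂ A₃ A∞ ⟩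
    n * n * A₂ + (n * n * A₃ + n * n * A∞)
      ≤⟨ +-mono-≤ A₂-bound (+-mono-≤ A₃-bound A∞-bound) ⟩
    16 * (n ! * n !) + (480 * (n ! * n !) + Kᵍ * (n ! * n !))
      ≡⟨ collect Kᵍ (n ! * n !) ⟩
    (496 + Kᵍ) * (n ! * n !) ∎
    where
    open ≤-Reasoning
    B₂ B₃ B∞ : Perm n → ℕ
    B₂ z = 𝟙 (t# z ≟ℕ 2) * c² z
    B₃ z = 𝟙 (medium? (t# z)) * c² z
    B∞ z = 𝟙 (n <? 4 * t# z) * c² z
    expand : ∀ n a b c → n * (a + (b + c)) ≡ n * a + (n * b + n * c)
    expand = solve-∀
    collect : ∀ k x → 16 * x + (480 * x + k * x) ≡ (496 + k) * x
    collect = solve-∀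
    is : ∀ {P : Set} (d : Dec P) c → P → c ≤ 𝟙 d * c
    is d c p = ≤-reflexive (sym (≡-trans (cong (_* c) (𝟙-yes d p)) (+-identityʳ c)))
    cases : ∀ {z} → z ∈ Sym n → z ≢ ε → c² z ≤ B₂ z + (B₃ z + B∞ z)
    cases {z} z∈ z≢ε with n <? 4 * t# z in eq
    ... | yes lt = ≤-trans (≤-reflexive (sym (+-identityʳ (c² z)))) (≤-trans (m≤n+m _ (B₃ z)) (m≤n+m _ (B₂ z)))
    ... | no ¬lt with ℕₚ.m≤n⇒m<n∨m≡n (Centralizer.2≤t z∈ z≢ε)
    ...   | inj₁ 3≤t = ≤-trans (is (medium? (t# z)) (c² z) (3≤t , ℕₚ.≮⇒≥ ¬lt)) (≤-trans (m≤m+n (B₃ z) _) (m≤n+m _ (B₂ z)))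
    ...   | inj₂ 2≡t = ≤-trans (is (t# z ≟ℕ 2) (c² z) (sym 2≡t)) (m≤m+n (B₂ z) _)

-- Permutations with prescribed values

module Prescribed (n : ℕ) where
  open Arrangements (_≟F_ {n})
  open import Data.List.Membership.DecPropositional (_≟F_ {n}) using (_∈?_)
  open import Data.List.Relation.Unary.Unique.DecPropositional (_≟F_ {n}) using (unique?)

  -- Distinctness of the sources belongs to the predicate: the sums below run over all a and b, and
  -- in degenerate cases a list would impose fewer conditions than it has entries. Its count is then
  -- zero.
  Sends : List (Fin n × Fin n) → Perm n → Set
  Sends ps x = Unique (map proj₁ ps) × All (λ ab → lookup x (proj₁ ab) ≡ proj₂ ab) ps

  sends? : ∀ ps x → Dec (Sends ps x)
  sends? ps x = unique? (map proj₁ ps) ×-dec All.all? (λ ab → lookup x (proj₁ ab) ≟F proj₂ ab) ps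

  #sends : List (Fin n × Fin n) → ℕ
  #sends ps = ∑ (Sym n) (λ x → 𝟙 (sends? ps x))

  targets : (x : Perm n) (ps : List (Fin n × Fin n)) → All (λ ab → lookup x (proj₁ ab) ≡ proj₂ ab) ps → map proj₂ ps ≡ map (lookup x) (map proj₁ ps)
  targets x []       []         = refl
  targets x (_ ∷ ps) (eq ∷ eqs) = cong₂ _∷_ (sym eq) (targets x ps eqs)

  #sends-≤ : ∀ ps c → length ps + c ≡ n → #sends ps ≤ c !
  #sends-≤ ps c len with unique? (map proj₂ ps)
  ... | no ¬u = ≤-trans (≤-reflexive (∑-0 (Sym n) (λ {x} x∈ → 𝟙-no (sends? ps x)
    (λ { (u , eqs) → ¬u (subst Unique (sym (targets x ps eqs)) (Uniqueₚ.map⁺ (∈-Sym⁻ x∈) u)) })))) z≤n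
  ... | yes u₂ = ≤-trans
    (count-injection (Listₚ.≡-dec _≟F_) {ys = arrangements c free₂} (Unique-Sym n) (sends? ps) (λ x → map (lookup x) free₁) into inj)
    size
    where
    as bs free₁ free₂ : List (Fin n)
    as = map proj₁ ps
    bs = map proj₂ ps
    free₁ = filter (¬? ∘ (_∈? as)) (allFin n)
    free₂ = filter (¬? ∘ (_∈? bs)) (allFin n)
    count-free : ∀ {l} → Unique l → length l ≡ length ps → length (filter (¬? ∘ (_∈? l)) (allFin n)) ≡ c
    count-free {l} u eq = ℕₚ.+-cancelˡ-≡ (length ps) _ _ (≡-trans (cong (_+ length (filter (¬? ∘ (_∈? l)) (allFin n))) (sym eq))
      (≡-trans (filter-∉-length _≟F_ (Uniqueₚ.allFin⁺ n) u (λ _ → ∈ₚ.∈-allFin _)) (≡-trans (length-allFin n) (sym len))))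
    ∣free₂∣ : length free₂ ≡ c
    ∣free₂∣ = count-free u₂ (Listₚ.length-map proj₂ ps)
    size : length (arrangements c free₂) ≤ c !
    size = ≤-reflexive (subst (λ m → length (arrangements m free₂) ≡ m !) ∣free₂∣
      (length-arrangements-all free₂ (Uniqueₚ.filter⁺ (¬? ∘ (_∈? bs)) (Uniqueₚ.allFin⁺ n))))
    into : ∀ {x} → x ∈ Sym n → Sends ps x → map (lookup x) free₁ ∈ arrangements c free₂
    into {x} x∈ (u₁ , eqs) = subst (λ m → map (lookup x) free₁ ∈ arrangements m free₂)
      (≡-trans (Listₚ.length-map (lookup x) free₁) (count-free u₁ (Listₚ.length-map proj₁ ps)))
      (∈-arrangements (Uniqueₚ.map⁺ (∈-Sym⁻ x∈) (Uniqueₚ.filter⁺ (¬? ∘ (_∈? as)) (Uniqueₚ.allFin⁺ n)))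
        (λ y∈ → let (i , i∈ , eq) = ∈ₚ.∈-map⁻ _ y∈ in subst (_∈ free₂) (sym eq)
          (∈ₚ.∈-filter⁺ (¬? ∘ (_∈? bs)) (∈ₚ.∈-allFin _) (λ xi∈ →
            let (j , j∈ , eq′) = ∈ₚ.∈-map⁻ _ (subst (lookup x i ∈_) (targets x ps eqs) xi∈) in
            proj₂ (∈ₚ.∈-filter⁻ (¬? ∘ (_∈? as)) {xs = allFin n} i∈) (subst (_∈ as) (sym (∈-Sym⁻ x∈ eq′)) j∈)))))
    inj : ∀ {x y} → x ∈ Sym n → y ∈ Sym n → Sends ps x → Sends ps y → map (lookup x) free₁ ≡ map (lookup y) free₁ → x ≡ y
    inj {x} {y} _ _ (_ , ex) (_ , ey) eq = lookup-ext at
      where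
      at : ∀ i → lookup x i ≡ lookup y i
      at i with i ∈? as
      ... | no i∉ = map-agree free₁ eq (∈ₚ.∈-filter⁺ (¬? ∘ (_∈? as)) (∈ₚ.∈-allFin i) i∉)
      ... | yes i∈ = map-agree as (≡-trans (sym (targets x ps ex)) (targets y ps ey)) i∈

module _ {n : ℕ} where

  square cube : Perm n → Perm n
  square g = g · g
  cube g = g · (g · g)

  lookup-square : ∀ {g} → square g ≡ ε → ∀ i → lookup g (lookup g i) ≡ i
  lookup-square {g} eq i = ≡-trans (sym (lookup-· g g i)) (≡-trans (cong (λ w → lookup w i) eq) (lookup-ε i))

  lookup-cube : ∀ {g} → cube g ≡ ε → ∀ i → lookup g (lookup g (lookup g i)) ≡ i
  lookup-cube {g} eq i = ≡-trans (cong (lookup g) (sym (lookup-· g g i))) (≡-trans (sym (lookup-· g (g · g) i))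
    (≡-trans (cong (λ w → lookup w i) eq) (lookup-ε i)))

I₂ I₃ : ℕ → ℕ
I₂ n = ∑ (Sym n) (λ g → 𝟙 (square g ≟P ε))
I₃ n = ∑ (Sym n) (λ g → 𝟙 (cube g ≟P ε))

count≤! : ∀ {n} {P : Perm n → Set} (P? : Decidable P) → ∑ (Sym n) (λ x → 𝟙 (P? x)) ≤ n !
count≤! {n} P? = ≤-trans (∑-≤-const 1 (Sym n) (λ {x} _ → 𝟙≤1 (P? x))) (≤-reflexive (≡-trans (*-identityʳ _) (length-Sym n)))

term≤∑ : ∀ {n} (f : Fin n → ℕ) i → f i ≤ ∑ (allFin n) f
term≤∑ f i = ∑-∈ {f = f} (∈ₚ.∈-allFin i)

∑-Fin-≤ : ∀ {n} (f : Fin n → ℕ) c → (∀ i → f i ≤ c) → ∑ (allFin n) f ≤ n * c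
∑-Fin-≤ {n} f c h = ≤-trans (∑-≤-const c (allFin n) (λ {i} _ → h i)) (≤-reflexive (cong (_* c) (length-allFin n)))

-- Follow the point 0: it is fixed or lies on a 3-cycle 0, a, b. This gives (n - 1)! + n² (n - 3)!,
-- and 6 = 1 + 5. A saving of n suffices, since the number is squared in the sum over pairs.
I₃-bound : ∀ n → n * I₃ n ≤ 6 * n !
I₃-bound zero = z≤n
I₃-bound (suc zero) = ≤-trans (≤-reflexive (*-identityˡ (I₃ 1))) (≤-trans (count≤! {1} (λ g → cube g ≟P ε)) (m≤m+n 1 5))
I₃-bound (suc (suc zero)) = ≤-trans (*-monoʳ-≤ 2 (count≤! {2} (λ g → cube g ≟P ε))) (m≤m+n 4 8)
I₃-bound (suc (suc (suc m))) = begin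
  n * I₃ n                                            ≤⟨ *-monoʳ-≤ n (∑-mono (Sym n) (λ {g} g∈ → 𝟙-≤ (cube g ≟P ε) (cases g∈))) ⟩
  n * ∑ (Sym n) (λ g → E₀ g + ∑ (allFin n) (λ a → ∑ (allFin n) (λ b → E a b g)))
    ≡⟨ cong (n *_) (≡-trans (∑-+ E₀ _ (Sym n)) (cong (∑ (Sym n) E₀ +_)
         (≡-trans (∑-swap _ (Sym n) (allFin n)) (∑-cong (allFin n) (λ {a} _ → ∑-swap (λ g b → E a b g) (Sym n) (allFin n)))))) ⟩
  n * (∑ (Sym n) E₀ + ∑ (allFin n) (λ a → ∑ (allFin n) (λ b → ∑ (Sym n) (E a b))))
    ≤⟨ *-monoʳ-≤ n (+-mono-≤ (#sends-≤ ((zero , zero) ∷ []) (2 + m) refl)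
         (∑-Fin-≤ _ _ (λ a → ∑-Fin-≤ _ _ (λ b → #sends-≤ ((zero , a) ∷ (a , b) ∷ (b , zero) ∷ []) m refl)))) ⟩
  n * ((2 + m) ! + n * (n * m !))                     ≡⟨ expand n ((2 + m) !) (m !) ⟩
  n ! + n * n * n * m !                               ≤⟨ +-monoʳ-≤ (n !) (cube*!≤ m) ⟩
  n ! + 5 * n !                                       ≡⟨⟩
  6 * n !                                             ∎
  where
  open ≤-Reasoning
  n : ℕ
  n = 3 + m
  open Prescribed n
  E₀ : Perm n → ℕ
  E₀ g = 𝟙 (sends? ((zero , zero) ∷ []) g)
  E : Fin n → Fin n → Perm n → ℕ
  E a b g = 𝟙 (sends? ((zero , a) ∷ (a , b) ∷ (b , zero) ∷ []) g)
  expand : ∀ n x y → n * (x + n * (n * y)) ≡ n * x + n * n * n * y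
  expand = solve-∀
  cases : ∀ {g} → g ∈ Sym n → cube g ≡ ε → 1 ≤ E₀ g + ∑ (allFin n) (λ a → ∑ (allFin n) (λ b → E a b g))
  cases {g} g∈ eq = split (lookup g zero ≟F zero)
    where
    a b : Fin n
    a = lookup g zero
    b = lookup g a
    hit : ∀ ps → Sends ps g → 1 ≤ 𝟙 (sends? ps g)
    hit ps s = ≤-reflexive (sym (𝟙-yes (sends? ps g) s))
    split : Dec (a ≡ zero) → 1 ≤ E₀ g + ∑ (allFin n) (λ a → ∑ (allFin n) (λ b → E a b g))
    split (yes fx) = ≤-trans (hit ((zero , zero) ∷ []) ([] ∷ [] , fx ∷ [])) (m≤m+n (E₀ g) _)
    split (no mv) = ≤-trans (hit ((zero , a) ∷ (a , b) ∷ (b , zero) ∷ [])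
        (((λ q → mv (sym q)) ∷ (λ q → 0≢b (sym q)) ∷ []) ∷ ((λ q → mv (∈-Sym⁻ g∈ (sym q))) ∷ []) ∷ [] ∷ [] ,
         refl ∷ refl ∷ lookup-cube {g = g} eq zero ∷ []))
      (≤-trans (term≤∑ (λ b → E a b g) b) (≤-trans (term≤∑ (λ a → ∑ (allFin n) (λ b → E a b g)) a) (m≤n+m _ (E₀ g))))
      where
      0≢b : b ≢ zero
      0≢b q = mv (≡-trans (cong (lookup g) (sym q)) (lookup-cube {g = g} eq zero))

-- Follow the points 0 and 1: both fixed, exchanged, one fixed and the other on a 2-cycle, or on two
-- different 2-cycles. Two points are needed because in the sum of f f₂ the number `I₂ n` enters
-- only to the first power and must supply the full n².
I₂-bound : ∀ n → n * n * I₂ n ≤ 21 * n !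
I₂-bound zero = z≤n
I₂-bound (suc zero) = ≤-trans (*-monoʳ-≤ 1 (count≤! {1} (λ g → square g ≟P ε))) (m≤m+n 1 20)
I₂-bound (suc (suc zero)) = ≤-trans (*-monoʳ-≤ 4 (count≤! {2} (λ g → square g ≟P ε))) (m≤m+n 8 34)
I₂-bound (suc (suc (suc zero))) = ≤-trans (*-monoʳ-≤ 9 (count≤! {3} (λ g → square g ≟P ε))) (m≤m+n 54 72)
I₂-bound (suc (suc (suc (suc m)))) = begin
  n * n * I₂ n
    ≤⟨ *-monoʳ-≤ (n * n) (∑-mono (Sym n) (λ {g} g∈ → 𝟙-≤ (square g ≟P ε) (cases g∈))) ⟩
  n * n * ∑ (Sym n) (λ g → E₁ g + (E₂ g + (∑ (allFin n) (λ b → E₃ b g) + (∑ (allFin n) (λ a → E₄ a g) + ∑ (allFin n) (λ a → ∑ (allFin n) (λ b → E₅ a b g))))))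
    ≡⟨ cong (n * n *_) (≡-trans (∑-+ E₁ _ (Sym n)) (cong (∑ (Sym n) E₁ +_) (≡-trans (∑-+ E₂ _ (Sym n)) (cong (∑ (Sym n) E₂ +_)
        (≡-trans (∑-+ (λ g → ∑ (allFin n) (λ b → E₃ b g)) _ (Sym n)) (cong₂ _+_ (∑-swap (λ g b → E₃ b g) (Sym n) (allFin n))
          (≡-trans (∑-+ (λ g → ∑ (allFin n) (λ a → E₄ a g)) _ (Sym n)) (cong₂ _+_ (∑-swap (λ g a → E₄ a g) (Sym n) (allFin n))
            (≡-trans (∑-swap (λ g a → ∑ (allFin n) (λ b → E₅ a b g)) (Sym n) (allFin n)) (∑-cong (allFin n) (λ {a} _ → ∑-swap (λ g b → E₅ a b g) (Sym n) (allFin n)))))))))))) ⟩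
  n * n * (#sends P₁ + (#sends P₂ + (∑ (allFin n) (λ b → #sends (P₃ b)) + (∑ (allFin n) (λ a → #sends (P₄ a)) + ∑ (allFin n) (λ a → ∑ (allFin n) (λ b → #sends (P₅ a b)))))))
    ≤⟨ *-monoʳ-≤ (n * n) (+-mono-≤ (#sends-≤ P₁ (2 + m) refl) (+-mono-≤ (#sends-≤ P₂ (2 + m) refl)
         (+-mono-≤ (∑-Fin-≤ _ _ (λ b → #sends-≤ (P₃ b) (1 + m) refl)) (+-mono-≤ (∑-Fin-≤ _ _ (λ a → #sends-≤ (P₄ a) (1 + m) refl))
           (∑-Fin-≤ _ _ (λ a → ∑-Fin-≤ _ _ (λ b → #sends-≤ (P₅ a b) m refl))))))) ⟩
  n * n * ((2 + m) ! + ((2 + m) ! + (n * (1 + m) ! + (n * (1 + m) ! + n * (n * m !)))))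
    ≤⟨ m≤m+n _ (n * (16 * (m * (m * m)) + 82 * (m * m) + 107 * m + 14) * m !) ⟩
  n * n * ((2 + m) ! + ((2 + m) ! + (n * (1 + m) ! + (n * (1 + m) ! + n * (n * m !))))) + n * (16 * (m * (m * m)) + 82 * (m * m) + 107 * m + 14) * m !
    ≡⟨ identity m (m !) ⟩
  21 * n ! ∎
  where
  open ≤-Reasoning
  n : ℕ
  n = 4 + m
  open Prescribed n
  identity : ∀ m x → (4 + m) * (4 + m) * ((2 + m) * ((1 + m) * x) + ((2 + m) * ((1 + m) * x) + ((4 + m) * ((1 + m) * x) + ((4 + m) * ((1 + m) * x) + (4 + m) * ((4 + m) * x)))))
             + (4 + m) * (16 * (m * (m * m)) + 82 * (m * m) + 107 * m + 14) * x
             ≡ 21 * ((4 + m) * ((3 + m) * ((2 + m) * ((1 + m) * x))))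
  identity = solve-∀
  one : Fin n
  one = suc zero
  P₁ P₂ : List (Fin n × Fin n)
  P₁ = (zero , zero) ∷ (one , one) ∷ []
  P₂ = (zero , one) ∷ (one , zero) ∷ []
  P₃ P₄ : Fin n → List (Fin n × Fin n)
  P₃ b = (zero , zero) ∷ (one , b) ∷ (b , one) ∷ []
  P₄ a = (one , one) ∷ (zero , a) ∷ (a , zero) ∷ []
  P₅ : Fin n → Fin n → List (Fin n × Fin n)
  P₅ a b = (zero , a) ∷ (one , b) ∷ (a , zero) ∷ (b , one) ∷ []
  E₁ E₂ : Perm n → ℕ
  E₁ g = 𝟙 (sends? P₁ g)
  E₂ g = 𝟙 (sends? P₂ g)
  E₃ E₄ : Fin n → Perm n → ℕ
  E₃ b g = 𝟙 (sends? (P₃ b) g)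
  E₄ a g = 𝟙 (sends? (P₄ a) g)
  E₅ : Fin n → Fin n → Perm n → ℕ
  E₅ a b g = 𝟙 (sends? (P₅ a b) g)
  0≢1 : zero ≢ one
  0≢1 ()
  hit : ∀ g ps → Sends ps g → 1 ≤ 𝟙 (sends? ps g)
  hit g ps s = ≤-reflexive (sym (𝟙-yes (sends? ps g) s))
  module _ {g : Perm n} (g∈ : g ∈ Sym n) (sq : ∀ i → lookup g (lookup g i) ≡ i) where
    a b : Fin n
    a = lookup g zero
    b = lookup g one
    s₃ s₄ s₅ : ℕ
    s₃ = ∑ (allFin n) (λ b → E₃ b g)
    s₄ = ∑ (allFin n) (λ a → E₄ a g)
    s₅ = ∑ (allFin n) (λ a → ∑ (allFin n) (λ b → E₅ a b g))
    a≢b : a ≢ b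
    a≢b q = 0≢1 (∈-Sym⁻ g∈ q)
    split : Dec (a ≡ zero) → Dec (b ≡ one) → Dec (a ≡ one) → 1 ≤ E₁ g + (E₂ g + (s₃ + (s₄ + s₅)))
    split (yes a0) (yes b1) _ = ≤-trans (hit g P₁ ((0≢1 ∷ []) ∷ [] ∷ [] , a0 ∷ b1 ∷ [])) (m≤m+n (E₁ g) _)
    split (yes a0) (no b≢1) _ = ≤-trans (hit g (P₃ b) ((0≢1 ∷ (λ q → a≢b (≡-trans a0 q)) ∷ []) ∷ ((λ q → b≢1 (sym q)) ∷ []) ∷ [] ∷ [] , a0 ∷ refl ∷ sq one ∷ []))
      (≤-trans (term≤∑ (λ b → E₃ b g) b) (≤-trans (m≤m+n s₃ _) (≤-trans (m≤n+m _ (E₂ g)) (m≤n+m _ (E₁ g)))))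
    split (no a≢0) (yes b1) _ = ≤-trans (hit g (P₄ a) (((λ ()) ∷ (λ q → a≢b (≡-trans (sym q) (sym b1))) ∷ []) ∷ ((λ q → a≢0 (sym q)) ∷ []) ∷ [] ∷ [] , b1 ∷ refl ∷ sq zero ∷ []))
      (≤-trans (term≤∑ (λ a → E₄ a g) a) (≤-trans (m≤m+n s₄ _) (≤-trans (m≤n+m _ s₃) (≤-trans (m≤n+m _ (E₂ g)) (m≤n+m _ (E₁ g))))))
    split (no a≢0) (no b≢1) (yes a1) = ≤-trans (hit g P₂ ((0≢1 ∷ []) ∷ [] ∷ [] , a1 ∷ ≡-trans (cong (lookup g) (sym a1)) (sq zero) ∷ []))
      (≤-trans (m≤m+n (E₂ g) _) (m≤n+m _ (E₁ g)))
    split (no a≢0) (no b≢1) (no a≢1) = ≤-trans (hit g (P₅ a b)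
      ((0≢1 ∷ (λ q → a≢0 (sym q)) ∷ (λ q → a≢1 (≡-trans (cong (lookup g) q) (sq one))) ∷ []) ∷
       ((λ q → a≢1 (sym q)) ∷ (λ q → b≢1 (sym q)) ∷ []) ∷ (a≢b ∷ []) ∷ [] ∷ [] , refl ∷ refl ∷ sq zero ∷ sq one ∷ []))
      (≤-trans (term≤∑ (λ b → E₅ a b g) b) (≤-trans (term≤∑ (λ a → ∑ (allFin n) (λ b → E₅ a b g)) a)
        (≤-trans (m≤n+m _ s₄) (≤-trans (m≤n+m _ s₃) (≤-trans (m≤n+m _ (E₂ g)) (m≤n+m _ (E₁ g)))))))
  cases : ∀ {g} → g ∈ Sym n → square g ≡ ε →
    1 ≤ E₁ g + (E₂ g + (∑ (allFin n) (λ b → E₃ b g) + (∑ (allFin n) (λ a → E₄ a g) + ∑ (allFin n) (λ a → ∑ (allFin n) (λ b → E₅ a b g)))))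
  cases {g} g∈ eq = split g∈ (lookup-square {g = g} eq) (lookup g zero ≟F zero) (lookup g one ≟F one) (lookup g zero ≟F one)

-- Sums over pairs of permutations

Kₘ Kₛ Kₜ : ℕ
Kₘ = 240 + Kᵍ
Kₛ = 496 + Kᵍ
Kₜ = Kₛ + (21 + Kₘ) + (21 + Kₘ) + (36 + Kₘ) + 2

∑-point : {A : Set} (_≟_ : DecidableEquality A) {xs : List A} → Unique xs → ∀ {a} → a ∈ xs → (F : A → ℕ) →
          ∑ xs (λ x → 𝟙 (x ≟ a) * F x) ≡ F a
∑-point _≟_ {x ∷ xs} (x# ∷ u) {a} (here refl) F = ≡-trans
  (cong₂ _+_ (≡-trans (cong (_* F a) (𝟙-yes (a ≟ a) refl)) (+-identityʳ (F a)))
             (∑-0 xs (λ {y} y∈ → cong (_* F y) (𝟙-no (y ≟ a) (λ eq → All.lookup x# y∈ (sym eq))))))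
  (+-identityʳ (F a))
∑-point _≟_ {x ∷ xs} (x# ∷ u) {a} (there a∈) F =
  cong₂ _+_ (cong (_* F x) (𝟙-no (x ≟ a) (All.lookup x# a∈))) (∑-point _≟_ u a∈ F)

module Pairs (n : ℕ) where

  ∑₂ : (Perm n → Perm n → ℕ) → ℕ
  ∑₂ F = ∑ (Sym n) (λ g → ∑ (Sym n) (F g))

  ∑₂-mono : {F G : Perm n → Perm n → ℕ} → (∀ {g h} → g ∈ Sym n → h ∈ Sym n → F g h ≤ G g h) → ∑₂ F ≤ ∑₂ G
  ∑₂-mono le = ∑-mono (Sym n) (λ g∈ → ∑-mono (Sym n) (le g∈))

  ∑₂-cong : {F G : Perm n → Perm n → ℕ} → (∀ {g h} → g ∈ Sym n → h ∈ Sym n → F g h ≡ G g h) → ∑₂ F ≡ ∑₂ G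
  ∑₂-cong eq = ∑-cong (Sym n) (λ g∈ → ∑-cong (Sym n) (eq g∈))

  ∑₂-+ : (F G : Perm n → Perm n → ℕ) → ∑₂ (λ g h → F g h + G g h) ≡ ∑₂ F + ∑₂ G
  ∑₂-+ F G = ≡-trans (∑-cong (Sym n) (λ {g} _ → ∑-+ (F g) (G g) (Sym n))) (∑-+ _ _ (Sym n))

  ∑₂-*ˡ : (c : ℕ) (F : Perm n → Perm n → ℕ) → ∑₂ (λ g h → c * F g h) ≡ c * ∑₂ F
  ∑₂-*ˡ c F = ≡-trans (∑-cong (Sym n) (λ {g} _ → ∑-*ˡ c (F g) (Sym n))) (∑-*ˡ c _ (Sym n))

  ∑₂-* : (F G : Perm n → ℕ) → ∑₂ (λ g h → F g * G h) ≡ ∑ (Sym n) F * ∑ (Sym n) G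
  ∑₂-* F G = ≡-trans (∑-cong (Sym n) (λ {g} _ → ∑-*ˡ (F g) G (Sym n))) (∑-*ʳ F (∑ (Sym n) G) (Sym n))

  ∑₂-const : (c : ℕ) → ∑₂ (λ _ _ → c) ≡ n ! * n ! * c
  ∑₂-const c = ≡-trans (∑-cong (Sym n) (λ _ → ≡-trans (∑-const c (Sym n)) (cong (_* c) (length-Sym n))))
    (≡-trans (∑-const (n ! * c) (Sym n)) (≡-trans (cong (_* (n ! * c)) (length-Sym n)) (sym (*-assoc (n !) (n !) c))))

  NonTrivial : Perm n → Perm n → Set
  NonTrivial g h = ¬ (g ≡ ε × h ≡ ε)

  trivial? : (g h : Perm n) → Dec (g ≡ ε × h ≡ ε)
  trivial? g h = (g ≟P ε) ×-dec (h ≟P ε)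

  nonTrivial? : (g h : Perm n) → Dec (NonTrivial g h)
  nonTrivial? g h = ¬? (trivial? g h)

  ∑₂-split : (F : Perm n → Perm n → ℕ) → ∑₂ F ≡ F ε ε + ∑₂ (λ g h → 𝟙 (nonTrivial? g h) * F g h)
  ∑₂-split F = begin
    ∑₂ F
      ≡⟨ ∑₂-cong (λ {g} {h} _ _ → split (trivial? g h) (F g h)) ⟩
    ∑₂ (λ g h → 𝟙 (trivial? g h) * F g h + 𝟙 (nonTrivial? g h) * F g h)
      ≡⟨ ∑₂-+ _ _ ⟩
    ∑₂ (λ g h → 𝟙 (trivial? g h) * F g h) + ∑₂ (λ g h → 𝟙 (nonTrivial? g h) * F g h)
      ≡⟨ cong (_+ ∑₂ (λ g h → 𝟙 (nonTrivial? g h) * F g h)) at-ε ⟩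
    F ε ε + ∑₂ (λ g h → 𝟙 (nonTrivial? g h) * F g h) ∎
    where
    open ≡-Reasoning
    split : {P : Set} (d : Dec P) (c : ℕ) → c ≡ 𝟙 d * c + 𝟙 (¬? d) * c
    split (yes _) c = sym (≡-trans (+-identityʳ (c + 0)) (+-identityʳ c))
    split (no _)  c = sym (+-identityʳ c)
    at-ε : ∑₂ (λ g h → 𝟙 (trivial? g h) * F g h) ≡ F ε ε
    at-ε = begin
      ∑₂ (λ g h → 𝟙 (trivial? g h) * F g h)
        ≡⟨ ∑₂-cong (λ {g} {h} _ _ → ≡-trans (cong (_* F g h) (𝟙-product (trivial? g h) (g ≟P ε) (h ≟P ε) id _,_)) (*-assoc (𝟙 (g ≟P ε)) (𝟙 (h ≟P ε)) (F g h))) ⟩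
      ∑ (Sym n) (λ g → ∑ (Sym n) (λ h → 𝟙 (g ≟P ε) * (𝟙 (h ≟P ε) * F g h)))
        ≡⟨ ∑-cong (Sym n) (λ {g} _ → ∑-*ˡ (𝟙 (g ≟P ε)) (λ h → 𝟙 (h ≟P ε) * F g h) (Sym n)) ⟩
      ∑ (Sym n) (λ g → 𝟙 (g ≟P ε) * ∑ (Sym n) (λ h → 𝟙 (h ≟P ε) * F g h))
        ≡⟨ ∑-point _≟P_ (Unique-Sym n) ε-∈ (λ g → ∑ (Sym n) (λ h → 𝟙 (h ≟P ε) * F g h)) ⟩
      ∑ (Sym n) (λ h → 𝟙 (h ≟P ε) * F ε h)
        ≡⟨ ∑-point _≟P_ (Unique-Sym n) ε-∈ (F ε) ⟩
      F ε ε ∎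

  #fix : Perm n → Perm n → ℕ
  #fix g h = ∑ (Sym n) (λ x → 𝟙 (((g · x) · h) ≟P x))

  #fix≤! : ∀ g h → #fix g h ≤ n !
  #fix≤! g h = count≤! (λ x → ((g · x) · h) ≟P x)

  #fix-row : ∀ {g} → g ∈ Sym n → ∑ (Sym n) (#fix g) ≤ n !
  #fix-row {g} g∈ = begin
    ∑ (Sym n) (#fix g)
      ≡⟨ ∑-swap (λ h x → 𝟙 (((g · x) · h) ≟P x)) (Sym n) (Sym n) ⟩
    ∑ (Sym n) (λ x → ∑ (Sym n) (λ h → 𝟙 (((g · x) · h) ≟P x)))
      ≤⟨ ∑-≤-const 1 (Sym n) (λ {x} x∈ → ∑-atMostOne (λ h → ((g · x) · h) ≟P x) (Unique-Sym n)
           (λ _ _ p q → ·-cancelˡ (·-∈ g∈ x∈) (≡-trans p (sym q)))) ⟩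
    length (Sym n) * 1
      ≡⟨ ≡-trans (*-identityʳ _) (length-Sym n) ⟩
    n ! ∎
    where open ≤-Reasoning

  -- If x and x₀ are both fixed, then x x₀⁻¹ commutes with g. So either there are no fixed points,
  -- or multiplication by x₀⁻¹ embeds them into the centralizer.
  #fix≤#centralizer : ∀ {g h} → g ∈ Sym n → h ∈ Sym n → #fix g h ≤ #centralizer g
  #fix≤#centralizer {g} {h} g∈ h∈ with Any.any? (λ x → ((g · x) · h) ≟P x) (Sym n)
  ... | no none = ≤-trans (≤-reflexive (∑-0 (Sym n) (λ {x} x∈ → 𝟙-no (((g · x) · h) ≟P x) (λ eq → none (lose x∈ eq))))) z≤n
  ... | yes some with find some
  ...   | x₀ , x₀∈ , fix₀ = begin
    #fix g h
      ≤⟨ count-injection _≟P_ {ys = filter (λ u → commute? u g) (Sym n)} (Unique-Sym n) (λ x → ((g · x) · h) ≟P x) (_· (x₀ ⁻¹))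
           (λ {x} x∈ fix → ∈ₚ.∈-filter⁺ (λ u → commute? u g) (·-∈ x∈ (inverse-∈ x₀∈)) (commutes x fix))
           (λ _ _ _ _ → ·-cancelʳ (inverse-∈ x₀∈)) ⟩
    length (filter (λ u → commute? u g) (Sym n))
      ≡⟨ length-filter (λ u → commute? u g) (Sym n) ⟩
    #centralizer g ∎
    where
    open ≤-Reasoning
    commutes : ∀ x → (g · x) · h ≡ x → (x · (x₀ ⁻¹)) · g ≡ g · (x · (x₀ ⁻¹))
    commutes x fix = ·-cancelʳ (·-∈ x₀∈ h∈) (≡-trans left (sym right))
      where
      y = x · (x₀ ⁻¹)
      left : (y · g) · (x₀ · h) ≡ x
      left = ≡-trans (·-assoc y g (x₀ · h)) (≡-trans (cong (y ·_) (≡-trans (sym (·-assoc g x₀ h)) fix₀)) (inverse-cancelʳ′ x₀∈ x))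
      right : (g · y) · (x₀ · h) ≡ x
      right = ≡-trans (sym (·-assoc (g · y) x₀ h)) (≡-trans (cong (_· h) (≡-trans (·-assoc g y x₀) (cong (g ·_) (inverse-cancelʳ′ x₀∈ x)))) fix)

  #fix-ε : ∀ {h} → h ≢ ε → #fix ε h ≡ 0
  #fix-ε {h} h≢ε = ∑-0 (Sym n) (λ {x} x∈ → 𝟙-no (((ε · x) · h) ≟P x)
    (λ eq → h≢ε (·-cancelˡ x∈ (≡-trans (cong (_· h) (sym (·-identityˡ x))) (≡-trans eq (sym (·-identityʳ x)))))))

  #fix-max : ∀ {g h} → g ∈ Sym n → h ∈ Sym n → NonTrivial g h → n * n * #fix g h ≤ Kₘ * n !
  #fix-max {g} {h} g∈ h∈ nt with g ≟P ε
  ... | yes refl = ≤-trans (≤-reflexive (≡-trans (cong (n * n *_) (#fix-ε (λ h≡ε → nt (refl , h≡ε)))) (*-zeroʳ (n * n)))) z≤n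
  ... | no g≢ε = ≤-trans (*-monoʳ-≤ (n * n) (#fix≤#centralizer g∈ h∈)) (centralizer-max g∈ g≢ε)

  N³ : ℕ
  N³ = n ! * (n ! * n !)

  -- Two of the three factors are bounded by c(g), the third is summed over h. A nontrivial pair
  -- with g = 1 has no fixed points, so the sum of c² may leave out the identity.
  ∑-#fix³ : n * n * ∑₂ (λ g h → 𝟙 (nonTrivial? g h) * (#fix g h * (#fix g h * #fix g h))) ≤ Kₛ * N³
  ∑-#fix³ = begin
    n * n * ∑₂ (λ g h → 𝟙 (nonTrivial? g h) * (#fix g h * (#fix g h * #fix g h)))
      ≤⟨ *-monoʳ-≤ (n * n) (∑₂-mono each) ⟩
    n * n * ∑₂ (λ g h → (𝟙 (¬? (g ≟P ε)) * c² g) * #fix g h)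
      ≤⟨ *-monoʳ-≤ (n * n) (∑-mono (Sym n) (λ {g} g∈ → ≤-trans (≤-reflexive (∑-*ˡ (𝟙 (¬? (g ≟P ε)) * c² g) (#fix g) (Sym n))) (*-monoʳ-≤ (𝟙 (¬? (g ≟P ε)) * c² g) (#fix-row g∈)))) ⟩
    n * n * ∑ (Sym n) (λ g → 𝟙 (¬? (g ≟P ε)) * c² g * n !)
      ≡⟨ cong (n * n *_) (∑-*ʳ (λ g → 𝟙 (¬? (g ≟P ε)) * c² g) (n !) (Sym n)) ⟩
    n * n * (∑ (Sym n) (λ g → 𝟙 (¬? (g ≟P ε)) * c² g) * n !)
      ≡⟨ *-assoc (n * n) _ (n !) ⟨
    n * n * ∑ (Sym n) (λ g → 𝟙 (¬? (g ≟P ε)) * c² g) * n !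
      ≤⟨ *-monoˡ-≤ (n !) (SquareSum.centralizer-square-sum n) ⟩
    Kₛ * (n ! * n !) * n !
      ≡⟨ regroup Kₛ (n !) ⟩
    Kₛ * N³ ∎
    where
    open ≤-Reasoning
    regroup : ∀ k x → k * (x * x) * x ≡ k * (x * (x * x))
    regroup = solve-∀
    each : ∀ {g h} → g ∈ Sym n → h ∈ Sym n → 𝟙 (nonTrivial? g h) * (#fix g h * (#fix g h * #fix g h)) ≤ (𝟙 (¬? (g ≟P ε)) * c² g) * #fix g h
    each {g} {h} g∈ h∈ = 𝟙*-≤ (nonTrivial? g h) (λ nt → bound nt (g ≟P ε))
      where
      bound : NonTrivial g h → (d : Dec (g ≡ ε)) → #fix g h * (#fix g h * #fix g h) ≤ (𝟙 (¬? d) * c² g) * #fix g h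
      bound nt (yes refl) = ≤-reflexive (cong (λ m → m * (m * m)) (#fix-ε (λ h≡ε → nt (refl , h≡ε))))
      bound nt (no _) = begin
        #fix g h * (#fix g h * #fix g h)    ≤⟨ *-monoʳ-≤ (#fix g h) (*-mono-≤ (#fix≤#centralizer g∈ h∈) (#fix≤#centralizer g∈ h∈)) ⟩
        #fix g h * c² g                     ≡⟨ *-comm (#fix g h) (c² g) ⟩
        c² g * #fix g h                     ≡⟨ cong (_* #fix g h) (+-identityʳ (c² g)) ⟨
        (c² g + 0) * #fix g h               ∎

  -- Either the pair of powers is trivial and fixes everything, or `#fix-max` applies. The weights
  -- e₁ and e₂ stand for the indicators of g′ = 1 and h′ = 1; as separate factors, either may be
  -- replaced by 1.
  power-max : ∀ {g′ h′} (e₁ e₂ : ℕ) → g′ ∈ Sym n → h′ ∈ Sym n → (g′ ≡ ε → h′ ≡ ε → 1 ≤ e₁ * e₂) →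
              n * n * #fix g′ h′ ≤ n ! * (n * n * (e₁ * e₂) + Kₘ)
  power-max {g′} {h′} e₁ e₂ g∈ h∈ e with trivial? g′ h′
  ... | yes (p , q) = begin
    n * n * #fix g′ h′                     ≤⟨ *-monoʳ-≤ (n * n) (#fix≤! g′ h′) ⟩
    n * n * n !                            ≡⟨ *-comm (n * n) (n !) ⟩
    n ! * (n * n)                          ≡⟨ cong (n ! *_) (*-identityʳ (n * n)) ⟨
    n ! * (n * n * 1)                      ≤⟨ *-monoʳ-≤ (n !) (≤-trans (*-monoʳ-≤ (n * n) (e p q)) (m≤m+n (n * n * (e₁ * e₂)) Kₘ)) ⟩
    n ! * (n * n * (e₁ * e₂) + Kₘ)         ∎
    where open ≤-Reasoning
  ... | no nt = begin
    n * n * #fix g′ h′                     ≤⟨ #fix-max g∈ h∈ nt ⟩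
    Kₘ * n !                               ≡⟨ *-comm Kₘ (n !) ⟩
    n ! * Kₘ                               ≤⟨ *-monoʳ-≤ (n !) (m≤n+m Kₘ (n * n * (e₁ * e₂))) ⟩
    n ! * (n * n * (e₁ * e₂) + Kₘ)         ∎
    where open ≤-Reasoning

  #fix₂′ #fix₃′ : Perm n → Perm n → ℕ
  #fix₂′ g h = #fix (square g) (square h)
  #fix₃′ g h = #fix (cube g) (cube h)

  i₂ i₃ : Perm n → ℕ
  i₂ g = 𝟙 (square g ≟P ε)
  i₃ g = 𝟙 (cube g ≟P ε)

  square-∈ : ∀ {g} → g ∈ Sym n → square g ∈ Sym n
  square-∈ g∈ = ·-∈ g∈ g∈

  cube-∈ : ∀ {g} → g ∈ Sym n → cube g ∈ Sym n
  cube-∈ g∈ = ·-∈ g∈ (·-∈ g∈ g∈)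

  -- Only the condition g² = 1 is kept in the bound for f₂. That bound does not involve h, so f can
  -- still be summed over h by `#fix-row`.
  ∑-#fix*#fix₂ : n * n * ∑₂ (λ g h → #fix g h * #fix₂′ g h) ≤ (21 + Kₘ) * N³
  ∑-#fix*#fix₂ = begin
    n * n * ∑₂ (λ g h → #fix g h * #fix₂′ g h)
      ≡⟨ ∑₂-*ˡ (n * n) _ ⟨
    ∑₂ (λ g h → n * n * (#fix g h * #fix₂′ g h))
      ≤⟨ ∑₂-mono each ⟩
    ∑₂ (λ g h → n ! * (n * n * i₂ g + Kₘ) * #fix g h)
      ≤⟨ ∑-mono (Sym n) (λ {g} g∈ → ≤-trans (≤-reflexive (∑-*ˡ (n ! * (n * n * i₂ g + Kₘ)) (#fix g) (Sym n))) (*-monoʳ-≤ (n ! * (n * n * i₂ g + Kₘ)) (#fix-row g∈))) ⟩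
    ∑ (Sym n) (λ g → n ! * (n * n * i₂ g + Kₘ) * n !)
      ≡⟨ ∑-cong (Sym n) (λ {g} _ → regroup₁ (n !) (n * n) (i₂ g) Kₘ) ⟩
    ∑ (Sym n) (λ g → n ! * n ! * (n * n * i₂ g + Kₘ))
      ≡⟨ ∑-*ˡ (n ! * n !) _ (Sym n) ⟩
    n ! * n ! * ∑ (Sym n) (λ g → n * n * i₂ g + Kₘ)
      ≡⟨ cong (n ! * n ! *_) (≡-trans (∑-+ (λ g → n * n * i₂ g) (λ _ → Kₘ) (Sym n))
           (cong₂ _+_ (∑-*ˡ (n * n) i₂ (Sym n)) (≡-trans (∑-const Kₘ (Sym n)) (cong (_* Kₘ) (length-Sym n))))) ⟩
    n ! * n ! * (n * n * I₂ n + n ! * Kₘ)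
      ≤⟨ *-monoʳ-≤ (n ! * n !) (+-monoˡ-≤ (n ! * Kₘ) (I₂-bound n)) ⟩
    n ! * n ! * (21 * n ! + n ! * Kₘ)
      ≡⟨ regroup₂ (n !) 21 Kₘ ⟩
    (21 + Kₘ) * N³ ∎
    where
    open ≤-Reasoning
    regroup₁ : ∀ x m i k → x * (m * i + k) * x ≡ x * x * (m * i + k)
    regroup₁ = solve-∀
    regroup₂ : ∀ x c k → x * x * (c * x + x * k) ≡ (c + k) * (x * (x * x))
    regroup₂ = solve-∀
    regroup₃ : ∀ m a b → m * (a * b) ≡ m * b * a
    regroup₃ = solve-∀
    each : ∀ {g h} → g ∈ Sym n → h ∈ Sym n → n * n * (#fix g h * #fix₂′ g h) ≤ n ! * (n * n * i₂ g + Kₘ) * #fix g h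
    each {g} {h} g∈ h∈ = ≤-trans (≤-reflexive (regroup₃ (n * n) (#fix g h) (#fix₂′ g h)))
      (*-monoˡ-≤ (#fix g h) (≤-trans (power-max (i₂ g) 1 (square-∈ g∈) (square-∈ h∈)
        (λ p _ → ≤-reflexive (sym (≡-trans (*-identityʳ (i₂ g)) (𝟙-yes (square g ≟P ε) p)))))
        (≤-reflexive (cong (λ m → n ! * (n * n * m + Kₘ)) (*-identityʳ (i₂ g))))))

  -- With no factor f left, both conditions can be kept: the double sum of the indicators factors,
  -- and the rarity of the solutions counts twice.
  ∑-power : (i : Perm n → ℕ) (power : Perm n → Perm n) → (∀ {g} → g ∈ Sym n → power g ∈ Sym n) →
            (∀ {g} → power g ≡ ε → 1 ≤ i g) → ∀ K → n * n * (∑ (Sym n) i * ∑ (Sym n) i) ≤ K * (n ! * n !) →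
            n * n * ∑₂ (λ g h → #fix (power g) (power h)) ≤ (K + Kₘ) * N³
  ∑-power i power power-∈ pos K bound = begin
    n * n * ∑₂ (λ g h → #fix (power g) (power h))
      ≡⟨ ∑₂-*ˡ (n * n) _ ⟨
    ∑₂ (λ g h → n * n * #fix (power g) (power h))
      ≤⟨ ∑₂-mono (λ {g} {h} g∈ h∈ → power-max (i g) (i h) (power-∈ g∈) (power-∈ h∈) (λ p q → *-mono-≤ (pos p) (pos q))) ⟩
    ∑₂ (λ g h → n ! * (n * n * (i g * i h) + Kₘ))
      ≡⟨ ∑₂-*ˡ (n !) _ ⟩
    n ! * ∑₂ (λ g h → n * n * (i g * i h) + Kₘ)
      ≡⟨ cong (n ! *_) (≡-trans (∑₂-+ (λ g h → n * n * (i g * i h)) (λ _ _ → Kₘ))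
           (cong₂ _+_ (≡-trans (∑₂-*ˡ (n * n) (λ g h → i g * i h)) (cong (n * n *_) (∑₂-* i i))) (∑₂-const Kₘ))) ⟩
    n ! * (n * n * (∑ (Sym n) i * ∑ (Sym n) i) + n ! * n ! * Kₘ)
      ≤⟨ *-monoʳ-≤ (n !) (+-monoˡ-≤ (n ! * n ! * Kₘ) bound) ⟩
    n ! * (K * (n ! * n !) + n ! * n ! * Kₘ)
      ≡⟨ regroup (n !) K Kₘ ⟩
    (K + Kₘ) * N³ ∎
    where
    open ≤-Reasoning
    regroup : ∀ x c k → x * (c * (x * x) + x * x * k) ≡ (c + k) * (x * (x * x))
    regroup = solve-∀

  ∑-#fix₂ : n * n * ∑₂ #fix₂′ ≤ (21 + Kₘ) * N³
  ∑-#fix₂ = ∑-power i₂ square square-∈ (λ {g} p → ≤-reflexive (sym (𝟙-yes (square g ≟P ε) p))) 21 (begin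
    n * n * (I₂ n * I₂ n)    ≡⟨ *-assoc (n * n) (I₂ n) (I₂ n) ⟨
    n * n * I₂ n * I₂ n      ≤⟨ *-mono-≤ (I₂-bound n) (count≤! {n} (λ g → square g ≟P ε)) ⟩
    21 * n ! * n !           ≡⟨ *-assoc 21 (n !) (n !) ⟩
    21 * (n ! * n !)         ∎)
    where open ≤-Reasoning

  ∑-#fix₃ : n * n * ∑₂ #fix₃′ ≤ (36 + Kₘ) * N³
  ∑-#fix₃ = ∑-power i₃ cube cube-∈ (λ {g} p → ≤-reflexive (sym (𝟙-yes (cube g ≟P ε) p))) 36 (begin
    n * n * (I₃ n * I₃ n)      ≡⟨ regroup n (I₃ n) ⟩
    (n * I₃ n) * (n * I₃ n)    ≤⟨ *-mono-≤ (I₃-bound n) (I₃-bound n) ⟩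
    (6 * n !) * (6 * n !)      ≡⟨ regroup′ (n !) ⟩
    36 * (n ! * n !)           ∎)
    where
    open ≤-Reasoning
    regroup : ∀ n i → n * n * (i * i) ≡ (n * i) * (n * i)
    regroup = solve-∀
    regroup′ : ∀ x → (6 * x) * (6 * x) ≡ 36 * (x * x)
    regroup′ = solve-∀

  square≤2! : n * n ≤ 2 * n !
  square≤2! = go n
    where
    go : ∀ n → n * n ≤ 2 * n !
    go zero = z≤n
    go (suc zero) = s≤s z≤n
    go (suc (suc m)) = ≤-trans (≤-trans (≤-reflexive (sym (*-identityʳ _))) (*-monoʳ-≤ ((2 + m) * (2 + m)) (ℕₚ.1≤n! m))) (square*!≤ m)

  ∑-1₂ : n * n * ∑₂ (λ _ _ → 1) ≤ 2 * N³
  ∑-1₂ = begin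
    n * n * ∑₂ (λ _ _ → 1)        ≡⟨ cong (n * n *_) (≡-trans (∑₂-const 1) (*-identityʳ (n ! * n !))) ⟩
    n * n * (n ! * n !)           ≤⟨ *-monoˡ-≤ (n ! * n !) square≤2! ⟩
    2 * n ! * (n ! * n !)         ≡⟨ *-assoc 2 (n !) (n ! * n !) ⟩
    2 * N³                        ∎
    where open ≤-Reasoning

  pairWeight : Perm n → Perm n → ℕ
  pairWeight g h = #fix g h * (#fix g h * #fix g h) + #fix g h * #fix₂′ g h + #fix₂′ g h + #fix₃′ g h + 1

  ∑-pairWeight : n * n * ∑₂ (λ g h → 𝟙 (nonTrivial? g h) * pairWeight g h) ≤ Kₜ * N³
  ∑-pairWeight = begin
    n * n * ∑₂ (λ g h → 𝟙 (nonTrivial? g h) * pairWeight g h)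
      ≤⟨ *-monoʳ-≤ (n * n) (∑₂-mono (λ {g} {h} _ _ → drop (nonTrivial? g h) (#fix g h * (#fix g h * #fix g h)) (#fix g h * #fix₂′ g h) (#fix₂′ g h) (#fix₃′ g h))) ⟩
    n * n * ∑₂ (λ g h → a g h + b g h + #fix₂′ g h + #fix₃′ g h + 1)
      ≡⟨ cong (n * n *_) (≡-trans (∑₂-+ (λ g h → a g h + b g h + #fix₂′ g h + #fix₃′ g h) (λ _ _ → 1)) (cong (_+ ∑₂ (λ _ _ → 1))
          (≡-trans (∑₂-+ (λ g h → a g h + b g h + #fix₂′ g h) #fix₃′) (cong (_+ ∑₂ #fix₃′)
            (≡-trans (∑₂-+ (λ g h → a g h + b g h) #fix₂′) (cong (_+ ∑₂ #fix₂′) (∑₂-+ a b))))))) ⟩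
    n * n * (∑₂ a + ∑₂ b + ∑₂ #fix₂′ + ∑₂ #fix₃′ + ∑₂ (λ _ _ → 1))
      ≡⟨ expand (n * n) (∑₂ a) (∑₂ b) (∑₂ #fix₂′) (∑₂ #fix₃′) (∑₂ (λ _ _ → 1)) ⟩
    n * n * ∑₂ a + n * n * ∑₂ b + n * n * ∑₂ #fix₂′ + n * n * ∑₂ #fix₃′ + n * n * ∑₂ (λ _ _ → 1)
      ≤⟨ +-mono-≤ (+-mono-≤ (+-mono-≤ (+-mono-≤ ∑-#fix³ ∑-#fix*#fix₂) ∑-#fix₂) ∑-#fix₃) ∑-1₂ ⟩
    Kₛ * N³ + (21 + Kₘ) * N³ + (21 + Kₘ) * N³ + (36 + Kₘ) * N³ + 2 * N³
      ≡⟨ collect Kₛ (21 + Kₘ) (36 + Kₘ) 2 N³ ⟩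
    Kₜ * N³ ∎
    where
    open ≤-Reasoning
    a b : Perm n → Perm n → ℕ
    a g h = 𝟙 (nonTrivial? g h) * (#fix g h * (#fix g h * #fix g h))
    b g h = #fix g h * #fix₂′ g h
    drop : {P : Set} (d : Dec P) → ∀ a b c e → 𝟙 d * (a + b + c + e + 1) ≤ 𝟙 d * a + b + c + e + 1
    drop (no _)  a b c e = z≤n
    drop (yes _) a b c e = ≤-reflexive (≡-trans (+-identityʳ (a + b + c + e + 1)) (cong (λ m → m + b + c + e + 1) (sym (+-identityʳ a))))
    expand : ∀ n a b c d e → n * (a + b + c + d + e) ≡ n * a + n * b + n * c + n * d + n * e
    expand = solve-∀
    collect : ∀ a b c d x → a * x + b * x + b * x + c * x + d * x ≡ (a + b + b + c + d) * x
    collect = solve-∀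

-- The contribution of the nontrivial pairs and its upper bound

module Excess (n : ℕ) where
  open Pairs n
  open Burnside n

  symBijection : ∀ {g h} → g ∈ Sym n → h ∈ Sym n → Bijection (Sym n)
  symBijection {g} {h} g∈ h∈ = record
    { φ = λ x → (g · x) · h ; ψ = λ x → ((g ⁻¹) · x) · (h ⁻¹)
    ; φ∈ = λ x∈ → ·-∈ (·-∈ g∈ x∈) h∈ ; ψ∈ = λ x∈ → ·-∈ (·-∈ (inverse-∈ g∈) x∈) (inverse-∈ h∈)
    ; ψφ = λ {x} _ → ≡-trans (two-sided-∘ (g ⁻¹) (h ⁻¹) g h x)
        (≡-trans (cong₂ (λ a b → (a · x) · b) (·-inverseˡ g∈) (·-inverseʳ h∈)) (trivial x))
    ; φψ = λ {x} _ → ≡-trans (two-sided-∘ g h (g ⁻¹) (h ⁻¹) x)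
        (≡-trans (cong₂ (λ a b → (a · x) · b) (·-inverseʳ g∈) (·-inverseˡ h∈)) (trivial x)) }
    where
    trivial : ∀ x → (ε · x) · ε ≡ x
    trivial x = ≡-trans (·-identityʳ (ε · x)) (·-identityˡ x)

  module _ {g h : Perm n} (g∈ : g ∈ Sym n) (h∈ : h ∈ Sym n) where
    private
      module V = Invariant _≟P_ (symBijection g∈ h∈)
      module F = FewInvariant _≟P_ (Unique-Sym n) (symBijection g∈ h∈)

    invariant : ∀ {k S} → S ∈ choose k (Sym n) → SameSet (act g h S) S → V.Inv S
    invariant {k} {S} S∈ (into , onto) = All.tabulate λ {x} x∈ →
      All.lookup into (∈ₚ.∈-map⁺ _ x∈) ,
      (let (y , y∈ , eq) = ∈ₚ.∈-map⁻ _ (All.lookup onto x∈) in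
       subst (_∈ S) (≡-trans (sym (Bijection.ψφ (symBijection g∈ h∈) (choose-⊆ k (Sym n) S∈ y∈)))
                             (cong (λ w → ((g ⁻¹) · w) · (h ⁻¹)) (sym eq))) y∈)

    #fixed≤#invariant : ∀ k → #fixed k g h ≤ V.#invariant k
    #fixed≤#invariant k = ∑-mono (choose k (Sym n)) (λ {S} S∈ → 𝟙-mono (sameSet? (act g h S) S) (V.inv? S) (invariant {k} S∈))

    #fix₂≡ : F.#fix₂ ≡ #fix₂′ g h
    #fix₂≡ = ∑-cong (Sym n) (λ {x} _ → cong (λ w → 𝟙 (w ≟P x)) (two-sided-∘ g h g h x))

    #fix₃≡ : F.#fix₃ ≡ #fix₃′ g h
    #fix₃≡ = ∑-cong (Sym n) (λ {x} _ → cong (λ w → 𝟙 (w ≟P x)) (≡-trans (cong (λ w → (g · w) · h) (two-sided-∘ g h g h x))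
      (≡-trans (two-sided-∘ g h (g · g) (h · h) x) (cong (λ w → (cube g · x) · w) (·-assoc h h h)))))

    weight≡ : F.f * (F.f * F.f) + F.f * F.#fix₂ + F.#fix₂ + F.#fix₃ + 1 ≡ pairWeight g h
    weight≡ = weight-cong F.f≡#fix₁ #fix₂≡ #fix₃≡
      where
      weight-cong : ∀ {a a′ b b′ c c′} → a ≡ a′ → b ≡ b′ → c ≡ c′ →
                    a * (a * a) + a * b + b + c + 1 ≡ a′ * (a′ * a′) + a′ * b′ + b′ + c′ + 1
      weight-cong refl refl refl = refl

    module _ (nt : NonTrivial g h) (large : 4 * Kₘ ≤ n * n) (1≤n : 1 ≤ n) (20≤ : 20 ≤ n !) where

      -- n² ≥ 4 Kₘ brings the maximal number of fixed points of a nontrivial pair, O(N / n²), below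
      -- N / 4.
      4f≤N : 4 * F.f ≤ F.N
      4f≤N = ≤-trans (ℕₚ.*-cancelˡ-≤ (n * n) {{ℕₚ.m*n≢0 n n {{>-nonZero 1≤n}} {{>-nonZero 1≤n}}}} (begin
        n * n * (4 * F.f)        ≡⟨ *-exchange (n * n) 4 F.f ⟩
        4 * (n * n * F.f)        ≡⟨ cong (λ m → 4 * (n * n * m)) F.f≡#fix₁ ⟩
        4 * (n * n * #fix g h)   ≤⟨ *-monoʳ-≤ 4 (#fix-max g∈ h∈ nt) ⟩
        4 * (Kₘ * n !)           ≡⟨ *-assoc 4 Kₘ (n !) ⟨
        4 * Kₘ * n !             ≤⟨ *-monoˡ-≤ (n !) large ⟩
        n * n * n !              ∎)) (≤-reflexive (sym (length-Sym n)))
        where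
        open ≤-Reasoning

      #invariant-bound′ : ∀ k → 3 ≤ k → 2 * k ≤ n ! → V.#invariant k * N³ ≤ 4000 * pairWeight g h * (n ! C k)
      #invariant-bound′ k 3≤k 2k≤N = ≤-trans
        (≤-reflexive (cong (λ m → V.#invariant k * (m * (m * m))) (sym (length-Sym n))))
        (≤-trans (F.#invariant-bound 4f≤N (≤-trans 20≤ (≤-reflexive (sym (length-Sym n)))) k 3≤k (≤-trans 2k≤N (≤-reflexive (sym (length-Sym n)))))
          (≤-reflexive (cong₂ (λ w m → 4000 * w * (m C k)) weight≡ (length-Sym n))))

      -- Beyond the middle, k is replaced by l = N - k, which has the same binomial coefficient; k ≤
      -- N - 3 becomes l ≥ 3.
      #fixed-bound : ∀ k → 3 ≤ k → k ≤ n ! ∸ 3 → #fixed k g h * N³ ≤ 4000 * pairWeight g h * (n ! C k)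
      #fixed-bound k 3≤k k≤ = byHalf (2 * k ≤? n !)
        where
        open ≤-Reasoning
        l : ℕ
        l = n ! ∸ k
        k≤N : k ≤ n !
        k≤N = ≤-trans k≤ (ℕₚ.m∸n≤m (n !) 3)
        k+l≡ : k + l ≡ n !
        k+l≡ = ℕₚ.m+[n∸m]≡n k≤N
        3≤l : 3 ≤ l
        3≤l = ≤-trans (≤-reflexive (sym (ℕₚ.m∸[m∸n]≡n (≤-trans (m≤m+n 3 17) 20≤)))) (ℕₚ.∸-monoʳ-≤ (n !) k≤)
        2l≤N : n ! ≤ 2 * k → 2 * l ≤ n !
        2l≤N N≤2k = ℕₚ.+-cancelʳ-≤ (2 * k) (2 * l) (n !) (begin
          2 * l + 2 * k     ≡⟨ *-distribˡ-+ 2 l k ⟨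
          2 * (l + k)       ≡⟨ cong (2 *_) (≡-trans (+-comm l k) k+l≡) ⟩
          2 * n !           ≡⟨ cong (n ! +_) (+-identityʳ (n !)) ⟩
          n ! + n !         ≤⟨ +-monoʳ-≤ (n !) N≤2k ⟩
          n ! + 2 * k       ∎)
        byHalf : Dec (2 * k ≤ n !) → #fixed k g h * N³ ≤ 4000 * pairWeight g h * (n ! C k)
        byHalf (yes 2k≤N) = ≤-trans (*-monoˡ-≤ N³ (#fixed≤#invariant k)) (#invariant-bound′ k 3≤k 2k≤N)
        byHalf (no ¬2k≤N) = begin
          #fixed k g h * N³            ≤⟨ *-monoˡ-≤ N³ (≤-trans (#fixed≤#invariant k) (V.#invariant-complement (Unique-Sym n) {k} {l} (≡-trans k+l≡ (sym (length-Sym n))))) ⟩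
          V.#invariant l * N³          ≤⟨ #invariant-bound′ l 3≤l (2l≤N (<⇒≤ (ℕₚ.≰⇒> ¬2k≤N))) ⟩
          4000 * pairWeight g h * (n ! C l)   ≡⟨ cong (4000 * pairWeight g h *_) (nCk≡nC[n∸k] k≤N) ⟨
          4000 * pairWeight g h * (n ! C k)   ∎

  excess : ℕ → ℕ
  excess k = ∑₂ (λ g h → 𝟙 (nonTrivial? g h) * #fixed k g h)

  #fixed-ε : ∀ k → #fixed k ε ε ≡ n ! C k
  #fixed-ε k = begin
    #fixed k ε ε                        ≡⟨ ∑-cong (choose k (Sym n)) (λ {S} _ → 𝟙-yes (sameSet? (act ε ε S) S) (subst (λ S′ → SameSet S′ S) (sym (act-ε S)) (SameSet-refl S))) ⟩
    ∑ (choose k (Sym n)) (λ _ → 1)      ≡⟨ ∑-1 (choose k (Sym n)) ⟩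
    length (choose k (Sym n))           ≡⟨ length-choose k (Sym n) ⟩
    length (Sym n) C k                  ≡⟨ cong (_C k) (length-Sym n) ⟩
    n ! C k                             ∎
    where open ≡-Reasoning

  T-excess : ∀ k → T n k * (n ! * n !) ≡ n ! C k + excess k
  T-excess k = ≡-trans (burnside k) (≡-trans (∑₂-split (#fixed k)) (cong (_+ excess k) (#fixed-ε k)))

  excess-bound : 4 * Kₘ ≤ n * n → 1 ≤ n → 20 ≤ n ! → ∀ k → 3 ≤ k → k ≤ n ! ∸ 3 → n * n * excess k ≤ 4000 * Kₜ * (n ! C k)
  excess-bound large 1≤n 20≤ k 3≤k k≤ = ℕₚ.*-cancelʳ-≤ _ _ N³ {{nz}} (begin
    n * n * excess k * N³
      ≡⟨ *-assoc (n * n) (excess k) N³ ⟩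
    n * n * (excess k * N³)
      ≡⟨ cong (n * n *_) (≡-trans (*-comm (excess k) N³) (sym (∑₂-*ˡ N³ _))) ⟩
    n * n * ∑₂ (λ g h → N³ * (𝟙 (nonTrivial? g h) * #fixed k g h))
      ≤⟨ *-monoʳ-≤ (n * n) (∑₂-mono each) ⟩
    n * n * ∑₂ (λ g h → 4000 * (n ! C k) * (𝟙 (nonTrivial? g h) * pairWeight g h))
      ≡⟨ cong (n * n *_) (∑₂-*ˡ (4000 * (n ! C k)) _) ⟩
    n * n * (4000 * (n ! C k) * ∑₂ (λ g h → 𝟙 (nonTrivial? g h) * pairWeight g h))
      ≡⟨ *-exchange (n * n) (4000 * (n ! C k)) _ ⟩
    4000 * (n ! C k) * (n * n * ∑₂ (λ g h → 𝟙 (nonTrivial? g h) * pairWeight g h))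
      ≤⟨ *-monoʳ-≤ (4000 * (n ! C k)) ∑-pairWeight ⟩
    4000 * (n ! C k) * (Kₜ * N³)
      ≡⟨ regroup 4000 (n ! C k) Kₜ N³ ⟩
    4000 * Kₜ * (n ! C k) * N³ ∎)
    where
    open ≤-Reasoning
    nz : NonZero N³
    nz = >-nonZero (*-mono-≤ (ℕₚ.1≤n! n) (*-mono-≤ (ℕₚ.1≤n! n) (ℕₚ.1≤n! n)))
    regroup : ∀ c b k x → c * b * (k * x) ≡ c * k * b * x
    regroup = solve-∀
    each : ∀ {g h} → g ∈ Sym n → h ∈ Sym n → N³ * (𝟙 (nonTrivial? g h) * #fixed k g h) ≤ 4000 * (n ! C k) * (𝟙 (nonTrivial? g h) * pairWeight g h)
    each {g} {h} g∈ h∈ = bound (nonTrivial? g h)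
      where
      bound : (d : Dec (NonTrivial g h)) → N³ * (𝟙 d * #fixed k g h) ≤ 4000 * (n ! C k) * (𝟙 d * pairWeight g h)
      bound (no _) = ≤-trans (≤-reflexive (*-zeroʳ N³)) z≤n
      bound (yes nt) = begin
        N³ * (#fixed k g h + 0)                   ≡⟨ ≡-trans (cong (N³ *_) (+-identityʳ (#fixed k g h))) (*-comm N³ (#fixed k g h)) ⟩
        #fixed k g h * N³                         ≤⟨ #fixed-bound g∈ h∈ nt large 1≤n 20≤ k 3≤k k≤ ⟩
        4000 * pairWeight g h * (n ! C k)         ≡⟨ swap′ 4000 (pairWeight g h) (n ! C k) ⟩
        4000 * (n ! C k) * pairWeight g h         ≡⟨ cong (4000 * (n ! C k) *_) (+-identityʳ (pairWeight g h)) ⟨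
        4000 * (n ! C k) * (pairWeight g h + 0)   ∎
        where
        swap′ : ∀ a b c → a * b * c ≡ a * c * b
        swap′ = solve-∀

-- Pairs of transpositions

∑-choose-filter-≤ : {A : Set} {P : A → Set} (P? : Decidable P) (F : List A → ℕ) (k : ℕ) (xs : List A) →
  ∑ (choose k (filter P? xs)) F ≤ ∑ (choose k xs) F
∑-choose-filter-≤ P? F zero    xs = ≤-refl
∑-choose-filter-≤ P? F (suc k) [] = ≤-refl
∑-choose-filter-≤ P? F (suc k) (x ∷ xs) = ≤-trans (step (P? x)) (≤-reflexive (sym (∑-choose-∷ F k x xs)))
  where
  step : Dec _ → ∑ (choose (suc k) (filter P? (x ∷ xs))) F ≤ ∑ (choose k xs) (F ∘ (x ∷_)) + ∑ (choose (suc k) xs) F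
  step (yes px) rewrite Listₚ.filter-accept P? {x} {xs} px = ≤-trans (≤-reflexive (∑-choose-∷ F k x (filter P? xs)))
    (+-mono-≤ (∑-choose-filter-≤ P? (F ∘ (x ∷_)) k xs) (∑-choose-filter-≤ P? F (suc k) xs))
  step (no ¬px) rewrite Listₚ.filter-reject P? {x} {xs} ¬px = ≤-trans (∑-choose-filter-≤ P? F (suc k) xs) (m≤n+m _ _)

module Transpositions (n : ℕ) where
  open Pairs n
  open Burnside n
  open Excess n using (excess)
  open Prescribed n

  flip : Fin n → Fin n → Fin n → Fin n
  flip a b i with i ≟F a | i ≟F b
  ... | yes _ | _     = b
  ... | no _  | yes _ = a
  ... | no _  | no _  = i

  flip-left : ∀ a b → flip a b a ≡ b
  flip-left a b with a ≟F a | a ≟F b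
  ... | yes _ | _ = refl
  ... | no ne | _ = contradiction refl ne

  flip-right : ∀ a b → flip a b b ≡ a
  flip-right a b with b ≟F a | b ≟F b
  ... | yes eq | _     = eq
  ... | no _   | yes _ = refl
  ... | no _   | no ne = contradiction refl ne

  flip-other : ∀ {a b i} → i ≢ a → i ≢ b → flip a b i ≡ i
  flip-other {a} {b} {i} i≢a i≢b with i ≟F a | i ≟F b
  ... | yes eq | _      = contradiction eq i≢a
  ... | no _   | yes eq = contradiction eq i≢b
  ... | no _   | no _   = refl

  flip-flip : ∀ a b i → flip a b (flip a b i) ≡ i
  flip-flip a b i with i ≟F a | i ≟F b
  ... | yes refl | _        = flip-right i b
  ... | no _     | yes refl = flip-left a i
  ... | no i≢a   | no i≢b   = flip-other i≢a i≢b

  τ : Fin n → Fin n → Perm n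
  τ a b = tabulate (flip a b)

  lookup-τ : ∀ a b i → lookup (τ a b) i ≡ flip a b i
  lookup-τ a b = Vecₚ.lookup∘tabulate (flip a b)

  τ-∈ : ∀ a b → τ a b ∈ Sym n
  τ-∈ a b = ∈-Sym⁺ λ {i} {j} eq → begin
    i                         ≡⟨ flip-flip a b i ⟨
    flip a b (flip a b i)     ≡⟨ cong (flip a b) (≡-trans (sym (lookup-τ a b i)) (≡-trans eq (lookup-τ a b j))) ⟩
    flip a b (flip a b j)     ≡⟨ flip-flip a b j ⟩
    j                         ∎
    where open ≡-Reasoning

  two : Fin n → Fin n → Fin n → Fin n → List (Fin n × Fin n)
  two a b c d = (a , c) ∷ (b , d) ∷ []

  -- Double transitivity by two transpositions: the first takes c to c′ and d to some e, the second
  -- takes e to d′ and leaves c′ alone, since c′ differs from both e and d′.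
  carry : ∀ {c d c′ d′ : Fin n} → c ≢ d → c′ ≢ d′ → ∃ λ σ → σ ∈ Sym n × lookup σ c ≡ c′ × lookup σ d ≡ d′
  carry {c} {d} {c′} {d′} c≢d c′≢d′ = τ e d′ · τ c c′ , ·-∈ (τ-∈ e d′) (τ-∈ c c′) , at-c , at-d
    where
    open ≡-Reasoning
    e : Fin n
    e = flip c c′ d
    c′≢e : c′ ≢ e
    c′≢e eq = c≢d (begin
      c                       ≡⟨ flip-right c c′ ⟨
      flip c c′ c′            ≡⟨ cong (flip c c′) eq ⟩
      flip c c′ e             ≡⟨ flip-flip c c′ d ⟩
      d                       ∎)
    value : ∀ i → lookup (τ e d′ · τ c c′) i ≡ flip e d′ (flip c c′ i)
    value i = ≡-trans (lookup-· (τ e d′) (τ c c′) i) (≡-trans (lookup-τ e d′ _) (cong (flip e d′) (lookup-τ c c′ i)))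
    at-c : lookup (τ e d′ · τ c c′) c ≡ c′
    at-c = ≡-trans (value c) (≡-trans (cong (flip e d′) (flip-left c c′)) (flip-other c′≢e c′≢d′))
    at-d : lookup (τ e d′ · τ c c′) d ≡ d′
    at-d = ≡-trans (value d) (flip-left e d′)

  #sends-two-≤ : ∀ {a b c d c′ d′} → c ≢ d → c′ ≢ d′ → #sends (two a b c d) ≤ #sends (two a b c′ d′)
  #sends-two-≤ {a} {b} {c} {d} {c′} {d′} c≢d c′≢d′ with carry c≢d c′≢d′
  ... | σ , σ∈ , σc , σd = ≤-trans
    (∑-mono (Sym n) (λ {x} _ → 𝟙-mono (sends? (two a b c d) x) (sends? (two a b c′ d′) (σ · x))
      (λ { (u , p ∷ q ∷ []) → u , ≡-trans (lookup-· σ x a) (≡-trans (cong (lookup σ) p) σc)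
                               ∷ ≡-trans (lookup-· σ x b) (≡-trans (cong (lookup σ) q) σd) ∷ [] })))
    (≤-reflexive (∑-Sym-·ˡ (λ x → 𝟙 (sends? (two a b c′ d′) x)) σ∈))

  -- The values (x a , x b) sort all permutations into n² classes. Those with two equal values are
  -- empty and the others are equally large by double transitivity, so each of these holds at least
  -- n! / n² permutations.
  #sends-two-lower : ∀ {a b c d} → a ≢ b → c ≢ d → n ! ≤ n * (n * #sends (two a b c d))
  #sends-two-lower {a} {b} {c} {d} a≢b c≢d = begin
    n !                                       ≡⟨ length-Sym n ⟨
    length (Sym n)                            ≡⟨ ∑-1 (Sym n) ⟨
    ∑ (Sym n) (λ _ → 1)                       ≤⟨ ∑-mono (Sym n) (λ {x} _ → some x) ⟩
    ∑ (Sym n) (λ x → ∑ (allFin n) (λ c → ∑ (allFin n) (λ d → 𝟙 (sends? (two a b c d) x))))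
      ≡⟨ ≡-trans (∑-swap _ (Sym n) (allFin n)) (∑-cong (allFin n) (λ {c} _ → ∑-swap (λ x d → 𝟙 (sends? (two a b c d) x)) (Sym n) (allFin n))) ⟩
    ∑ (allFin n) (λ c → ∑ (allFin n) (λ d → #sends (two a b c d)))
      ≤⟨ ∑-Fin-≤ _ _ (λ c′ → ∑-Fin-≤ _ _ (λ d′ → compare c′ d′ (c′ ≟F d′))) ⟩
    n * (n * #sends (two a b c d)) ∎
    where
    open ≤-Reasoning
    some : ∀ x → 1 ≤ ∑ (allFin n) (λ c → ∑ (allFin n) (λ d → 𝟙 (sends? (two a b c d) x)))
    some x = ≤-trans (≤-reflexive (sym (𝟙-yes (sends? (two a b (lookup x a) (lookup x b)) x) ((a≢b ∷ []) ∷ [] ∷ [] , refl ∷ refl ∷ []))))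
      (≤-trans (term≤∑ (λ d → 𝟙 (sends? (two a b (lookup x a) d) x)) (lookup x b))
               (term≤∑ (λ c → ∑ (allFin n) (λ d → 𝟙 (sends? (two a b c d) x))) (lookup x a)))
    compare : ∀ c′ d′ → Dec (c′ ≡ d′) → #sends (two a b c′ d′) ≤ #sends (two a b c d)
    compare c′ d′ (no c′≢d′) = #sends-two-≤ {a} {b} c′≢d′ c≢d
    compare c′ .c′ (yes refl) = ≤-trans (≤-reflexive (∑-0 (Sym n) (λ {x} x∈ → 𝟙-no (sends? (two a b c′ c′) x)
      (λ { (_ , p ∷ q ∷ []) → a≢b (∈-Sym⁻ x∈ (≡-trans p (sym q))) })))) z≤n

  -- Conjugation by x turns `τ a b` into the transposition of x a and x b, so multiplying x by
  -- matching transpositions on both sides changes nothing.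
  sends-fixed : ∀ {a b c d x} → x ∈ Sym n → lookup x a ≡ c → lookup x b ≡ d → (τ c d · x) · τ a b ≡ x
  sends-fixed {a} {b} {c} {d} {x} x∈ xa xb = lookup-ext λ i → begin
    lookup ((τ c d · x) · τ a b) i         ≡⟨ lookup-· (τ c d · x) (τ a b) i ⟩
    lookup (τ c d · x) (lookup (τ a b) i)  ≡⟨ lookup-· (τ c d) x _ ⟩
    lookup (τ c d) (lookup x (lookup (τ a b) i)) ≡⟨ lookup-τ c d _ ⟩
    flip c d (lookup x (lookup (τ a b) i)) ≡⟨ cong (λ j → flip c d (lookup x j)) (lookup-τ a b i) ⟩
    flip c d (lookup x (flip a b i))       ≡⟨ at i (i ≟F a) (i ≟F b) ⟩
    lookup x i                             ∎
    where
    open ≡-Reasoning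
    at : ∀ i → Dec (i ≡ a) → Dec (i ≡ b) → flip c d (lookup x (flip a b i)) ≡ lookup x i
    at i (yes refl) _ = ≡-trans (cong (λ j → flip c d (lookup x j)) (flip-left i b)) (≡-trans (cong (flip c d) xb) (≡-trans (flip-right c d) (sym xa)))
    at i (no _) (yes refl) = ≡-trans (cong (λ j → flip c d (lookup x j)) (flip-right a i)) (≡-trans (cong (flip c d) xa) (≡-trans (flip-left c d) (sym xb)))
    at i (no i≢a) (no i≢b) = ≡-trans (cong (λ j → flip c d (lookup x j)) (flip-other i≢a i≢b))
      (flip-other (λ eq → i≢a (∈-Sym⁻ x∈ (≡-trans eq (sym xa)))) (λ eq → i≢b (∈-Sym⁻ x∈ (≡-trans eq (sym xb)))))

  #fix-τ : ∀ {a b c d} → a ≢ b → c ≢ d → n ! ≤ n * (n * #fix (τ c d) (τ a b))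
  #fix-τ {a} {b} {c} {d} a≢b c≢d = ≤-trans (#sends-two-lower a≢b c≢d) (*-monoʳ-≤ n (*-monoʳ-≤ n
    (∑-mono (Sym n) (λ {x} x∈ → 𝟙-mono (sends? (two a b c d) x) (((τ c d · x) · τ a b) ≟P x) (λ { (_ , p ∷ q ∷ []) → sends-fixed x∈ p q })))))

  #fixed-lower : ∀ k g h → (#fix g h) C k ≤ #fixed k g h
  #fixed-lower k g h = begin
    (#fix g h) C k                     ≡⟨ cong (_C k) (length-filter fixed? (Sym n)) ⟨
    length Fixed C k                   ≡⟨ length-choose k Fixed ⟨
    length (choose k Fixed)            ≡⟨ ∑-1 (choose k Fixed) ⟨
    ∑ (choose k Fixed) (λ _ → 1)       ≡⟨ ∑-cong (choose k Fixed) (λ {S} S∈ → sym (𝟙-yes (sameSet? (act g h S) S) (pointwise S (choose-⊆ k Fixed S∈)))) ⟩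
    ∑ (choose k Fixed) (λ S → 𝟙 (sameSet? (act g h S) S))   ≤⟨ ∑-choose-filter-≤ fixed? _ k (Sym n) ⟩
    #fixed k g h                       ∎
    where
    open ≤-Reasoning
    fixed? : ∀ x → Dec ((g · x) · h ≡ x)
    fixed? x = ((g · x) · h) ≟P x
    Fixed : List (Perm n)
    Fixed = filter fixed? (Sym n)
    unchanged : ∀ S → (∀ {x} → x ∈ S → x ∈ Fixed) → act g h S ≡ S
    unchanged [] _ = refl
    unchanged (x ∷ S) ⊆F = cong₂ _∷_ (proj₂ (∈ₚ.∈-filter⁻ fixed? {xs = Sym n} (⊆F (here refl)))) (unchanged S (⊆F ∘ there))
    pointwise : ∀ S → (∀ {x} → x ∈ S → x ∈ Fixed) → SameSet (act g h S) S
    pointwise S ⊆F = subst (λ S′ → SameSet S′ S) (sym (unchanged S ⊆F)) (SameSet-refl S)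

  -- Transpositions are indexed by two-element sublists, so that each occurs once; the fallback `ε`
  -- is for lists with fewer than two entries.
  τ₂ : List (Fin n) → Perm n
  τ₂ (a ∷ b ∷ _) = τ a b
  τ₂ _           = ε

  pairs : List (List (Fin n))
  pairs = choose 2 (allFin n)

  distinct : ∀ {S} → S ∈ pairs → ∃ λ a → ∃ λ b → S ≡ a ∷ b ∷ [] × a ≢ b
  distinct {S} S∈ with S | choose-length 2 (allFin n) S∈ | choose-Unique 2 (Uniqueₚ.allFin⁺ n) S∈
  ... | a ∷ b ∷ [] | _ | (a≢b ∷ []) ∷ _ = a , b , refl , a≢b

  moves : ∀ {a b i} → a ≢ b → i ∈ a ∷ b ∷ [] → lookup (τ a b) i ≢ i
  moves {a} {b} a≢b (here refl) eq = a≢b (≡-trans (sym eq) (≡-trans (lookup-τ a b a) (flip-left a b)))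
  moves {a} {b} a≢b (there (here refl)) eq = a≢b (≡-trans (sym (flip-right a b)) (≡-trans (sym (lookup-τ a b b)) eq))

  moves⁻ : ∀ {a b i} → lookup (τ a b) i ≢ i → i ∈ a ∷ b ∷ []
  moves⁻ {a} {b} {i} ne with i ≟F a | i ≟F b
  ... | yes refl | _        = here refl
  ... | no _     | yes refl = there (here refl)
  ... | no i≢a   | no i≢b   = contradiction (≡-trans (lookup-τ a b i) (flip-other i≢a i≢b)) ne

  τ₂-∈ : ∀ {S} → S ∈ pairs → τ₂ S ∈ Sym n
  τ₂-∈ S∈ with distinct S∈
  ... | a , b , refl , _ = τ-∈ a b

  τ₂≢ε : ∀ {S} → S ∈ pairs → τ₂ S ≢ ε
  τ₂≢ε S∈ eq with distinct S∈
  ... | a , b , refl , a≢b = moves a≢b (here refl) (≡-trans (cong (λ w → lookup w a) eq) (lookup-ε a))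

  τ₂-injective : ∀ {S S′} → S ∈ pairs → S′ ∈ pairs → τ₂ S ≡ τ₂ S′ → S ≡ S′
  τ₂-injective S∈ S′∈ eq = Cover.choose-ext _≟F_ 2 (Uniqueₚ.allFin⁺ n) S∈ S′∈ (half S∈ S′∈ eq) (half S′∈ S∈ (sym eq))
    where
    half : ∀ {S S′} → S ∈ pairs → S′ ∈ pairs → τ₂ S ≡ τ₂ S′ → ∀ {i} → i ∈ S → i ∈ S′
    half S∈ S′∈ eq {i} i∈ with distinct S∈ | distinct S′∈
    ... | a , b , refl , a≢b | c , d , refl , _ = moves⁻ (λ fx → moves a≢b i∈ (≡-trans (cong (λ w → lookup w i) eq) fx))

  module _ (3n²≤N : 3 * (n * n) ≤ n !) (2≤n : 2 ≤ n) where

    private instance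
      n≢0 : NonZero n
      n≢0 = >-nonZero (≤-trans (s≤s z≤n) 2≤n)
      n²≢0 : NonZero (n * n)
      n²≢0 = ℕₚ.m*n≢0 n n

    n⁶ : ℕ
    n⁶ = (n * n) * ((n * n) * (n * n))

    -- At least f³ / 27 triples consist of fixed permutations, where f ≥ N / n². The assumption 3n²
    -- ≤ N guarantees f ≥ 3, from which on this bound for C(f, 3) is valid.
    #fixed-τ : ∀ {S S′} → S ∈ pairs → S′ ∈ pairs → N³ ≤ n⁶ * (27 * #fixed 3 (τ₂ S) (τ₂ S′))
    #fixed-τ {S} {S′} S∈ S′∈ with distinct S∈ | distinct S′∈
    ... | c , d , refl , c≢d | a , b , refl , a≢b = begin
      n ! * (n ! * n !)                                   ≤⟨ *-mono-≤ low (*-mono-≤ low low) ⟩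
      (n * n * f) * ((n * n * f) * (n * n * f))           ≡⟨ regroup (n * n) f ⟩
      n⁶ * (f * (f * f))                                  ≤⟨ *-monoʳ-≤ n⁶ (C3-lower {f} 3≤f) ⟩
      n⁶ * (27 * (f C 3))                                 ≤⟨ *-monoʳ-≤ n⁶ (*-monoʳ-≤ 27 (#fixed-lower 3 (τ c d) (τ a b))) ⟩
      n⁶ * (27 * #fixed 3 (τ c d) (τ a b))                ∎
      where
      open ≤-Reasoning
      f : ℕ
      f = #fix (τ c d) (τ a b)
      low : n ! ≤ n * n * f
      low = ≤-trans (#fix-τ a≢b c≢d) (≤-reflexive (sym (*-assoc n n f)))
      3≤f : 3 ≤ f
      3≤f = ℕₚ.*-cancelʳ-≤ 3 f (n * n) (≤-trans 3n²≤N (≤-trans low (≤-reflexive (*-comm (n * n) f))))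
      regroup : ∀ m f → (m * f) * ((m * f) * (m * f)) ≡ (m * (m * m)) * (f * (f * f))
      regroup = solve-∀

    ∑-pairs≤excess : ∑ pairs (λ S → ∑ pairs (λ S′ → #fixed 3 (τ₂ S) (τ₂ S′))) ≤ excess 3
    ∑-pairs≤excess = begin
      ∑ pairs (λ S → ∑ pairs (λ S′ → #fixed 3 (τ₂ S) (τ₂ S′)))
        ≡⟨ ∑-cong pairs (λ {S} S∈ → ∑-cong pairs (λ {S′} _ → sym (≡-trans
             (cong (_* #fixed 3 (τ₂ S) (τ₂ S′)) (𝟙-yes (nonTrivial? (τ₂ S) (τ₂ S′)) (λ e → τ₂≢ε S∈ (proj₁ e)))) (+-identityʳ _)))) ⟩
      ∑ pairs (λ S → ∑ pairs (λ S′ → F (τ₂ S) (τ₂ S′)))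
        ≤⟨ ∑-mono pairs (λ {S} _ → ∑-reindex-≤ _≟P_ uPairs τ₂ (F (τ₂ S)) τ₂-∈ τ₂-injective) ⟩
      ∑ pairs (λ S → ∑ (Sym n) (F (τ₂ S)))
        ≤⟨ ∑-reindex-≤ _≟P_ uPairs τ₂ (λ g → ∑ (Sym n) (F g)) τ₂-∈ τ₂-injective ⟩
      excess 3 ∎
      where
      open ≤-Reasoning
      uPairs : Unique pairs
      uPairs = Unique-choose (Uniqueₚ.allFin⁺ n) 2
      F : Perm n → Perm n → ℕ
      F g h = 𝟙 (nonTrivial? g h) * #fixed 3 g h

    n²≤4C : n * n ≤ 4 * length pairs
    n²≤4C = ≤-trans (go n 2≤n) (≤-reflexive (cong (4 *_) (sym (≡-trans (length-choose 2 (allFin n)) (cong (_C 2) (length-allFin n))))))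
      where
      go : ∀ n → 2 ≤ n → n * n ≤ 4 * (n C 2)
      go (suc (suc m)) _ = begin
        (2 + m) * (2 + m)                 ≤⟨ m≤m+n _ ((2 + m) * m) ⟩
        (2 + m) * (2 + m) + (2 + m) * m   ≡⟨ identity m ⟩
        2 * ((2 + m) * (1 + m))           ≡⟨ cong (λ x → 2 * ((2 + m) * x)) (nC1≡n (1 + m)) ⟨
        2 * ((2 + m) * ((1 + m) C 1))     ≡⟨ cong (2 *_) (C-absorption (1 + m) 1) ⟨
        2 * (2 * ((2 + m) C 2))           ≡⟨ *-assoc 2 2 ((2 + m) C 2) ⟨
        4 * ((2 + m) C 2)                 ∎
        where
        open ≤-Reasoning
        identity : ∀ m → (2 + m) * (2 + m) + (2 + m) * m ≡ 2 * ((2 + m) * (1 + m))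
        identity = solve-∀
      go (suc zero) (s≤s ())

    -- There are at least n² / 4 transpositions, hence n⁴ / 16 pairs, each fixing at least N³ / (27
    -- n⁶) triples. This gives N³ / (432 n²) with 432 = 16 · 27, and C(N, 3) ≤ N³.
    excess-lower : n ! C 3 ≤ 432 * (n * n * excess 3)
    excess-lower = ≤-trans (≤-trans (C-drop₃ (n !) 0) (≤-reflexive (*-identityʳ N³)))
      (ℕₚ.*-cancelʳ-≤ N³ (432 * (n * n * excess 3)) ((n * n) * (n * n)) {{ℕₚ.m*n≢0 (n * n) (n * n)}} (begin
        N³ * ((n * n) * (n * n))              ≤⟨ *-monoʳ-≤ N³ (*-mono-≤ n²≤4C n²≤4C) ⟩
        N³ * ((4 * m) * (4 * m))              ≡⟨ regroup₁ N³ m ⟩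
        16 * (m * (m * N³))                   ≤⟨ *-monoʳ-≤ 16 all-pairs ⟩
        16 * (n⁶ * (27 * excess 3))           ≡⟨ regroup₂ (n * n) (excess 3) ⟩
        432 * (n * n * excess 3) * ((n * n) * (n * n)) ∎))
      where
      open ≤-Reasoning
      m : ℕ
      m = length pairs
      regroup₁ : ∀ x m → x * ((4 * m) * (4 * m)) ≡ 16 * (m * (m * x))
      regroup₁ = solve-∀
      regroup₂ : ∀ q e → 16 * ((q * (q * q)) * (27 * e)) ≡ 432 * (q * e) * (q * q)
      regroup₂ = solve-∀
      all-pairs : m * (m * N³) ≤ n⁶ * (27 * excess 3)
      all-pairs = begin
        m * (m * N³)
          ≡⟨ ≡-trans (∑-const _ pairs) (cong (m *_) (∑-const N³ pairs)) ⟨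
        ∑ pairs (λ _ → ∑ pairs (λ _ → N³))
          ≤⟨ ∑-mono pairs (λ S∈ → ∑-mono pairs (λ S′∈ → #fixed-τ S∈ S′∈)) ⟩
        ∑ pairs (λ S → ∑ pairs (λ S′ → n⁶ * (27 * #fixed 3 (τ₂ S) (τ₂ S′))))
          ≡⟨ ≡-trans (∑-cong pairs (λ _ → ≡-trans (∑-cong pairs (λ _ → sym (*-assoc n⁶ 27 _))) (∑-*ˡ (n⁶ * 27) _ pairs))) (∑-*ˡ (n⁶ * 27) _ pairs) ⟩
        n⁶ * 27 * ∑ pairs (λ S → ∑ pairs (λ S′ → #fixed 3 (τ₂ S) (τ₂ S′)))
          ≤⟨ *-monoʳ-≤ (n⁶ * 27) ∑-pairs≤excess ⟩
        n⁶ * 27 * excess 3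
          ≡⟨ *-assoc n⁶ 27 (excess 3) ⟩
        n⁶ * (27 * excess 3) ∎

-- Rational arithmetic

toℚᵘ-ℕ : ∀ m → ℚ.toℚᵘ (ℕtoℚ m) ℚᵘ.≃ mkℚᵘ (ℤ.+ m) 0
toℚᵘ-ℕ m = ℚₚ.toℚᵘ-fromℚᵘ (mkℚᵘ (ℤ.+ m) 0)

ℕtoℚ-+ : ∀ a b → ℕtoℚ (a + b) ≡ ℕtoℚ a ℚ.+ ℕtoℚ b
ℕtoℚ-+ a b = ℚₚ.toℚᵘ-injective (begin
  ℚ.toℚᵘ (ℕtoℚ (a + b))                          ≈⟨ toℚᵘ-ℕ (a + b) ⟩
  mkℚᵘ (ℤ.+ (a + b)) 0                             ≈⟨ *≡* (cong (ℤ._* ℤ.+ 1) (≡-trans (ℤₚ.pos-+ a b) (sym (cong₂ ℤ._+_ (ℤₚ.*-identityʳ (ℤ.+ a)) (ℤₚ.*-identityʳ (ℤ.+ b)))))) ⟩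
  mkℚᵘ (ℤ.+ a) 0 ℚᵘ.+ mkℚᵘ (ℤ.+ b) 0                 ≈⟨ ℚᵘₚ.+-cong (toℚᵘ-ℕ a) (toℚᵘ-ℕ b) ⟨
  ℚ.toℚᵘ (ℕtoℚ a) ℚᵘ.+ ℚ.toℚᵘ (ℕtoℚ b)           ≈⟨ ℚₚ.toℚᵘ-homo-+ (ℕtoℚ a) (ℕtoℚ b) ⟨
  ℚ.toℚᵘ (ℕtoℚ a ℚ.+ ℕtoℚ b)                     ∎)
  where open ℚᵘₚ.≃-Reasoning

ℕtoℚ-* : ∀ a b → ℕtoℚ (a * b) ≡ ℕtoℚ a ℚ.* ℕtoℚ b
ℕtoℚ-* a b = ℚₚ.toℚᵘ-injective (begin
  ℚ.toℚᵘ (ℕtoℚ (a * b))                          ≈⟨ toℚᵘ-ℕ (a * b) ⟩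
  mkℚᵘ (ℤ.+ (a * b)) 0                             ≈⟨ *≡* (cong (ℤ._* ℤ.+ 1) (ℤₚ.pos-* a b)) ⟩
  mkℚᵘ (ℤ.+ a) 0 ℚᵘ.* mkℚᵘ (ℤ.+ b) 0                 ≈⟨ ℚᵘₚ.*-cong (toℚᵘ-ℕ a) (toℚᵘ-ℕ b) ⟨
  ℚ.toℚᵘ (ℕtoℚ a) ℚᵘ.* ℚ.toℚᵘ (ℕtoℚ b)           ≈⟨ ℚₚ.toℚᵘ-homo-* (ℕtoℚ a) (ℕtoℚ b) ⟨
  ℚ.toℚᵘ (ℕtoℚ a ℚ.* ℕtoℚ b)                     ∎)
  where open ℚᵘₚ.≃-Reasoning

ℕtoℚ-mono : ∀ {a b} → a ≤ b → ℕtoℚ a ℚ.≤ ℕtoℚ b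
ℕtoℚ-mono {a} {b} a≤b = ℚₚ.toℚᵘ-cancel-≤ (ℚᵘₚ.≤-respˡ-≃ (ℚᵘₚ.≃-sym (toℚᵘ-ℕ a)) (ℚᵘₚ.≤-respʳ-≃ (ℚᵘₚ.≃-sym (toℚᵘ-ℕ b))
  (*≤* (ℤₚ.*-monoʳ-≤-nonNeg (ℤ.+ 1) (ℤ.+≤+ a≤b)))))

ℕtoℚ-cancel : ∀ {a b} → ℕtoℚ a ℚ.≤ ℕtoℚ b → a ≤ b
ℕtoℚ-cancel {a} {b} le with ℚᵘₚ.≤-respˡ-≃ (toℚᵘ-ℕ a) (ℚᵘₚ.≤-respʳ-≃ (toℚᵘ-ℕ b) (ℚₚ.toℚᵘ-mono-≤ le))
... | *≤* le′ = ℤₚ.drop‿+≤+ (ℤₚ.*-cancelʳ-≤-pos (ℤ.+ a) (ℤ.+ b) (ℤ.+ 1) le′)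

ℕtoℚ-nonNeg : ∀ a → ℚ.NonNegative (ℕtoℚ a)
ℕtoℚ-nonNeg a = ℚ.nonNegative (ℕtoℚ-mono {0} {a} z≤n)

ℕtoℚ-pos : ∀ {a} → 1 ≤ a → ℚ.Positive (ℕtoℚ a)
ℕtoℚ-pos {a} 1≤a = ℚ.positive (ℚₚ.<-≤-trans (ℚ.*<* (ℤ.+<+ (s≤s z≤n))) (ℕtoℚ-mono {1} {a} 1≤a))

positive⇒≢0 : ∀ {q} → ℚ.Positive q → q ≢ 0ℚ
positive⇒≢0 {q} pos eq = ℚₚ.<-irrefl (sym eq) (ℚₚ.positive⁻¹ q {{pos}})

//-*-cancel : ∀ p q → q ≢ 0ℚ → (p // q) ℚ.* q ≡ p
//-*-cancel p q q≢0 with q ℚₚ.≟ 0ℚ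
... | yes q≡0 = contradiction q≡0 q≢0
... | no q≢0′ = ≡-trans (ℚₚ.*-assoc p _ q) (≡-trans (cong (p ℚ.*_) (ℚₚ.*-inverseˡ q {{ℚ.≢-nonZero q≢0′}})) (ℚₚ.*-identityʳ p))

ℕtoℚ-^ : ∀ a q → ℕtoℚ (a ^ q) ≡ ℕtoℚ a ^ℚ q
ℕtoℚ-^ a zero    = refl
ℕtoℚ-^ a (suc q) = ≡-trans (ℕtoℚ-* a (a ^ q)) (cong (ℕtoℚ a ℚ.*_) (ℕtoℚ-^ a q))

*-mono-≤-nonNeg : ∀ {a b c d} → 0ℚ ℚ.≤ b → 0ℚ ℚ.≤ c → a ℚ.≤ b → c ℚ.≤ d → a ℚ.* c ℚ.≤ b ℚ.* d
*-mono-≤-nonNeg {a} {b} {c} {d} 0≤b 0≤c a≤b c≤d = ℚₚ.≤-trans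
  (ℚₚ.*-monoʳ-≤-nonNeg c {{ℚ.nonNegative 0≤c}} a≤b) (ℚₚ.*-monoˡ-≤-nonNeg b {{ℚ.nonNegative 0≤b}} c≤d)

^ℚ-nonNeg : ∀ {x} q → 0ℚ ℚ.≤ x → 0ℚ ℚ.≤ x ^ℚ q
^ℚ-nonNeg zero    _   = ℕtoℚ-mono {0} {1} z≤n
^ℚ-nonNeg {x} (suc q) 0≤x = ℚₚ.nonNegative⁻¹ (x ℚ.* (x ^ℚ q))
  {{ℚₚ.nonNeg*nonNeg⇒nonNeg x {{ℚ.nonNegative 0≤x}} (x ^ℚ q) {{ℚ.nonNegative (^ℚ-nonNeg q 0≤x)}}}}

^ℚ-mono : ∀ {x y} q → 0ℚ ℚ.≤ x → x ℚ.≤ y → x ^ℚ q ℚ.≤ y ^ℚ q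
^ℚ-mono zero    _   _   = ℚₚ.≤-refl
^ℚ-mono (suc q) 0≤x x≤y = *-mono-≤-nonNeg (ℚₚ.≤-trans 0≤x x≤y) (^ℚ-nonNeg q 0≤x) x≤y (^ℚ-mono q 0≤x x≤y)

^ℚ-* : ∀ x y q → (x ℚ.* y) ^ℚ q ≡ (x ^ℚ q) ℚ.* (y ^ℚ q)
^ℚ-* x y zero    = refl
^ℚ-* x y (suc q) = ≡-trans (cong (x ℚ.* y ℚ.*_) (^ℚ-* x y q))
  (solve 4 (λ a b c d → (a :* b) :* (c :* d) := (a :* c) :* (b :* d)) refl x y (x ^ℚ q) (y ^ℚ q))
  where open +-*-Solver

1^ℚ : ∀ q → 1ℚ ^ℚ q ≡ 1ℚ
1^ℚ zero    = refl
1^ℚ (suc q) = ≡-trans (ℚₚ.*-identityˡ (1ℚ ^ℚ q)) (1^ℚ q)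

-- Denominators are at least 1, so the absolute value of the numerator is an upper bound.
≤ℕ : ∀ q → ∃ λ c → q ℚ.≤ ℕtoℚ c
≤ℕ q = ℤ.∣ ℚ.↥ q ∣ , ℚₚ.toℚᵘ-cancel-≤ (ℚᵘₚ.≤-respʳ-≃ (ℚᵘₚ.≃-sym (toℚᵘ-ℕ ℤ.∣ ℚ.↥ q ∣)) (bound q))
  where
  bound : ∀ q → ℚ.toℚᵘ q ℚᵘ.≤ mkℚᵘ (ℤ.+ ℤ.∣ ℚ.↥ q ∣) 0
  bound (ℚ.mkℚ (ℤ.+ m) d _) = *≤* (subst₂ ℤ._≤_ (ℤₚ.pos-* m 1) (ℤₚ.pos-* m (suc d)) (ℤ.+≤+ (*-monoʳ-≤ m (s≤s z≤n))))
  bound (ℚ.mkℚ (ℤ.-[1+ m ]) d _) = *≤* ℤ.-≤+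

reciprocal-bound : ∀ ε → 0ℚ ℚ.< ε → ∃ λ d → 1ℚ ℚ.≤ ε ℚ.* ℕtoℚ d
reciprocal-bound ε 0<ε = d , (begin
  1ℚ                          ≡⟨ ℚₚ.*-inverseʳ ε ⟨
  ε ℚ.* (ℚ.1/ ε)              ≤⟨ ℚₚ.*-monoˡ-≤-nonNeg ε {{ℚₚ.pos⇒nonNeg ε}} (proj₂ (≤ℕ (ℚ.1/ ε))) ⟩
  ε ℚ.* ℕtoℚ d                ∎)
  where
  open ℚₚ.≤-Reasoning
  instance
    ε-pos : ℚ.Positive ε
    ε-pos = ℚ.positive 0<ε
    ε≢0 : ℚ.NonZero ε
    ε≢0 = ℚₚ.pos⇒nonZero ε
  d : ℕ
  d = proj₁ (≤ℕ (ℚ.1/ ε))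

-- From the excess to the relative error

open Excess using (excess; T-excess; excess-bound)

0≤err : ∀ n k → 0ℚ ℚ.≤ err n k
0≤err n k = ℚₚ.0≤∣p∣ ((ℕtoℚ (T n k) // Λ n k) ℚ.- 1ℚ)

-- T/Λ - 1 is exactly the excess divided by C(N, k), a nonnegative number, so the absolute value
-- costs nothing and bounds carry over in both directions. k ≤ N keeps Λ nonzero, so that neither
-- division takes its default value.
err-excess : ∀ n k → k ≤ n ! → err n k ℚ.* ℕtoℚ (n ! C k) ≡ ℕtoℚ (excess n k)
err-excess n k k≤N = begin
  ℚ.∣ x ℚ.- 1ℚ ∣ ℚ.* b          ≡⟨ cong (ℚ.∣ x ℚ.- 1ℚ ∣ ℚ.*_) (ℚₚ.0≤p⇒∣p∣≡p (ℚₚ.nonNegative⁻¹ b {{ℕtoℚ-nonNeg (n ! C k)}})) ⟨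
  ℚ.∣ x ℚ.- 1ℚ ∣ ℚ.* ℚ.∣ b ∣    ≡⟨ ℚₚ.∣p*q∣≡∣p∣*∣q∣ (x ℚ.- 1ℚ) b ⟨
  ℚ.∣ (x ℚ.- 1ℚ) ℚ.* b ∣        ≡⟨ cong ℚ.∣_∣ difference ⟩
  ℚ.∣ e ∣                       ≡⟨ ℚₚ.0≤p⇒∣p∣≡p (ℚₚ.nonNegative⁻¹ e {{ℕtoℚ-nonNeg (excess n k)}}) ⟩
  e                             ∎
  where
  open ≡-Reasoning
  open +-*-Solver
  b e M x t : ℚ
  b = ℕtoℚ (n ! C k)
  e = ℕtoℚ (excess n k)
  M = ℕtoℚ (n ! * n !)
  t = ℕtoℚ (T n k)
  x = t // Λ n k
  b≢0 : b ≢ 0ℚ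
  b≢0 = positive⇒≢0 (ℕtoℚ-pos (C-pos k≤N))
  M≢0 : M ≢ 0ℚ
  M≢0 = positive⇒≢0 (ℕtoℚ-pos (*-mono-≤ (ℕₚ.1≤n! n) (ℕₚ.1≤n! n)))
  Λ*M : Λ n k ℚ.* M ≡ b
  Λ*M = //-*-cancel b M M≢0
  Λ≢0 : Λ n k ≢ 0ℚ
  Λ≢0 eq = b≢0 (≡-trans (sym Λ*M) (≡-trans (cong (ℚ._* M) eq) (ℚₚ.*-zeroˡ M)))
  x*b : x ℚ.* b ≡ b ℚ.+ e
  x*b = begin
    x ℚ.* b                     ≡⟨ cong (x ℚ.*_) Λ*M ⟨
    x ℚ.* (Λ n k ℚ.* M)         ≡⟨ ℚₚ.*-assoc x (Λ n k) M ⟨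
    x ℚ.* Λ n k ℚ.* M           ≡⟨ cong (ℚ._* M) (//-*-cancel t (Λ n k) Λ≢0) ⟩
    t ℚ.* M                     ≡⟨ ℕtoℚ-* (T n k) (n ! * n !) ⟨
    ℕtoℚ (T n k * (n ! * n !))  ≡⟨ cong ℕtoℚ (T-excess n k) ⟩
    ℕtoℚ (n ! C k + excess n k) ≡⟨ ℕtoℚ-+ (n ! C k) (excess n k) ⟩
    b ℚ.+ e                     ∎
  difference : (x ℚ.- 1ℚ) ℚ.* b ≡ e
  difference = begin
    (x ℚ.- 1ℚ) ℚ.* b            ≡⟨ solve 2 (λ x b → (x :- con 1ℚ) :* b := x :* b :- b) refl x b ⟩
    x ℚ.* b ℚ.- b               ≡⟨ cong (ℚ._- b) x*b ⟩
    b ℚ.+ e ℚ.- b               ≡⟨ solve 2 (λ b e → b :+ e :- b := e) refl b e ⟩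
    e                           ∎

module _ (n k : ℕ) (k≤N : k ≤ n !) where

  private
    b : ℚ
    b = ℕtoℚ (n ! C k)
    instance
      b-pos : ℚ.Positive b
      b-pos = ℕtoℚ-pos (C-pos k≤N)

  err-upper : ∀ {K} → n * n * excess n k ≤ K * (n ! C k) → err n k ℚ.* ℕtoℚ (n * n) ℚ.≤ ℕtoℚ K
  err-upper {K} le = ℚₚ.*-cancelʳ-≤-pos b (begin
    err n k ℚ.* ℕtoℚ (n * n) ℚ.* b    ≡⟨ solve 3 (λ x m b → x :* m :* b := m :* (x :* b)) refl (err n k) (ℕtoℚ (n * n)) b ⟩
    ℕtoℚ (n * n) ℚ.* (err n k ℚ.* b)  ≡⟨ cong (ℕtoℚ (n * n) ℚ.*_) (err-excess n k k≤N) ⟩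
    ℕtoℚ (n * n) ℚ.* ℕtoℚ (excess n k) ≡⟨ ℕtoℚ-* (n * n) (excess n k) ⟨
    ℕtoℚ (n * n * excess n k)         ≤⟨ ℕtoℚ-mono le ⟩
    ℕtoℚ (K * (n ! C k))              ≡⟨ ℕtoℚ-* K (n ! C k) ⟩
    ℕtoℚ K ℚ.* b                      ∎)
    where
    open ℚₚ.≤-Reasoning
    open +-*-Solver

  err-lower : ∀ {K} → n ! C k ≤ K * excess n k → 1ℚ ℚ.≤ ℕtoℚ K ℚ.* err n k
  err-lower {K} le = ℚₚ.*-cancelʳ-≤-pos b (begin
    1ℚ ℚ.* b                          ≡⟨ ℚₚ.*-identityˡ b ⟩
    b                                 ≤⟨ ℕtoℚ-mono le ⟩
    ℕtoℚ (K * excess n k)             ≡⟨ ℕtoℚ-* K (excess n k) ⟩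
    ℕtoℚ K ℚ.* ℕtoℚ (excess n k)      ≡⟨ cong (ℕtoℚ K ℚ.*_) (err-excess n k k≤N) ⟨
    ℕtoℚ K ℚ.* (err n k ℚ.* b)        ≡⟨ ℚₚ.*-assoc (ℕtoℚ K) (err n k) b ⟨
    ℕtoℚ K ℚ.* err n k ℚ.* b          ∎)
    where open ℚₚ.≤-Reasoning

-- Every k-set is counted for every pair; this suffices for the finitely many small n.
excess-trivial : ∀ n k → excess n k ≤ n ! * n ! * (n ! C k)
excess-trivial n k = ≤-trans (∑₂-mono (λ {g} {h} _ _ → 𝟙*-≤ (nonTrivial? g h) (λ _ → #fixed≤C g h))) (≤-reflexive (∑₂-const (n ! C k)))
  where
  open Pairs n
  open Burnside n
  #fixed≤C : ∀ g h → #fixed k g h ≤ n ! C k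
  #fixed≤C g h = ≤-trans (∑-≤-const 1 (choose k (Sym n)) (λ {S} _ → 𝟙≤1 (sameSet? (act g h S) S)))
    (≤-reflexive (≡-trans (*-identityʳ (length (choose k (Sym n)))) (≡-trans (length-choose k (Sym n)) (cong (_C k) (length-Sym n)))))

5≤n⇒120≤n! : ∀ {n} → 5 ≤ n → 120 ≤ n !
5≤n⇒120≤n! = !-mono

UpperBound : ℕ → Set
UpperBound K = ∀ n k → 1 ≤ n → 3 ≤ k → k ≤ n ! ∸ 3 → n * n * excess n k ≤ K * (n ! C k)

-- For n < n₀ the trivial bound stays within a constant depending on n₀ only, and this constant is
-- added to the one for large n.
uniform-bound : ∀ n₀ → 4 * Kₘ ≤ n₀ → 5 ≤ n₀ → UpperBound (4000 * Kₜ + n₀ * n₀ * (n₀ ! * n₀ !))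
uniform-bound n₀ 4Kₘ≤n₀ 5≤n₀ n k 1≤n 3≤k k≤ = bySize (n₀ ≤? n)
  where
  open ≤-Reasoning
  bySize : Dec (n₀ ≤ n) → n * n * excess n k ≤ (4000 * Kₜ + n₀ * n₀ * (n₀ ! * n₀ !)) * (n ! C k)
  bySize (yes n₀≤n) = ≤-trans
    (excess-bound n (≤-trans 4Kₘ≤n₀ (≤-trans n₀≤n (ℕₚ.m≤m*n n n {{>-nonZero 1≤n}}))) 1≤n
      (≤-trans (m≤m+n 20 100) (5≤n⇒120≤n! (≤-trans 5≤n₀ n₀≤n))) k 3≤k k≤)
    (*-monoˡ-≤ (n ! C k) (m≤m+n (4000 * Kₜ) (n₀ * n₀ * (n₀ ! * n₀ !))))
  bySize (no n₀≰n) = begin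
    n * n * excess n k                          ≤⟨ *-mono-≤ (*-mono-≤ n≤n₀ n≤n₀) (excess-trivial n k) ⟩
    n₀ * n₀ * (n ! * n ! * (n ! C k))           ≡⟨ *-assoc (n₀ * n₀) (n ! * n !) (n ! C k) ⟨
    n₀ * n₀ * (n ! * n !) * (n ! C k)           ≤⟨ *-monoˡ-≤ (n ! C k) (*-monoʳ-≤ (n₀ * n₀) (*-mono-≤ (!-mono n≤n₀) (!-mono n≤n₀))) ⟩
    n₀ * n₀ * (n₀ ! * n₀ !) * (n ! C k)         ≤⟨ *-monoˡ-≤ (n ! C k) (m≤n+m (n₀ * n₀ * (n₀ ! * n₀ !)) (4000 * Kₜ)) ⟩
    (4000 * Kₜ + n₀ * n₀ * (n₀ ! * n₀ !)) * (n ! C k) ∎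
    where
    n≤n₀ : n ≤ n₀
    n≤n₀ = <⇒≤ (ℕₚ.≰⇒> n₀≰n)

opaque
  -- The successor makes the constant positive, as the final statement requires. Opaque for the same
  -- reason as `growth`: the witness contains the factorial of a huge number.
  upper-bound : ∃ λ K → 1 ≤ K × UpperBound K
  upper-bound = suc K , s≤s z≤n , λ n k 1≤n 3≤k k≤ → ≤-trans (uniform-bound (4 * Kₘ + 5) (m≤m+n (4 * Kₘ) 5) (m≤n+m 5 (4 * Kₘ)) n k 1≤n 3≤k k≤)
      (*-monoˡ-≤ (n ! C k) (ℕₚ.n≤1+n K))
    where
    K : ℕ
    K = 4000 * Kₜ + (4 * Kₘ + 5) * (4 * Kₘ + 5) * ((4 * Kₘ + 5) ! * (4 * Kₘ + 5) !)

K∞ : ℕ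
K∞ = proj₁ upper-bound

err-bound : ∀ n k → 1 ≤ n → 3 ≤ k → k ≤ n ! ∸ 3 → err n k ℚ.* ℕtoℚ (n * n) ℚ.≤ ℕtoℚ K∞
err-bound n k 1≤n 3≤k k≤ = err-upper n k (≤-trans k≤ (ℕₚ.m∸n≤m (n !) 3)) {K∞} (proj₂ (proj₂ upper-bound) n k 1≤n 3≤k k≤)

-- Since 2 C(N, 2) ≤ N² and T ≥ 1, the identity accounts for at most half of T N²; the excess is
-- then at least C(N, k) and the relative error at least 1. The hypothesis on binomial coefficients
-- serves k = 2 and k = N - 2 alike.
excess-pair : ∀ n k → k ≤ n ! → n ! C k ≡ n ! C 2 → n ! C k ≤ 1 * excess n k
excess-pair n k k≤N B≡ = ≤-trans (ℕₚ.+-cancelˡ-≤ Bₖ Bₖ (excess n k) (begin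
  Bₖ + Bₖ                      ≡⟨ cong₂ _+_ B≡ (≡-trans B≡ (sym (+-identityʳ (n ! C 2)))) ⟩
  2 * (n ! C 2)              ≤⟨ 2C₂≤ (n !) ⟩
  n ! * n !                  ≡⟨ *-identityˡ (n ! * n !) ⟨
  1 * (n ! * n !)            ≤⟨ *-monoˡ-≤ (n ! * n !) 1≤T ⟩
  T n k * (n ! * n !)        ≡⟨ T-excess n k ⟩
  Bₖ + excess n k             ∎)) (≤-reflexive (sym (*-identityˡ (excess n k))))
  where
  open ≤-Reasoning
  Bₖ : ℕ
  Bₖ = n ! C k
  2C₂≤ : ∀ N → 2 * (N C 2) ≤ N * N
  2C₂≤ zero    = z≤n
  2C₂≤ (suc N) = begin
    2 * (suc N C 2)     ≡⟨ C-absorption N 1 ⟩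
    suc N * (N C 1)     ≡⟨ cong (suc N *_) (nC1≡n N) ⟩
    suc N * N           ≤⟨ *-monoʳ-≤ (suc N) (ℕₚ.n≤1+n N) ⟩
    suc N * suc N       ∎
  1≤T : 1 ≤ T n k
  1≤T = ℕₚ.n≢0⇒n>0 λ T≡0 → ℕₚ.<⇒≢ (≤-trans (C-pos k≤N) (m≤m+n Bₖ (excess n k)))
    (sym (≡-trans (sym (T-excess n k)) (cong (_* (n ! * n !)) T≡0)))

2≤n! : ∀ {n} → 2 ≤ n → 2 ≤ n !
2≤n! = !-mono

no-limit : (k : ℕ → ℕ) → (∀ n → 2 ≤ n → k n ≤ n ! × n ! C k n ≡ n ! C 2) →
  ¬ ((ε : ℚ) → 0ℚ ℚ.< ε → ∃ λ (N : ℕ) → (n : ℕ) → N ≤ n → 2 ≤ n → err n (k n) ℚ.≤ ε)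
no-limit k two limit = refute (2 + N) (m≤m+n 2 N) (proj₂ (limit ℚ.½ 0<½) (2 + N) (m≤n+m N 2) (m≤m+n 2 N))
  where
  0<½ : 0ℚ ℚ.< ℚ.½
  0<½ = ℚ.*<* (ℤ.+<+ (s≤s z≤n))
  N : ℕ
  N = proj₁ (limit ℚ.½ 0<½)
  1≰½ : ¬ (1ℚ ℚ.≤ ℚ.½)
  1≰½ (ℚ.*≤* (ℤ.+≤+ (s≤s ())))
  refute : ∀ n → 2 ≤ n → ¬ (err n (k n) ℚ.≤ ℚ.½)
  refute n 2≤n small = 1≰½ (ℚₚ.≤-trans (err-lower n (k n) k≤N {1} (excess-pair n (k n) k≤N C≡))
                              (ℚₚ.≤-trans (ℚₚ.≤-reflexive (ℚₚ.*-identityˡ (err n (k n)))) small))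
    where
    k≤N : k n ≤ n !
    k≤N = proj₁ (two n 2≤n)
    C≡ : n ! C k n ≡ n ! C 2
    C≡ = proj₂ (two n 2≤n)

3n²≤n! : ∀ n → 5 ≤ n → 3 * (n * n) ≤ n !
3n²≤n! (suc (suc m)) (s≤s (s≤s 3≤m)) = ℕₚ.*-cancelʳ-≤ _ _ 2 (begin
  3 * (n * n) * 2            ≡⟨ regroup (n * n) ⟩
  n * n * 6                  ≤⟨ *-monoʳ-≤ (n * n) (!-mono 3≤m) ⟩
  n * n * m !                ≤⟨ square*!≤ m ⟩
  2 * n !                    ≡⟨ *-comm 2 (n !) ⟩
  n ! * 2                    ∎)
  where
  open ≤-Reasoning
  n : ℕ
  n = 2 + m
  regroup : ∀ x → 3 * x * 2 ≡ x * 6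
  regroup = solve-∀

err₃-lower : ∀ n → 5 ≤ n → 1ℚ ℚ.≤ ℕtoℚ (432 * (n * n)) ℚ.* err n 3
err₃-lower n 5≤n = err-lower n 3 (≤-trans (m≤m+n 3 117) (5≤n⇒120≤n! 5≤n)) {432 * (n * n)}
  (≤-trans (Transpositions.excess-lower n (3n²≤n! n 5≤n) (≤-trans (m≤m+n 2 3) 5≤n)) (≤-reflexive (sym (*-assoc 432 (n * n) (excess n 3)))))

-- A rational exponent a = p / q > 2 is expressed without roots by raising err nᵃ ≤ C to the q-th
-- power. At k = 3 the lower bound gives 1 ≤ (432 n²)^q err^q, and n^(2q + 1) ≤ n^p then forces n ≤
-- (432 c)^q = D for an integer c ≥ C, which n = 5 + D violates.
no-better-rate : (p q : ℕ) → 2 * q < p →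
  ¬ (∃ λ (C : ℚ) → 0ℚ ℚ.< C × ((n k : ℕ) → 1 ≤ n → 3 ≤ k → k ≤ n ! ∸ 3 → (err n k ^ℚ q) ℚ.* ℕtoℚ (n ^ p) ℚ.≤ C ^ℚ q))
no-better-rate p q 2q<p (C , 0<C , rate) = ℕₚ.<⇒≱ (ℕₚ.m<n+m D (s≤s (z≤n {4}))) (ℕtoℚ-cancel {n} {D} n≤D)
  where
  open ℚₚ.≤-Reasoning
  open +-*-Solver
  c D n : ℕ
  c = proj₁ (≤ℕ C)
  D = 432 ^ q * c ^ q
  n = 5 + D
  5≤n : 5 ≤ n
  5≤n = m≤m+n 5 D
  1≤n : 1 ≤ n
  1≤n = ≤-trans (m≤m+n 1 4) 5≤n
  3≤N∸3 : 3 ≤ n ! ∸ 3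
  3≤N∸3 = ≤-trans (m≤m+n 3 114) (ℕₚ.∸-monoˡ-≤ 3 (5≤n⇒120≤n! 5≤n))
  E : ℚ
  E = err n 3
  1≤^ : 1ℚ ℚ.≤ (ℕtoℚ (432 * (n * n)) ^ℚ q) ℚ.* (E ^ℚ q)
  1≤^ = begin
    1ℚ                                              ≡⟨ 1^ℚ q ⟨
    1ℚ ^ℚ q                                         ≤⟨ ^ℚ-mono q (ℕtoℚ-mono {0} {1} z≤n) (err₃-lower n 5≤n) ⟩
    (ℕtoℚ (432 * (n * n)) ℚ.* E) ^ℚ q               ≡⟨ ^ℚ-* (ℕtoℚ (432 * (n * n))) E q ⟩
    (ℕtoℚ (432 * (n * n)) ^ℚ q) ℚ.* (E ^ℚ q)        ∎
  powers : n * (432 * (n * n)) ^ q ≤ 432 ^ q * n ^ p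
  powers = ≤R.begin
    n * (432 * (n * n)) ^ q                         ≤R.≡⟨ cong (n *_) (^-distribʳ-* q 432 (n * n)) ⟩
    n * (432 ^ q * (n * n) ^ q)                     ≤R.≡⟨ cong (λ m → n * (432 ^ q * m)) (≡-trans (^-distribʳ-* q n n) (≡-trans (sym (ℕₚ.^-distribˡ-+-* n q q)) (cong (λ m → n ^ (q + m)) (sym (+-identityʳ q))))) ⟩
    n * (432 ^ q * n ^ (2 * q))                     ≤R.≡⟨ *-exchange n (432 ^ q) (n ^ (2 * q)) ⟩
    432 ^ q * (n * n ^ (2 * q))                     ≤R.≤⟨ *-monoʳ-≤ (432 ^ q) (ℕₚ.^-monoʳ-≤ n {{>-nonZero 1≤n}} 2q<p) ⟩
    432 ^ q * n ^ p                                 ≤R.∎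
    where
    module ≤R = ≤-Reasoning
  n≤D : ℕtoℚ n ℚ.≤ ℕtoℚ D
  n≤D = begin
    ℕtoℚ n                                                          ≡⟨ ℚₚ.*-identityʳ (ℕtoℚ n) ⟨
    ℕtoℚ n ℚ.* 1ℚ                                                   ≤⟨ ℚₚ.*-monoˡ-≤-nonNeg (ℕtoℚ n) {{ℕtoℚ-nonNeg n}} 1≤^ ⟩
    ℕtoℚ n ℚ.* ((ℕtoℚ (432 * (n * n)) ^ℚ q) ℚ.* (E ^ℚ q))           ≡⟨ ℚₚ.*-assoc (ℕtoℚ n) (ℕtoℚ (432 * (n * n)) ^ℚ q) (E ^ℚ q) ⟨
    ℕtoℚ n ℚ.* (ℕtoℚ (432 * (n * n)) ^ℚ q) ℚ.* (E ^ℚ q)             ≡⟨ cong (ℚ._* (E ^ℚ q)) (≡-trans (cong (ℕtoℚ n ℚ.*_) (sym (ℕtoℚ-^ (432 * (n * n)) q))) (sym (ℕtoℚ-* n ((432 * (n * n)) ^ q)))) ⟩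
    ℕtoℚ (n * (432 * (n * n)) ^ q) ℚ.* (E ^ℚ q)                     ≤⟨ ℚₚ.*-monoʳ-≤-nonNeg (E ^ℚ q) {{ℚ.nonNegative (^ℚ-nonNeg q (0≤err n 3))}} (ℕtoℚ-mono powers) ⟩
    ℕtoℚ (432 ^ q * n ^ p) ℚ.* (E ^ℚ q)                             ≡⟨ cong (ℚ._* (E ^ℚ q)) (ℕtoℚ-* (432 ^ q) (n ^ p)) ⟩
    ℕtoℚ (432 ^ q) ℚ.* ℕtoℚ (n ^ p) ℚ.* (E ^ℚ q)                    ≡⟨ solve 3 (λ a b e → a :* b :* e := a :* (e :* b)) refl (ℕtoℚ (432 ^ q)) (ℕtoℚ (n ^ p)) (E ^ℚ q) ⟩
    ℕtoℚ (432 ^ q) ℚ.* ((E ^ℚ q) ℚ.* ℕtoℚ (n ^ p))                  ≤⟨ ℚₚ.*-monoˡ-≤-nonNeg (ℕtoℚ (432 ^ q)) {{ℕtoℚ-nonNeg (432 ^ q)}} (rate n 3 1≤n ≤-refl 3≤N∸3) ⟩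
    ℕtoℚ (432 ^ q) ℚ.* (C ^ℚ q)                                     ≤⟨ ℚₚ.*-monoˡ-≤-nonNeg (ℕtoℚ (432 ^ q)) {{ℕtoℚ-nonNeg (432 ^ q)}} (^ℚ-mono q (ℚₚ.<⇒≤ 0<C) (proj₂ (≤ℕ C))) ⟩
    ℕtoℚ (432 ^ q) ℚ.* (ℕtoℚ c ^ℚ q)                                ≡⟨ cong (ℕtoℚ (432 ^ q) ℚ.*_) (sym (ℕtoℚ-^ c q)) ⟩
    ℕtoℚ (432 ^ q) ℚ.* ℕtoℚ (c ^ q)                                 ≡⟨ ℕtoℚ-* (432 ^ q) (c ^ q) ⟨
    ℕtoℚ D                                                          ∎

theorem1p1 : ((ε : ℚ) → 0ℚ Data.Rational.< ε →
    ∃ λ (N : ℕ) → (n k : ℕ) → N Data.Nat.≤ n → 1 Data.Nat.≤ n →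
    3 Data.Nat.≤ k → k Data.Nat.≤ n ! ∸ 3 → err n k Data.Rational.≤ ε)
    × (∃ λ (C : ℚ) → 0ℚ Data.Rational.< C ×
    ((n k : ℕ) → 1 Data.Nat.≤ n → 3 Data.Nat.≤ k → k Data.Nat.≤ n ! ∸ 3 →
    err n k Data.Rational.≤ C // ℕtoℚ (n Data.Nat.* n)))
    × ¬ ((ε : ℚ) → 0ℚ Data.Rational.< ε →
    ∃ λ (N : ℕ) → (n : ℕ) → N Data.Nat.≤ n → 2 Data.Nat.≤ n → err n 2 Data.Rational.≤ ε)
    × ¬ ((ε : ℚ) → 0ℚ Data.Rational.< ε →
    ∃ λ (N : ℕ) → (n : ℕ) → N Data.Nat.≤ n → 2 Data.Nat.≤ n →
    err n (n ! ∸ 2) Data.Rational.≤ ε)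
    × ((p q : ℕ) → 1 Data.Nat.≤ q → 2 Data.Nat.* q Data.Nat.< p →
    ¬ (∃ λ (C : ℚ) → 0ℚ Data.Rational.< C ×
    ((n k : ℕ) → 1 Data.Nat.≤ n → 3 Data.Nat.≤ k → k Data.Nat.≤ n ! ∸ 3 →
    (err n k ^ℚ q) Data.Rational.* ℕtoℚ (n ^ p) Data.Rational.≤ C ^ℚ q)))
theorem1p1 = uniform , rate ,
  no-limit (λ _ → 2) (λ n 2≤n → 2≤n! 2≤n , refl) ,
  no-limit (λ n → n ! ∸ 2) (λ n 2≤n → ℕₚ.m∸n≤m (n !) 2 , sym (nCk≡nC[n∸k] (2≤n! 2≤n))) ,
  (λ p q _ → no-better-rate p q)
  where
  open ℚₚ.≤-Reasoning
  m-pos : ∀ {n} → 1 ≤ n → ℚ.Positive (ℕtoℚ (n * n))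
  m-pos 1≤n = ℕtoℚ-pos (*-mono-≤ 1≤n 1≤n)
  rate : ∃ λ C → 0ℚ ℚ.< C × ((n k : ℕ) → 1 ≤ n → 3 ≤ k → k ≤ n ! ∸ 3 → err n k ℚ.≤ C // ℕtoℚ (n * n))
  rate = ℕtoℚ K∞ , ℚₚ.positive⁻¹ (ℕtoℚ K∞) {{ℕtoℚ-pos (proj₁ (proj₂ upper-bound))}} , λ n k 1≤n 3≤k k≤ →
    ℚₚ.*-cancelʳ-≤-pos (ℕtoℚ (n * n)) {{m-pos 1≤n}} (ℚₚ.≤-trans (err-bound n k 1≤n 3≤k k≤)
      (ℚₚ.≤-reflexive (sym (//-*-cancel (ℕtoℚ K∞) (ℕtoℚ (n * n)) (positive⇒≢0 (m-pos 1≤n))))))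
  uniform : (ε : ℚ) → 0ℚ ℚ.< ε → ∃ λ N → (n k : ℕ) → N ≤ n → 1 ≤ n → 3 ≤ k → k ≤ n ! ∸ 3 → err n k ℚ.≤ ε
  -- d is at least 1 / ε, and n ≥ K∞ d already gives n² ≥ K∞ d, hence K∞ / n² ≤ ε.
  uniform ε 0<ε = K∞ * d , λ n k N≤n 1≤n 3≤k k≤ → ℚₚ.*-cancelʳ-≤-pos (ℕtoℚ (n * n)) {{m-pos 1≤n}} (begin
    err n k ℚ.* ℕtoℚ (n * n)        ≤⟨ err-bound n k 1≤n 3≤k k≤ ⟩
    ℕtoℚ K∞                         ≡⟨ ℚₚ.*-identityʳ (ℕtoℚ K∞) ⟨
    ℕtoℚ K∞ ℚ.* 1ℚ                  ≤⟨ ℚₚ.*-monoˡ-≤-nonNeg (ℕtoℚ K∞) {{ℕtoℚ-nonNeg K∞}} 1≤εd ⟩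
    ℕtoℚ K∞ ℚ.* (ε ℚ.* ℕtoℚ d)      ≡⟨ solve 3 (λ a b c → a :* (b :* c) := b :* (a :* c)) refl (ℕtoℚ K∞) ε (ℕtoℚ d) ⟩
    ε ℚ.* (ℕtoℚ K∞ ℚ.* ℕtoℚ d)      ≡⟨ cong (ε ℚ.*_) (sym (ℕtoℚ-* K∞ d)) ⟩
    ε ℚ.* ℕtoℚ (K∞ * d)             ≤⟨ ℚₚ.*-monoˡ-≤-nonNeg ε {{ℚ.nonNegative (ℚₚ.<⇒≤ 0<ε)}} (ℕtoℚ-mono (≤-trans N≤n (ℕₚ.m≤m*n n n {{>-nonZero 1≤n}}))) ⟩
    ε ℚ.* ℕtoℚ (n * n)              ∎)
    where
    open +-*-Solver
    d : ℕ
    d = proj₁ (reciprocal-bound ε 0<ε)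
    1≤εd : 1ℚ ℚ.≤ ε ℚ.* ℕtoℚ d
    1≤εd = proj₂ (reciprocal-bound ε 0<ε)
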